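{- Let $S$ be a cut-free net atomically testable by a sequent $A_1,\dots,A_n$. If $S$ is not correct (i.e. $S$ represents no proof of $\mathsf{MLL}^\maltese$), then there exist nets $T_1\in\mathsf{tests}(A_1),\dots,T_n\in\mathsf{tests}(A_n)$ such that the normal form $S_0$ of $S::(T_1\parallel\cdots\parallel T_n)$ is not correct; more precisely, either $S_0$ is a sum of $k\ge 2$ daimon links without outputs ($S_0=\sum_{1\le i\le k}\maltese_0$), or $S_0$ contains a cyclic cut, i.e. a cut link whose two inputs are outputs of the same daimon link.
   Context: **Nets.** Fix a countable set of positions. A hypergraph has a finite set $V$ of positions and a finite set $E$ of labelled links; each link has a source and a target, which are finite sequences of pairwise distinct positions, the source and the target being disjoint. The only links used are: tensor links $\langle p_1,p_2\rhd_\otimes p\rangle$ and par links $\langle p_1,p_2\rhd_\wp p\rangle$ (two inputs, one output), cut links $\langle p_1,p_2\rhd_{\mathsf{cut}}\rangle$ (two inputs, no output), and daimon links $\langle\rhd_\maltese p_1,\dots,p_n\rangle$, $n\ge 0$ (no input). ($\wp$ denotes the par connective.) The sum $H_1+H_2$ takes the union of positions and the disjoint union of links. A conclusion is a position that is in the source of no link. A (multiplicative) net $S$ is a finite sum of such links in which every position is in the target of exactly one link and in the source of at most one link, together with a total order on its conclusions; $S(i)$ is the $i$-th conclusion and $\#S$ the number of conclusions. A net is cut-free if it has no cut link. Nets are considered up to isomorphism. $S\parallel T$ is the disjoint union (after renaming positions), with the conclusions of $S$ ordered before those of $T$. $\maltese_n$ is the net made of one daimon link with $n$ outputs. Initial positions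 are the outputs of daimon links. **Cut elimination.** The interactions $S::(T_1\parallel\cdots\parallel T_n)$ considered here reduce to their normal form using only the homogeneous rules, closed under sum with a context and insensitive to the order of the inputs of cut links: (i) $\langle p_1,p_2\rhd_\wp p\rangle+\langle p,q\rhd_{\mathsf{cut}}\rangle+\langle q_1,q_2\rhd_\otimes q\rangle\to\langle p_1,q_1\rhd_{\mathsf{cut}}\rangle+\langle p_2,q_2\rhd_{\mathsf{cut}}\rangle$; (ii) for two distinct daimon links, $\langle\rhd_\maltese\bar p\rangle+\langle p_i,q_j\rhd_{\mathsf{cut}}\rangle+\langle\rhd_\maltese\bar q\rangle\to\langle\rhd_\maltese\bar p\setminus p_i,\bar q\setminus q_j\rangle$. (The full cut elimination relation also has rules for cuts between a daimon link and a tensor or par link, but no such cut occurs when reducing these interactions.) Homogeneous cut elimination is confluent and strongly normalising (up to the order of the outputs of daimon links). **Interaction.** For nets $S,T$ with $k=\min(\#S,\#T)$, $S::T$ is $S+T+\sum_{1\le i\le k}\langle S(i),T(i)\rhd_{\mathsf{cut}}\rangle$ ($S,T$ made disjoint), the remaining conclusions keeping their order. **Logic.** Propositional variables form a countable set with an involution $X\mapsto X^\bot$. Formulas: $A,B::=X\mid A\wp B\mid A\otimes B$, with $(A\wp B)^\bot=A^\bot\otimes B^\bot$, $(A\otimes B)^\bot=A^\bot\wp B^\bot$. Sequents are finite sequences of formulas. $\mathsf{MLL}^\maltese$ proofs are trees built with the rules: ($\maltese$) infer any $\Gamma$ with no premise; ($\wp$) from $\Gamma,A,B$ infer $\Gamma,A\wp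 B$; ($\otimes$) from $\Gamma,A$ and $\Delta,B$ infer $\Gamma,\Delta,A\otimes B$; (cut) from $\Gamma,A$ and $\Delta,A^\bot$ infer $\Gamma,\Delta$; (ex) exchange of two consecutive formulas. A net $S$ represents a proof $\pi$ of $A_1,\dots,A_n$ (the $i$-th conclusion of $S$ corresponding to $A_i$), inductively: a $\maltese$-rule is represented by a single daimon link $\langle\rhd_\maltese p_1,\dots,p_n\rangle$ with conclusions ordered $p_1,\dots,p_n$; a $\wp$-rule by adding a par link with fresh output to the conclusions for $A,B$ of a net representing the premise; a $\otimes$-rule (resp. cut-rule) by the disjoint sum of nets representing the premises plus a tensor link with fresh output (resp. a cut link) on the conclusions for the two active formulas; exchange by exchanging the two conclusions in the order. A net is correct if it represents some $\mathsf{MLL}^\maltese$ proof. **Atomic testability.** A formula labelling of a cut-free net $S$ is a function $\tau$ from its positions to formulas such that $\tau(p)=\tau(p_1)\wp\tau(p_2)$ for each par link $\langle p_1,p_2\rhd_\wp p\rangle$ and $\tau(p)=\tau(p_1)\otimes\tau(p_2)$ for each tensor link $\langle p_1,p_2\rhd_\otimes p\rangle$ of $S$. It is atomic if every output of every daimon link is labelled by a propositional variable. A cut-free net $S$ with $n$ conclusions is atomically testable by $A_1,\dots,A_n$ if it has an atomic formula labelling $\tau$ with $\tau(S(i))=A_i$ for all $i$. **Natural partitions.** In such a net $S$ there is a binary tree of connective links above each conclusion; each initial position $p$ is determined by the index $i$ of the conclusion $S(i)$ below it and its address, the left/right word leading from $S(i)$ up to $p$. Order the $n$ initial positions lexicographically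 by (index, address), left before right. For a partition $P$ of the initial positions of $S$, $\mathbf{Nat}_S(P)$ is the corresponding partition of $\{1,\dots,n\}$. $\mathsf P_\maltese(S)$ is the partition $\{\mathrm t(d)\mid d\text{ a daimon link of }S\}$, $\mathrm t(d)$ being the set of outputs of $d$. **Switchings.** For a par link $\langle p_1,p_2\rhd_\wp p\rangle$ of a net, a left (resp. right) switching step deletes this link and replaces $p_1$ (resp. $p_2$) by $p$ in the target of the link having it as an output; $p_2$ (resp. $p_1$) becomes a new (last) conclusion. A switching $\sigma S$ of $S$ is a normal form of $S$ for these steps (so it has no par link). Its initial positions are identified with those of $S$ via the replacements. For cut-free $S$, $\uparrow^i\sigma S$ is the partition of the initial positions having one class for each conclusion $q$ of $\sigma S$, namely the set of initial positions above $q$ in $\sigma S$ (those from which $q$ is reached by going repeatedly from an input to an output of a link). **Tests.** A cut-free net $T$ is a test of a formula $A$ if $T$ is atomically testable by $A^\bot$ and there exist a (cut-free) net $S$ atomically testable by $A$ and a switching $\sigma S$ of $S$ such that $\mathbf{Nat}_T(\mathsf P_\maltese(T))=\mathbf{Nat}_S(\uparrow^i\sigma S)$. $\mathsf{tests}(A)$ is the set of tests of $A$. -}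

module Defs where

open import Data.Fin.Base as Fin using (Fin; toℕ)
open import Data.List.Base using (List; []; _∷_; _++_; _∷ʳ_; map; concatMap; drop; foldr; length; lookup; zipWith)
open import Data.List.Membership.Propositional using (_∈_; _∉_)
open import Data.List.Relation.Binary.Disjoint.Propositional using (Disjoint)
open import Data.List.Relation.Binary.Lex.Strict using (Lex-<)
open import Data.List.Relation.Binary.Permutation.Propositional using (_↭_)
open import Data.List.Relation.Unary.All using (All)
open import Data.List.Relation.Unary.AllPairs using (AllPairs)
open import Data.List.Relation.Unary.Unique.Propositional using (Unique)
open import Data.Nat.Base using (ℕ; suc; _*_)
open import Data.Nat.Properties using (_≟_)
open import Data.Product.Base using (Σ; _×_; _,_; ∃; ∃-syntax; Σ-syntax)
open import Data.Product.Relation.Binary.Lex.Strict using (×-Lex)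
open import Data.Bool.Base using (if_then_else_)
open import Function.Base using (_∘_; id)
open import Function.Bundles using (_↣_; _⇔_)
open import Relation.Binary.Construct.Closure.ReflexiveTransitive using (Star)
open import Relation.Binary.PropositionalEquality.Core using (_≡_; _≢_)
open import Relation.Binary.Rewriting using (IsNormalForm)
open import Relation.Nullary.Decidable.Core using (does)
open import Relation.Nullary.Negation.Core using (¬_)
open import Relation.Unary using (Pred; _≐_)
open import Level using (0ℓ)

Position : Set
Position = ℕ

data Connective : Set where
  tensor par : Connective

-- conn c p₁ p₂ p is ⟨p₁,p₂ ▷ p⟩ labelled by c.
data Link : Set where
  conn   : (c : Connective) (p₁ p₂ p : Position) → Link
  cut    : (p₁ p₂ : Position) → Link
  daimon : (ps : List Position) → Link

source target ends : Link → List Position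
source (conn c p₁ p₂ p) = p₁ ∷ p₂ ∷ []
source (cut p₁ p₂)      = p₁ ∷ p₂ ∷ []
source (daimon ps)      = []
target (conn c p₁ p₂ p) = p ∷ []
target (cut p₁ p₂)      = []
target (daimon ps)      = ps
ends l = source l ++ target l

-- The links form a finite family, so repetitions count (there may be
-- several daimon links without outputs) but order does not: links are
-- always compared up to _↭_.  The positions are those of the links.
-- The order of `conclusions` is the total order on conclusions.
record Hypergraph : Set where
  constructor hypergraph
  field
    links       : List Link
    conclusions : List Position

open Hypergraph public

sources targets positions : Hypergraph → List Position
sources   = concatMap source ∘ links
targets   = concatMap target ∘ links
positions = concatMap ends ∘ links

record IsNet (S : Hypergraph) : Set where
  field
    -- The empty sum is not a net.
    nonEmpty           : links S ≢ []
    linksWellFormed    : All (Unique ∘ ends) (links S)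
    atMostOneTarget    : Unique (targets S)
    atLeastOneTarget   : ∀ {p} → p ∈ positions S → p ∈ targets S
    atMostOneSource    : Unique (sources S)
    conclusionsOrdered : Unique (conclusions S)
    conclusionsExact   : ∀ {p} → p ∈ conclusions S ⇔ (p ∈ positions S × p ∉ sources S)

CutFree : Hypergraph → Set
CutFree S = ∀ {p q} → cut p q ∉ links S

Initial : Hypergraph → Pred Position 0ℓ
Initial S p = ∃[ ps ] daimon ps ∈ links S × p ∈ ps

renameLink : (Position → Position) → Link → Link
renameLink f (conn c p₁ p₂ p) = conn c (f p₁) (f p₂) (f p)
renameLink f (cut p₁ p₂)      = cut (f p₁) (f p₂)
renameLink f (daimon ps)      = daimon (map f ps)

infix 4 _≅_

record _≅_ (S T : Hypergraph) : Set where
  field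
    rename       : Position → Position
    injective    : ∀ {p q} → p ∈ positions S → q ∈ positions S → rename p ≡ rename q → p ≡ q
    links↭       : map (renameLink rename) (links S) ↭ links T
    conclusions≡ : map rename (conclusions S) ≡ conclusions T

-- Even and odd renamings make the two operands of a sum disjoint.
inˡ inʳ : Position → Position
inˡ p = 2 * p
inʳ p = suc (2 * p)

infixr 6 _∥_
infix  5 _::_

_∥_ : Hypergraph → Hypergraph → Hypergraph
S ∥ T = hypergraph
  (map (renameLink inˡ) (links S) ++ map (renameLink inʳ) (links T))
  (map inˡ (conclusions S) ++ map inʳ (conclusions T))

∥⋯∥ : List Hypergraph → Hypergraph
∥⋯∥ = foldr _∥_ (hypergraph [] [])

-- zipWith stops at the shorter list, and one of the two lists of
-- remaining conclusions is empty.
_::_ : Hypergraph → Hypergraph → Hypergraph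
S :: T = hypergraph
  (zipWith cut (map inˡ (conclusions S)) (map inʳ (conclusions T)) ++ links (S ∥ T))
  (drop (length (conclusions T)) (map inˡ (conclusions S)) ++
   drop (length (conclusions S)) (map inʳ (conclusions T)))

-- Cut links are insensitive to the order of their inputs.
data CutOf (p q : Position) : Pred Link 0ℓ where
  direct  : CutOf p q (cut p q)
  swapped : CutOf p q (cut q p)

infix 4 _⟿_ _⟶_ _⟶*_

data _⟿_ : List Link → List Link → Set where
  multiplicative : ∀ {p₁ p₂ p q₁ q₂ q l} → CutOf p q l →
    conn par p₁ p₂ p ∷ l ∷ conn tensor q₁ q₂ q ∷ [] ⟿ cut p₁ q₁ ∷ cut p₂ q₂ ∷ []
  glueing : ∀ {ps ps′ qs qs′ p q l} → CutOf p q l →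
    daimon (ps ++ p ∷ ps′) ∷ l ∷ daimon (qs ++ q ∷ qs′) ∷ [] ⟿
    daimon ((ps ++ ps′) ++ (qs ++ qs′)) ∷ []

data _⟶_ (S : Hypergraph) : Hypergraph → Set where
  inContext : ∀ {redex reduct} context → redex ⟿ reduct →
    links S ↭ redex ++ context →
    S ⟶ hypergraph (reduct ++ context) (conclusions S)

_⟶*_ : Hypergraph → Hypergraph → Set
_⟶*_ = Star _⟶_

NormalFormOf : Hypergraph → Hypergraph → Set
NormalFormOf S S₀ = S ⟶* S₀ × IsNormalForm _⟶_ S₀

CyclicCut : Hypergraph → Set
CyclicCut S = ∃[ p ] ∃[ q ] ∃[ ps ] cut p q ∈ links S × daimon ps ∈ links S × p ∈ ps × q ∈ ps

_[_↦_] : (Position → Position) → Position → Position → Position → Position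
(f [ p ↦ q ]) x = if does (f x ≟ p) then q else f x

mapTarget : (Position → Position) → Link → Link
mapTarget f (conn c p₁ p₂ p) = conn c p₁ p₂ (f p)
mapTarget f (cut p₁ p₂)      = cut p₁ p₂
mapTarget f (daimon ps)      = daimon (map f ps)

-- A hypergraph obtained by switching, with the identification of the
-- initial positions of the original net with its own.
SwitchState : Set
SwitchState = Hypergraph × (Position → Position)

infix 4 _⟶ₛ_

data _⟶ₛ_ : SwitchState → SwitchState → Set where
  left : ∀ {S ι p₁ p₂ p} context → links S ↭ conn par p₁ p₂ p ∷ context →
    (S , ι) ⟶ₛ
    (hypergraph (map (mapTarget (id [ p₁ ↦ p ])) context) (conclusions S ∷ʳ p₂) , ι [ p₁ ↦ p ])
  right : ∀ {S ι p₁ p₂ p} context → links S ↭ conn par p₁ p₂ p ∷ context →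
    (S , ι) ⟶ₛ
    (hypergraph (map (mapTarget (id [ p₂ ↦ p ])) context) (conclusions S ∷ʳ p₁) , ι [ p₂ ↦ p ])

IsSwitching : Hypergraph → SwitchState → Set
IsSwitching S σS = Star _⟶ₛ_ (S , id) σS × IsNormalForm _⟶ₛ_ σS

-- A set of subsets of A, given as a family.
Classes : Set → Set₁
Classes A = Σ[ I ∈ Set ] (I → Pred A 0ℓ)

infix 4 _≋_

_≋_ : ∀ {A} → Classes A → Classes A → Set
(I , P) ≋ (J , Q) = (∀ i → ∃[ j ] P i ≐ Q j) × (∀ j → ∃[ i ] P i ≐ Q j)

-- A daimon link without outputs contributes the empty class.
P✠ : Hypergraph → Classes Position
P✠ S = (∃[ ps ] daimon ps ∈ links S) , λ (ps , _) p → p ∈ ps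

Below : Hypergraph → Position → Position → Set
Below S p q = ∃[ l ] l ∈ links S × p ∈ source l × q ∈ target l

↑ⁱ : Hypergraph → SwitchState → Classes Position
↑ⁱ S (σS , ι) = (∃[ q ] q ∈ conclusions σS) , λ (q , _) p → Initial S p × Star (Below σS) (ι p) q

data Side : Set where
  left right : Side

data _<ₛ_ : Side → Side → Set where
  left<right : left <ₛ right

Address : Set
Address = List Side

data AtAddress (S : Hypergraph) : Position → Address → Position → Set where
  here  : ∀ {p} → AtAddress S p [] p
  left  : ∀ {c p₁ p₂ p w r} → conn c p₁ p₂ p ∈ links S → AtAddress S p₁ w r → AtAddress S p (left ∷ w) r
  right : ∀ {c p₁ p₂ p w r} → conn c p₁ p₂ p ∈ links S → AtAddress S p₂ w r → AtAddress S p (right ∷ w) r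

Location : Hypergraph → Set
Location S = Fin (length (conclusions S)) × Address

Located : (S : Hypergraph) → Position → Location S → Set
Located S p (i , w) = AtAddress S (lookup (conclusions S) i) w p

_≺_ : ∀ {S} → Location S → Location S → Set
_≺_ = ×-Lex _≡_ Fin._<_ (Lex-< _≡_ _<ₛ_)

NaturallyBefore : Hypergraph → Position → Position → Set
NaturallyBefore S p q = ∃[ u ] ∃[ v ] Located S p u × Located S q v × _≺_ {S} u v

-- ps lists the initial positions of S in their natural order.
record NaturalOrder (S : Hypergraph) (ps : List Position) : Set where
  field
    initial : ∀ {p} → p ∈ ps ⇔ Initial S p
    sorted  : AllPairs (NaturallyBefore S) ps

-- Nat ps P transports P to {1,…,n} along the enumeration ps.
Nat : List Position → Classes Position → Classes ℕ
Nat ps (I , P) = I , λ i k → ∃[ j ] suc (toℕ j) ≡ k × P i (lookup ps j)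

record PropositionalVariables : Set₁ where
  field
    Variable   : Set
    _ᗮ         : Variable → Variable
    involutive : ∀ X → (X ᗮ) ᗮ ≡ X
    countable  : Variable ↣ ℕ

dualConnective : Connective → Connective
dualConnective tensor = par
dualConnective par    = tensor

module MLL✠ (𝒱 : PropositionalVariables) where

  open PropositionalVariables 𝒱

  infixr 7 _⊗_ _⅋_
  infix  3 ⊢_

  data Formula : Set where
    var      : Variable → Formula
    compound : Connective → Formula → Formula → Formula

  pattern _⊗_ A B = compound tensor A B
  pattern _⅋_ A B = compound par A B

  dual : Formula → Formula
  dual (var X)          = var (X ᗮ)
  dual (compound c A B) = compound (dualConnective c) (dual A) (dual B)

  Sequent : Set
  Sequent = List Formula

  data ⊢_ : Sequent → Set where
    ✠-rule   : ∀ Γ → ⊢ Γ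
    ⅋-rule   : ∀ Γ {A B} → ⊢ Γ ++ A ∷ B ∷ [] → ⊢ Γ ∷ʳ A ⅋ B
    ⊗-rule   : ∀ Γ Δ {A B} → ⊢ Γ ∷ʳ A → ⊢ Δ ∷ʳ B → ⊢ Γ ++ Δ ++ A ⊗ B ∷ []
    cut-rule : ∀ Γ Δ {A} → ⊢ Γ ∷ʳ A → ⊢ Δ ∷ʳ dual A → ⊢ Γ ++ Δ
    ex-rule  : ∀ Γ Δ {A B} → ⊢ Γ ++ A ∷ B ∷ Δ → ⊢ Γ ++ B ∷ A ∷ Δ

  data Represents : ∀ {Γ} → Hypergraph → ⊢ Γ → Set where
    ✠ : ∀ {Γ ps} → Unique ps → length ps ≡ length Γ →
      Represents (hypergraph (daimon ps ∷ []) ps) (✠-rule Γ)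
    ⅋ : ∀ {Γ A B ls cs p₁ p₂ p} {π : ⊢ Γ ++ A ∷ B ∷ []} →
      let S = hypergraph ls (cs ++ p₁ ∷ p₂ ∷ []) in
      Represents S π → p ∉ positions S →
      Represents (hypergraph (conn par p₁ p₂ p ∷ ls) (cs ∷ʳ p)) (⅋-rule Γ π)
    ⊗ : ∀ {Γ Δ A B ls ks cs ds p₁ p₂ p} {π : ⊢ Γ ∷ʳ A} {ρ : ⊢ Δ ∷ʳ B} →
      let S = hypergraph ls (cs ∷ʳ p₁)
          T = hypergraph ks (ds ∷ʳ p₂) in
      Represents S π → Represents T ρ → Disjoint (positions S) (positions T) →
      p ∉ positions S → p ∉ positions T →
      Represents (hypergraph (conn tensor p₁ p₂ p ∷ ls ++ ks) (cs ++ ds ++ p ∷ [])) (⊗-rule Γ Δ π ρ)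
    cut : ∀ {Γ Δ A ls ks cs ds p₁ p₂} {π : ⊢ Γ ∷ʳ A} {ρ : ⊢ Δ ∷ʳ dual A} →
      let S = hypergraph ls (cs ∷ʳ p₁)
          T = hypergraph ks (ds ∷ʳ p₂) in
      Represents S π → Represents T ρ → Disjoint (positions S) (positions T) →
      Represents (hypergraph (cut p₁ p₂ ∷ ls ++ ks) (cs ++ ds)) (cut-rule Γ Δ π ρ)
    ex : ∀ {Γ Δ A B ls cs ds p q} {π : ⊢ Γ ++ A ∷ B ∷ Δ} → length cs ≡ length Γ →
      Represents (hypergraph ls (cs ++ p ∷ q ∷ ds)) π →
      Represents (hypergraph ls (cs ++ q ∷ p ∷ ds)) (ex-rule Γ Δ π)
    -- Nets are considered up to isomorphism.
    iso : ∀ {Γ S T} {π : ⊢ Γ} → S ≅ T → Represents S π → Represents T π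

  Correct : Hypergraph → Set
  Correct S = ∃[ Γ ] Σ[ π ∈ ⊢ Γ ] Represents S π

  IsLabelling : Hypergraph → (Position → Formula) → Set
  IsLabelling S τ = ∀ {c p₁ p₂ p} → conn c p₁ p₂ p ∈ links S → τ p ≡ compound c (τ p₁) (τ p₂)

  IsAtomic : Hypergraph → (Position → Formula) → Set
  IsAtomic S τ = ∀ {p} → Initial S p → ∃[ X ] τ p ≡ var X

  -- A labelling is a total function of which only the values on the
  -- positions of S matter.
  record AtomicallyTestable (S : Hypergraph) (Γ : Sequent) : Set where
    field
      isNet     : IsNet S
      cutFree   : CutFree S
      τ         : Position → Formula
      labelling : IsLabelling S τ
      atomic    : IsAtomic S τ
      labels    : map τ (conclusions S) ≡ Γ

  infix 4 _∈tests_

  record _∈tests_ (T : Hypergraph) (A : Formula) : Set where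
    field
      testable   : AtomicallyTestable T (dual A ∷ [])
      S          : Hypergraph
      S-testable : AtomicallyTestable S (A ∷ [])
      σS         : SwitchState
      switching  : IsSwitching S σS
      T-order    : List Position
      T-natural  : NaturalOrder T T-order
      S-order    : List Position
      S-natural  : NaturalOrder S S-order
      matches    : Nat T-order (P✠ T) ≋ Nat S-order (↑ⁱ S σS)

{-# OPTIONS --safe #-}
module Submission where

-- Every S :: T₁ ∥ ⋯ ∥ Tₙ has the same Euler characteristic χ = #daimons − #tensors − #cuts as S, and
-- reduction preserves χ; if χ ≠ 1 then every choice of tests leads to k = χ daimon links or to a cyclic cut.
--
-- If χ = 1, parse S into correct subnets, starting from its daimon links: there is always one subnet more
-- than remaining tensor links.  A par link with both premises in one subnet is absorbed by it.  Otherwise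
-- either every subnet contains a premise of a remaining tensor link, and by the pigeonhole principle two
-- subnets share such a link, which merges them; or some subnet is joined to the rest by par links only,
-- each with a premise outside, so that the switching following those premises disconnects it.
--
-- Such a switching is recorded as a 2-colouring of the positions of S, which determines the tests.  Labelling
-- positions by formulas whose variables are the colours, cuts relate dual labels and each daimon link has one
-- colour; reduction preserves both colours, so that a normal form has two daimon links or a cyclic cut.

open import Defs
open import Data.Bool.Base using (Bool; true; false; if_then_else_)
import Data.Bool.Properties as Bool
open import Data.Empty using (⊥; ⊥-elim)
open import Data.Fin.Base using (zero; toℕ)
open import Data.Integer.Base as ℤ using (ℤ; 0ℤ; 1ℤ; -1ℤ)
import Data.Integer.Properties as ℤ
open import Data.Integer.Tactic.RingSolver using (solve-∀)
open import Data.List.Base using (List; []; _∷_; _++_; _∷ʳ_; map; concat; concatMap; length; lookup; replicate; zipWith; drop)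
open import Data.List.Membership.Propositional using (_∈_; _∉_; find; lose)
open import Data.List.Membership.Propositional.Properties
  using (∈-++⁺ˡ; ∈-++⁺ʳ; ∈-++⁻; ∈-∃++; ∈-map⁺; ∈-map⁻; ∈-concat⁻′; ∈-concat⁺′; ∈-concatMap⁺; ∈-concatMap⁻)
open import Data.List.Properties
  using (++-assoc; ++-identityʳ; ∷ʳ-++; ∷-injective; map-++; map-id; map-cong; map-∘; length-map; length-++; length-replicate;
         concat-++; concatMap-++; drop-all)
open import Data.List.Relation.Binary.Disjoint.Propositional using (Disjoint)
open import Data.List.Relation.Binary.Lex.Core using (this; next)
open import Data.List.Relation.Binary.Lex.Strict using (Lex-<)
open import Data.List.Relation.Binary.Permutation.Propositional using (_↭_; refl; prep; swap; trans; ↭-sym; ↭-reflexive; ↭⇒↭ₛ)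
open import Data.List.Relation.Binary.Permutation.Propositional.Properties
  using (All-resp-↭; ∈-resp-↭; drop-∷; ++⁺; ++⁺ˡ; ++⁺ʳ; ++-comm; ++-commutativeMonoid; shift; shifts; ∷↭∷ʳ; map⁺; ↭-map-inv; ↭-length)
import Data.List.Relation.Binary.Permutation.Setoid.Properties as PermutationSetoid
open import Data.List.Relation.Binary.Pointwise using (Pointwise; []; _∷_)
open import Data.List.Relation.Unary.All using (All; []; _∷_)
import Data.List.Relation.Unary.All as All
import Data.List.Relation.Unary.All.Properties as All
open import Data.List.Relation.Unary.AllPairs using (AllPairs; []; _∷_)
import Data.List.Relation.Unary.AllPairs as AllPairs
import Data.List.Relation.Unary.AllPairs.Properties as AllPairs
open import Data.List.Relation.Unary.Any using (Any; here; there; any?)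
open import Data.List.Relation.Unary.Unique.Propositional using (Unique)
import Data.List.Relation.Unary.Unique.Propositional.Properties as Unique
open import Data.Nat.Base as ℕ using (ℕ; zero; suc; _<_; _≤_; s≤s; z≤n; s≤s⁻¹)
open import Data.Nat.ListAction using (sum)
import Data.Nat.Properties as ℕ
open import Data.List.Membership.DecPropositional ℕ._≟_ using (_∈?_)
open import Data.Product.Base using (_×_; _,_; proj₁; proj₂; ∃-syntax; Σ-syntax)
open import Data.Sum.Base using (_⊎_; inj₁; inj₂; [_,_]′)
open import Function.Base using (id; _∘_)
open import Function.Bundles using (mk⇔; mk↣; module Equivalence)
open import Relation.Binary.Construct.Closure.ReflexiveTransitive using (Star; ε; _◅_; _◅◅_)
open import Relation.Binary.PropositionalEquality
  using (_≡_; _≢_; refl; sym; cong; cong₂; subst; subst₂; setoid) renaming (trans to ≡-trans)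
open import Relation.Binary.Rewriting using (IsNormalForm)
open import Relation.Nullary.Decidable using (Dec; yes; no; _×-dec_; _⊎-dec_; does; dec-true; dec-false)
open import Relation.Nullary.Negation.Core using (¬_; contradiction)
open import Relation.Unary using (_≐_)

-- Tests have χ = 1: their tensor links are the par links of the switched tree, dualised, and their
-- daimon links are its classes, one for the root and one for each par link. Each test comes with
-- one cut, which compensates it, so the interaction keeps the χ of `S`. A colouring turns
-- disconnectedness, a global property of a switching, into conditions local to each link. Par links
-- are switched towards a premise of their own colour, so each class, hence each daimon link of a
-- test, has a single colour. The involution on colours is the identity: a cut between dual
-- variables joins equal colours, and glueing never mixes them. The statement is about every normal
-- form, so χ and the colours are carried along arbitrary reductions. A closed net without cuts has
-- no positions left, and reduction never erases the last link; the only outcome to exclude is then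
-- k = 1, which is what χ ≠ 1 or the survival of both colours does. Incorrectness is finally read
-- off representations: none contains a cyclic cut, and none consists of several empty daimon links.

private variable
  A B : Set

-- Lists up to permutation

module _ {A : Set} where
  open import Algebra.Solver.CommutativeMonoid (++-commutativeMonoid {A = A}) public
    using (_⊕_; _⊜_) renaming (solve to solve↭; id to ∅)

Unique-resp-↭ : {xs ys : List A} → xs ↭ ys → Unique xs → Unique ys
Unique-resp-↭ {A = A} p = PermutationSetoid.Unique-resp-↭ (setoid A) (↭⇒↭ₛ p)

Unique-++⁻ : ∀ (xs : List A) {ys} → Unique (xs ++ ys) → Unique xs × Unique ys × Disjoint xs ys
Unique-++⁻ []       u        = [] , u , λ ()
Unique-++⁻ (x ∷ xs) (x≢ ∷ u) with Unique-++⁻ xs u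
... | uˡ , uʳ , disjoint = All.++⁻ˡ xs x≢ ∷ uˡ , uʳ , λ where
  (here refl , v∈ys) → All.lookup (All.++⁻ʳ xs x≢) v∈ys refl
  (there v∈xs , v∈ys) → disjoint (v∈xs , v∈ys)

Unique-head : {x : A} {xs : List A} → Unique (x ∷ xs) → x ∉ xs
Unique-head (x≢ ∷ _) x∈xs = All.lookup x≢ x∈xs refl

Unique-tail : {x : A} {xs : List A} → Unique (x ∷ xs) → Unique xs
Unique-tail (_ ∷ u) = u

++-cancelˡ-↭ : ∀ (xs : List A) {ys zs} → xs ++ ys ↭ xs ++ zs → ys ↭ zs
++-cancelˡ-↭ []       p = p
++-cancelˡ-↭ (x ∷ xs) p = ++-cancelˡ-↭ xs (drop-∷ p)

∈⇒↭ : {x : A} {xs : List A} → x ∈ xs → ∃[ ys ] xs ↭ x ∷ ys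
∈⇒↭ x∈xs with ∈-∃++ x∈xs
... | ys , zs , refl = ys ++ zs , shift _ ys zs

∈⇒↭₂ : {x y : A} {xs : List A} → x ≢ y → x ∈ xs → y ∈ xs → ∃[ ys ] xs ↭ x ∷ y ∷ ys
∈⇒↭₂ x≢y x∈xs y∈xs with ∈⇒↭ x∈xs
... | ys , p with ∈-resp-↭ p y∈xs
...   | here refl   = contradiction refl x≢y
...   | there y∈ys with ∈⇒↭ y∈ys
...     | zs , q = zs , trans p (prep _ q)

concatMap-↭ : ∀ (f : A → List B) {xs ys} → xs ↭ ys → concatMap f xs ↭ concatMap f ys
concatMap-↭ f refl        = refl
concatMap-↭ f (prep x p)  = ++⁺ˡ (f x) (concatMap-↭ f p)
concatMap-↭ f (swap x y p) = trans (shifts (f x) (f y)) (++⁺ˡ (f y) (++⁺ˡ (f x) (concatMap-↭ f p)))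
concatMap-↭ f (trans p q) = trans (concatMap-↭ f p) (concatMap-↭ f q)

∈-concatMap : ∀ (f : A → List B) {x xs y} → x ∈ xs → y ∈ f x → y ∈ concatMap f xs
∈-concatMap f x∈xs y∈fx = ∈-concatMap⁺ f (lose x∈xs y∈fx)

concatMap-∈⁻ : ∀ (f : A → List B) xs {y} → y ∈ concatMap f xs → ∃[ x ] x ∈ xs × y ∈ f x
concatMap-∈⁻ f xs y∈ = find (∈-concatMap⁻ f {xs = xs} y∈)

Unique-concatMap⁻ : ∀ (f : A → List B) {x xs} → Unique (concatMap f xs) → x ∈ xs → Unique (f x)
Unique-concatMap⁻ f {xs = x ∷ xs} u (here refl)  = proj₁ (Unique-++⁻ (f x) u)
Unique-concatMap⁻ f {xs = x ∷ xs} u (there x∈xs) = Unique-concatMap⁻ f (proj₁ (proj₂ (Unique-++⁻ (f x) u))) x∈xs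

-- With `target` or `source` for `f`, this is how links sharing an output or an input are identified
-- in a net.
Unique-concatMap⇒≡ : ∀ (f : A → List B) {x x′ xs y} → Unique (concatMap f xs) →
  x ∈ xs → x′ ∈ xs → y ∈ f x → y ∈ f x′ → x ≡ x′
Unique-concatMap⇒≡ f {xs = x ∷ xs} u (here refl)  (here refl)   y∈ y∈′ = refl
Unique-concatMap⇒≡ f {xs = x ∷ xs} u (here refl)  (there x′∈xs) y∈ y∈′ =
  ⊥-elim (proj₂ (proj₂ (Unique-++⁻ (f x) u)) (y∈ , ∈-concatMap f x′∈xs y∈′))
Unique-concatMap⇒≡ f {xs = x ∷ xs} u (there x∈xs) (here refl)   y∈ y∈′ =
  ⊥-elim (proj₂ (proj₂ (Unique-++⁻ (f x) u)) (y∈′ , ∈-concatMap f x∈xs y∈))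
Unique-concatMap⇒≡ f {xs = x ∷ xs} u (there x∈xs) (there x′∈xs) =
  Unique-concatMap⇒≡ f (proj₁ (proj₂ (Unique-++⁻ (f x) u))) x∈xs x′∈xs

Unique-⇔⇒↭ : {xs ys : List A} → Unique xs → Unique ys →
  (∀ {v} → v ∈ xs → v ∈ ys) → (∀ {v} → v ∈ ys → v ∈ xs) → xs ↭ ys
Unique-⇔⇒↭ {xs = []} {[]}     _ _ _ _ = refl
Unique-⇔⇒↭ {xs = []} {y ∷ ys} _ _ _ ⊇ with () ← ⊇ (here refl)
Unique-⇔⇒↭ {xs = x ∷ xs} u v ⊆ ⊇ with ∈⇒↭ (⊆ (here refl))
... | zs , p = trans (prep x (Unique-⇔⇒↭ (Unique-tail u) (Unique-tail v′) ⊆′ ⊇′)) (↭-sym p)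
  where
  v′ = Unique-resp-↭ p v
  ⊆′ : ∀ {w} → w ∈ xs → w ∈ zs
  ⊆′ w∈xs with ∈-resp-↭ p (⊆ (there w∈xs))
  ... | here refl = contradiction w∈xs (Unique-head u)
  ... | there w∈zs = w∈zs
  ⊇′ : ∀ {w} → w ∈ zs → w ∈ xs
  ⊇′ w∈zs with ⊇ (∈-resp-↭ (↭-sym p) (there w∈zs))
  ... | here refl = contradiction w∈zs (Unique-head v′)
  ... | there w∈xs = w∈xs

-- Sources, targets and the balance of a net

sourcesOf targetsOf : List Link → List Position
sourcesOf = concatMap source
targetsOf = concatMap target

Triple : Set
Triple = Position × Position × Position

link : Connective → Triple → Link
link c (p₁ , p₂ , p) = conn c p₁ p₂ p

source⇒position : ∀ ls {p} → p ∈ sourcesOf ls → p ∈ concatMap ends ls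
source⇒position ls p∈ with concatMap-∈⁻ source ls p∈
... | l , l∈ , p∈l = ∈-concatMap ends {xs = ls} l∈ (∈-++⁺ˡ p∈l)

target⇒position : ∀ ls {p} → p ∈ targetsOf ls → p ∈ concatMap ends ls
target⇒position ls p∈ with concatMap-∈⁻ target ls p∈
... | l , l∈ , p∈l = ∈-concatMap ends {xs = ls} l∈ (∈-++⁺ʳ (source l) p∈l)

position⇒source⊎target : ∀ ls {p} → p ∈ concatMap ends ls → p ∈ sourcesOf ls ⊎ p ∈ targetsOf ls
position⇒source⊎target ls p∈ with concatMap-∈⁻ ends ls p∈
... | l , l∈ , p∈l with ∈-++⁻ (source l) p∈l
...   | inj₁ s = inj₁ (∈-concatMap source {xs = ls} l∈ s)
...   | inj₂ t = inj₂ (∈-concatMap target {xs = ls} l∈ t)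

module _ {S : Hypergraph} (S-net : IsNet S) where
  open IsNet S-net

  -- The membership conditions of `IsNet` are condensed into one permutation, which can be summed,
  -- rearranged and cancelled; `balanced⇒IsNet` is the way back.
  IsNet⇒balanced : targets S ↭ sources S ++ conclusions S
  IsNet⇒balanced = Unique-⇔⇒↭ atMostOneTarget
    (Unique.++⁺ atMostOneSource conclusionsOrdered λ (s , c) → proj₂ (Equivalence.to conclusionsExact c) s) ⊆ ⊇
    where
    ⊆ : ∀ {p} → p ∈ targets S → p ∈ sources S ++ conclusions S
    ⊆ {p} p∈ with p ∈? sources S
    ... | yes s = ∈-++⁺ˡ s
    ... | no ¬s = ∈-++⁺ʳ (sources S) (Equivalence.from conclusionsExact (target⇒position (links S) p∈ , ¬s))
    ⊇ : ∀ {p} → p ∈ sources S ++ conclusions S → p ∈ targets S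
    ⊇ p∈ with ∈-++⁻ (sources S) p∈
    ... | inj₁ s = atLeastOneTarget (source⇒position (links S) s)
    ... | inj₂ c = atLeastOneTarget (proj₁ (Equivalence.to conclusionsExact c))

-- Sequentialisation

renameLink-id : ∀ l → renameLink id l ≡ l
renameLink-id (conn c p₁ p₂ p) = refl
renameLink-id (cut p₁ p₂)      = refl
renameLink-id (daimon ps)      = cong daimon (map-id ps)

-- A colouring stands for a switching: if each par link follows a premise of its own colour, every
-- connected component of the result has one colour. `Separates` adds that both colours occur.
record Colouring (S : Hypergraph) (colour : Position → Bool) : Set where
  field
    tensorMono : ∀ {p₁ p₂ p} → conn tensor p₁ p₂ p ∈ links S → colour p₁ ≡ colour p × colour p₂ ≡ colour p
    parMono    : ∀ {p₁ p₂ p} → conn par p₁ p₂ p ∈ links S → colour p₁ ≡ colour p ⊎ colour p₂ ≡ colour p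
    daimonMono : ∀ {ps} → daimon ps ∈ links S → ∃[ b ] All (λ p → colour p ≡ b) ps

-- Two occurrences are split off the list, since links may repeat and a daimon link without outputs
-- satisfies both colour conditions.
Separates : List Link → (Position → Bool) → Set
Separates ls colour = ∃[ ps ] ∃[ qs ] ∃[ ks ] ls ↭ daimon ps ∷ daimon qs ∷ ks ×
  All (λ p → colour p ≡ true) ps × All (λ p → colour p ≡ false) qs

-- Induction on `ys`: a `y` related to nothing is dropped, a `y` related to a single `x` is dropped
-- together with it, and a `y` related to two occurrences gives the second outcome.
pigeonhole : ∀ {R : A → B → Set} → (∀ x y → Dec (R x y)) → ∀ xs ys → length ys < length xs →
  (∃[ x ] x ∈ xs × (∀ {y} → y ∈ ys → ¬ R x y)) ⊎
  (∃[ x ] ∃[ x′ ] ∃[ zs ] ∃[ y ] xs ↭ x ∷ x′ ∷ zs × y ∈ ys × R x y × R x′ y)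
pigeonhole R? (x ∷ xs) [] _ = inj₁ (x , here refl , λ ())
pigeonhole {A = A} {R = R} R? xs (y ∷ ys) <xs with any? (λ x → R? x y) xs
... | no none = weaken (pigeonhole R? xs ys (ℕ.<-trans (ℕ.n<1+n _) <xs))
  where
  weaken : _ → _
  weaken (inj₁ (x , x∈ , fresh)) = inj₁ (x , x∈ , λ where
    (here refl) r → none (lose x∈ r)
    (there y∈) r → fresh y∈ r)
  weaken (inj₂ (x , x′ , zs , y , p , y∈ , r , r′)) = inj₂ (x , x′ , zs , y , p , there y∈ , r , r′)
... | yes some with find some
...   | x , x∈ , Rxy with ∈⇒↭ x∈
...     | xs′ , p with any? (λ x → R? x y) xs′
...       | yes some′ with find some′
...         | x′ , x′∈ , Rx′y with ∈⇒↭ x′∈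
...           | zs , q = inj₂ (x , x′ , zs , y , trans p (prep _ q) , here refl , Rxy , Rx′y)
pigeonhole {A = A} {R = R} R? xs (y ∷ ys) <xs | yes _ | x , x∈ , Rxy | xs′ , p | no none =
  weaken (pigeonhole R? xs′ ys (s≤s⁻¹ (subst (_ <_) (↭-length p) <xs)))
  where
  weaken : _ → _
  weaken (inj₁ (x′ , x′∈ , fresh)) = inj₁ (x′ , ∈-resp-↭ (↭-sym p) (there x′∈) , λ where
    (here refl) r → none (lose x′∈ r)
    (there y∈) r → fresh y∈ r)
  weaken (inj₂ (x₁ , x₂ , zs , y , q , y∈ , r , r′)) =
    inj₂ (x₁ , x₂ , x ∷ zs , y , trans p (trans (prep x q) (trans (swap x x₁ refl) (prep x₁ (swap x x₂ refl)))) , there y∈ , r , r′)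

module Sequentialisation (𝒱 : PropositionalVariables) where
  open MLL✠ 𝒱

  Proves : List Link → List Position → Sequent → Set
  Proves ls cs Γ = Σ[ π ∈ ⊢ Γ ] Represents (hypergraph ls cs) π

  -- The rules of `Represents` fix an order of the links; the isomorphism with identity renaming
  -- makes it irrelevant.
  Proves-resp-↭ : ∀ {ls ls′ cs Γ} → ls ↭ ls′ → Proves ls cs Γ → Proves ls′ cs Γ
  Proves-resp-↭ {ls} {cs = cs} p (π , r) = π , iso record
    { rename       = id
    ; injective    = λ _ _ eq → eq
    ; links↭       = trans (↭-reflexive (≡-trans (map-cong renameLink-id ls) (map-id ls))) p
    ; conclusions≡ = map-id cs
    } r

  module _ (τ : Position → Formula) where

    private
      Proved : List Link → List Position → Set
      Proved ls cs = Proves ls cs (map τ cs)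

    transpose : ∀ {ls} cs {p q ds} → Proved ls (cs ++ p ∷ q ∷ ds) → Proved ls (cs ++ q ∷ p ∷ ds)
    transpose {ls} cs {p} {q} {ds} r with subst (Proves ls _) (map-++ τ cs (p ∷ q ∷ ds)) r
    ... | π , ρ = subst (Proves ls _) (sym (map-++ τ cs (q ∷ p ∷ ds))) (ex-rule (map τ cs) _ π , ex (sym (length-map τ cs)) ρ)

    -- A permutation is a composite of adjacent transpositions. The prefix `cs` is general because
    -- the head of a `prep` moves into it.
    exchange : ∀ {ls} cs {ds ds′} → ds ↭ ds′ → Proved ls (cs ++ ds) → Proved ls (cs ++ ds′)
    exchange cs refl r = r
    exchange {ls} cs (prep p σ) r =
      subst (Proved ls) (∷ʳ-++ cs p _) (exchange (cs ∷ʳ p) σ (subst (Proved ls) (sym (∷ʳ-++ cs p _)) r))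
    exchange {ls} cs (swap p q σ) r = transpose cs
      (subst (Proved ls) (++-assoc cs (p ∷ q ∷ []) _) (exchange (cs ++ p ∷ q ∷ []) σ (subst (Proved ls) (sym (++-assoc cs (p ∷ q ∷ []) _)) r)))
    exchange cs (trans σ σ′) r = exchange cs σ′ (exchange cs σ r)

    -- A subnet already parsed. `hasDaimon` will provide the daimon link on its side of a separating
    -- colouring.
    record Component : Set where
      field
        ls          : List Link
        cs          : List Position
        represented : Proved ls cs
        balanced    : targetsOf ls ↭ sourcesOf ls ++ cs
        hasDaimon   : ∃[ ps ] daimon ps ∈ ls

      source⇒target : ∀ {p} → p ∈ sourcesOf ls → p ∈ targetsOf ls
      source⇒target p∈ = ∈-resp-↭ (↭-sym balanced) (∈-++⁺ˡ p∈)

      conclusion⇒target : ∀ {p} → p ∈ cs → p ∈ targetsOf ls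
      conclusion⇒target p∈ = ∈-resp-↭ (↭-sym balanced) (∈-++⁺ʳ (sourcesOf ls) p∈)

      position⇒target : ∀ {p} → p ∈ concatMap ends ls → p ∈ targetsOf ls
      position⇒target p∈ = [ source⇒target , id ]′ (position⇒source⊎target ls p∈)

    open Component

    daimonComponent : ∀ ps → Unique ps → Component
    daimonComponent ps u = record
      { ls          = daimon ps ∷ []
      ; cs          = ps
      ; represented = ✠-rule _ , ✠ u (sym (length-map τ ps))
      ; balanced    = ↭-reflexive (++-identityʳ ps)
      ; hasDaimon   = ps , here refl
      }

    parComponent : (C : Component) → ∀ {p₁ p₂ p ds} → cs C ↭ p₁ ∷ p₂ ∷ ds → p ∉ targetsOf (ls C) →
      τ p ≡ compound par (τ p₁) (τ p₂) → Component
    parComponent C {p₁} {p₂} {p} {ds} σ fresh τp≡ = record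
      { ls          = conn par p₁ p₂ p ∷ ls C
      ; cs          = ds ∷ʳ p
      ; represented = represented′
      ; balanced    = trans (prep p (trans (balanced C) (++⁺ˡ (sourcesOf (ls C)) σ)))
          (solve↭ 5 (λ p p₁ p₂ ss ds → p ⊕ (ss ⊕ (p₁ ⊕ (p₂ ⊕ ds))) ⊜ p₁ ⊕ (p₂ ⊕ (ss ⊕ (ds ⊕ p)))) refl
            (p ∷ []) (p₁ ∷ []) (p₂ ∷ []) (sourcesOf (ls C)) ds)
      ; hasDaimon   = let ps , ps∈ = hasDaimon C in ps , there ps∈
      }
      where
      represented′ : Proved (conn par p₁ p₂ p ∷ ls C) (ds ∷ʳ p)
      represented′ with subst (Proves (ls C) _) (map-++ τ ds (p₁ ∷ p₂ ∷ []))
        (exchange [] (trans σ (solve↭ 3 (λ p₁ p₂ ds → p₁ ⊕ (p₂ ⊕ ds) ⊜ ds ⊕ (p₁ ⊕ p₂)) refl (p₁ ∷ []) (p₂ ∷ []) ds)) (represented C))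
      ... | π , ρ = subst (Proves _ _) (≡-trans (cong (λ A → map τ ds ∷ʳ A) (sym τp≡)) (sym (map-++ τ ds (p ∷ []))))
        (⅋-rule (map τ ds) π , ⅋ ρ (fresh ∘ position⇒target C))

    tensorComponent : (C D : Component) → Disjoint (targetsOf (ls C)) (targetsOf (ls D)) → ∀ {p₁ p₂ p ds es} →
      cs C ↭ p₁ ∷ ds → cs D ↭ p₂ ∷ es → p ∉ targetsOf (ls C) → p ∉ targetsOf (ls D) →
      τ p ≡ compound tensor (τ p₁) (τ p₂) → Component
    tensorComponent C D disjoint {p₁} {p₂} {p} {ds} {es} σ ρ fresh fresh′ τp≡ = record
      { ls          = conn tensor p₁ p₂ p ∷ ls C ++ ls D
      ; cs          = ds ++ es ++ p ∷ []
      ; represented = represented′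
      ; balanced    = trans (prep p (trans (↭-reflexive (concatMap-++ target (ls C) (ls D)))
          (++⁺ (trans (balanced C) (++⁺ˡ _ σ)) (trans (balanced D) (++⁺ˡ _ ρ)))))
          (trans (solve↭ 7 (λ p p₁ p₂ ss ds ss′ es → p ⊕ ((ss ⊕ (p₁ ⊕ ds)) ⊕ (ss′ ⊕ (p₂ ⊕ es))) ⊜ p₁ ⊕ (p₂ ⊕ ((ss ⊕ ss′) ⊕ (ds ⊕ (es ⊕ p))))) refl
            (p ∷ []) (p₁ ∷ []) (p₂ ∷ []) (sourcesOf (ls C)) ds (sourcesOf (ls D)) es)
          (prep _ (prep _ (++⁺ʳ _ (↭-reflexive (sym (concatMap-++ source (ls C) (ls D))))))))
      ; hasDaimon   = let ps , ps∈ = hasDaimon C in ps , there (∈-++⁺ˡ ps∈)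
      }
      where
      last : ∀ p ds → p ∷ ds ↭ ds ∷ʳ p
      last p ds = solve↭ 2 (λ p ds → p ⊕ ds ⊜ ds ⊕ p) refl (p ∷ []) ds
      proved : (E : Component) → ∀ {q es} → cs E ↭ q ∷ es → Proves (ls E) (es ∷ʳ q) (map τ es ∷ʳ τ q)
      proved E {q} {es} σ = subst (Proves (ls E) _) (map-++ τ es (q ∷ [])) (exchange [] (trans σ (last q es)) (represented E))
      represented′ : Proved (conn tensor p₁ p₂ p ∷ ls C ++ ls D) (ds ++ es ++ p ∷ [])
      represented′ with proved C σ | proved D ρ
      ... | π , r | π′ , r′ = subst (Proves _ _) labels
        (⊗-rule (map τ ds) (map τ es) π π′ ,
         ⊗ r r′ (λ (v , v′) → disjoint (position⇒target C v , position⇒target D v′)) (fresh ∘ position⇒target C) (fresh′ ∘ position⇒target D))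
        where
        labels : map τ ds ++ map τ es ++ compound tensor (τ p₁) (τ p₂) ∷ [] ≡ map τ (ds ++ es ++ p ∷ [])
        labels = ≡-trans (cong (λ A → map τ ds ++ map τ es ++ A ∷ []) (sym τp≡))
          (sym (≡-trans (map-++ τ ds (es ++ p ∷ [])) (cong (map τ ds ++_) (map-++ τ es (p ∷ [])))))

-- The Euler characteristic

weight : Link → ℤ
weight (conn tensor _ _ _) = -1ℤ
weight (conn par _ _ _)    = 0ℤ
weight (cut _ _)           = -1ℤ
weight (daimon _)          = 1ℤ

-- In a switching, daimon links are the initial pieces and each tensor or cut link joins two pieces,
-- while a par link, left with one premise, joins nothing. Connected acyclic switchings have value
-- 1.
χ : List Link → ℤ
χ []       = 0ℤ
χ (l ∷ ls) = weight l ℤ.+ χ ls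

χ-++ : ∀ ls ks → χ (ls ++ ks) ≡ χ ls ℤ.+ χ ks
χ-++ []       ks = sym (ℤ.+-identityˡ _)
χ-++ (l ∷ ls) ks = ≡-trans (cong (λ n → weight l ℤ.+ n) (χ-++ ls ks)) (sym (ℤ.+-assoc (weight l) _ _))

χ-↭ : ∀ {ls ks} → ls ↭ ks → χ ls ≡ χ ks
χ-↭ refl         = refl
χ-↭ (prep l p)   = cong (λ n → weight l ℤ.+ n) (χ-↭ p)
χ-↭ (swap l k p) = ≡-trans (cong (λ n → weight l ℤ.+ (weight k ℤ.+ n)) (χ-↭ p)) (lemma (weight l) (weight k) _)
  where
  lemma : ∀ a b c → a ℤ.+ (b ℤ.+ c) ≡ b ℤ.+ (a ℤ.+ c)
  lemma = solve-∀
χ-↭ (trans p q)  = ≡-trans (χ-↭ p) (χ-↭ q)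

χ-daimons : ∀ pss → χ (map daimon pss) ≡ ℤ.+ length pss
χ-daimons []         = refl
χ-daimons (ps ∷ pss) = cong (λ n → 1ℤ ℤ.+ n) (χ-daimons pss)

χ-tensors : ∀ ts → χ (map (link tensor) ts) ≡ ℤ.- (ℤ.+ length ts)
χ-tensors []       = refl
χ-tensors (t ∷ ts) = ≡-trans (cong (λ n → -1ℤ ℤ.+ n) (χ-tensors ts)) (sym (ℤ.neg-distrib-+ 1ℤ (ℤ.+ length ts)))

χ-pars : ∀ ps → χ (map (link par) ps) ≡ 0ℤ
χ-pars []       = refl
χ-pars (p ∷ ps) = cong (λ n → 0ℤ ℤ.+ n) (χ-pars ps)

classify : ∀ ls → (∀ {p q} → cut p q ∉ ls) →
  ∃[ pss ] ∃[ ts ] ∃[ ps ] ls ↭ map daimon pss ++ map (link tensor) ts ++ map (link par) ps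
classify [] _ = [] , [] , [] , refl
classify (l ∷ ls) cutFree with classify ls (cutFree ∘ there)
classify (conn tensor p₁ p₂ p ∷ ls) cutFree | pss , ts , ps , σ =
  pss , (p₁ , p₂ , p) ∷ ts , ps , trans (prep _ σ) (↭-sym (shift _ (map daimon pss) _))
classify (conn par p₁ p₂ p ∷ ls) cutFree | pss , ts , ps , σ =
  pss , ts , (p₁ , p₂ , p) ∷ ps , trans (prep _ σ) (↭-sym
    (trans (++⁺ˡ (map daimon pss) (shift _ (map (link tensor) ts) _)) (shift _ (map daimon pss) _)))
classify (cut p q ∷ ls) cutFree | _ = ⊥-elim (cutFree (here refl))
classify (daimon qs ∷ ls) cutFree | pss , ts , ps , σ = qs ∷ pss , ts , ps , prep _ σ

-- Duality and size of formulas

dualConnective-involutive : ∀ c → dualConnective (dualConnective c) ≡ c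
dualConnective-involutive tensor = refl
dualConnective-involutive par    = refl

module Formulas (𝒱 : PropositionalVariables) where
  open MLL✠ 𝒱
  open PropositionalVariables 𝒱

  compound-injective : ∀ {c c′ A A′ B B′} → compound c A B ≡ compound c′ A′ B′ → A ≡ A′ × B ≡ B′
  compound-injective refl = refl , refl

  var-injective : ∀ {X Y} → var X ≡ var Y → X ≡ Y
  var-injective refl = refl

  dual-involutive : ∀ A → dual (dual A) ≡ A
  dual-involutive (var X) = cong var (involutive X)
  dual-involutive (compound c A B)
    rewrite dualConnective-involutive c | dual-involutive A | dual-involutive B = refl

  size : Formula → ℕ
  size (var _)          = 0
  size (compound _ A B) = suc (size A ℕ.+ size B)

-- Parsing a net, or separating it by a colouring

module Parsing (𝒱 : PropositionalVariables) where
  open MLL✠ 𝒱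
  open Formulas 𝒱
  open Sequentialisation 𝒱

  module _ {S : Hypergraph} {Γ : Sequent} (S-testable : AtomicallyTestable S Γ) where
    open AtomicallyTestable S-testable
    open IsNet isNet

    target∈targets : ∀ {l p} → l ∈ links S → p ∈ target l → p ∈ targets S
    target∈targets l∈ p∈ = ∈-concatMap target l∈ p∈

    source∈targets : ∀ {l p} → l ∈ links S → p ∈ source l → p ∈ targets S
    source∈targets l∈ p∈ = atLeastOneTarget (source⇒position (links S) (∈-concatMap source l∈ p∈))

    -- Every connective output has a premise of its own colour. Going up to it shrinks the label, on
    -- which the recursion runs, until a daimon link is met.
    ascend : ∀ {colour} → Colouring S colour → ∀ A {p} → τ p ≡ A → p ∈ targets S →
      ∃[ ps ] daimon ps ∈ links S × ∃[ q ] q ∈ ps × colour q ≡ colour p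
    ascend κ A τp≡ p∈ with concatMap-∈⁻ target (links S) p∈
    ... | daimon ps , l∈ , p∈ps = ps , l∈ , _ , p∈ps , refl
    ascend κ (var X) τp≡ p∈ | conn c p₁ p₂ p , l∈ , here refl with () ← ≡-trans (sym τp≡) (labelling l∈)
    ascend κ (compound _ A B) τp≡ p∈ | conn tensor p₁ p₂ p , l∈ , here refl
      with compound-injective (≡-trans (sym (labelling l∈)) τp≡)
         | Colouring.tensorMono κ l∈
    ... | τp₁≡ , _ | eq , _ with ascend κ A τp₁≡ (source∈targets l∈ (here refl))
    ...   | ps , ps∈ , q , q∈ , eq′ = ps , ps∈ , q , q∈ , ≡-trans eq′ eq
    ascend κ (compound _ A B) τp≡ p∈ | conn par p₁ p₂ p , l∈ , here refl
      with compound-injective (≡-trans (sym (labelling l∈)) τp≡)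
         | Colouring.parMono κ l∈
    ... | τp₁≡ , _ | inj₁ eq with ascend κ A τp₁≡ (source∈targets l∈ (here refl))
    ...   | ps , ps∈ , q , q∈ , eq′ = ps , ps∈ , q , q∈ , ≡-trans eq′ eq
    ascend κ (compound _ A B) τp≡ p∈ | conn par p₁ p₂ p , l∈ , here refl
      | _ , τp₂≡ | inj₂ eq with ascend κ B τp₂≡ (source∈targets l∈ (there (here refl)))
    ...   | ps , ps∈ , q , q∈ , eq′ = ps , ps∈ , q , q∈ , ≡-trans eq′ eq

    open Component {τ}

    Bad : Set
    Bad = ∃[ colour ] Colouring S colour × Separates (links S) colour

    -- A par link outside the component C can follow a premise outside C, so nothing else gets the colour of C.
    isolate : (C : Component τ) (ks : List Link) → (∀ {p} → p ∈ sourcesOf ks → p ∈ targetsOf ks) →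
      ∀ ts ps → links S ↭ ls C ++ ks ++ map (link tensor) ts ++ map (link par) ps →
      (∀ {p₁ p₂ p} → (p₁ , p₂ , p) ∈ ts → p₁ ∉ cs C × p₂ ∉ cs C) →
      (∀ {p₁ p₂ p} → (p₁ , p₂ , p) ∈ ps → p₁ ∉ cs C ⊎ p₂ ∉ cs C) →
      ∀ {p} → p ∈ targetsOf (map (link tensor) ts ++ map (link par) ps) → Bad
    isolate C ks closed ts ps σ outside outside′ {z} z∈ = colour , κ , separated
      where
      rs = map (link tensor) ts ++ map (link par) ps
      colour : Position → Bool
      colour p = does (p ∈? targetsOf (ls C))
      inside : ∀ {p} → p ∈ targetsOf (ls C) → colour p ≡ true
      inside = dec-true (_ ∈? _)
      elsewhere : ∀ {p} → p ∉ targetsOf (ls C) → colour p ≡ false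
      elsewhere = dec-false (_ ∈? _)
      split : (f : Link → List Position) → concatMap f (links S) ↭ concatMap f (ls C) ++ concatMap f ks ++ concatMap f rs
      split f = trans (concatMap-↭ f σ) (↭-reflexive (≡-trans (concatMap-++ f (ls C) (ks ++ rs)) (cong (concatMap f (ls C) ++_) (concatMap-++ f ks rs))))
      disjoint : Disjoint (targetsOf (ls C)) (targetsOf ks ++ targetsOf rs)
      disjoint = proj₂ (proj₂ (Unique-++⁻ (targetsOf (ls C)) (Unique-resp-↭ (split target) atMostOneTarget)))
      disjointˢ : Disjoint (sourcesOf (ls C)) (sourcesOf ks ++ sourcesOf rs)
      disjointˢ = proj₂ (proj₂ (Unique-++⁻ (sourcesOf (ls C)) (Unique-resp-↭ (split source) atMostOneSource)))
      ks-elsewhere : ∀ {p} → p ∈ targetsOf ks → colour p ≡ false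
      ks-elsewhere p∈ = elsewhere λ v → disjoint (v , ∈-++⁺ˡ p∈)
      rs-elsewhere : ∀ {p} → p ∈ targetsOf rs → colour p ≡ false
      rs-elsewhere p∈ = elsewhere λ v → disjoint (v , ∈-++⁺ʳ (targetsOf ks) p∈)
      -- A position of `C` is used inside `C` or is a conclusion of `C`. In the first case the
      -- remaining link would be a second link using it.
      premise-elsewhere : ∀ {l p} → l ∈ rs → p ∈ source l → p ∉ cs C → colour p ≡ false
      premise-elsewhere {l} {p} l∈ p∈ p∉ = elsewhere λ v → impossible (∈-++⁻ (sourcesOf (ls C)) (∈-resp-↭ (balanced C) v))
        where
        impossible : p ∈ sourcesOf (ls C) ⊎ p ∈ cs C → ⊥
        impossible (inj₁ s) = disjointˢ (s , ∈-++⁺ʳ (sourcesOf ks) (∈-concatMap source l∈ p∈))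
        impossible (inj₂ c) = p∉ c
      data Place (l : Link) : Set where
        in-C  : l ∈ ls C → Place l
        in-ks : l ∈ ks → Place l
        in-ts : l ∈ map (link tensor) ts → Place l
        in-ps : l ∈ map (link par) ps → Place l
      place : ∀ {l} → l ∈ links S → Place l
      place l∈ with ∈-++⁻ (ls C) (∈-resp-↭ σ l∈)
      ... | inj₁ i = in-C i
      ... | inj₂ i with ∈-++⁻ ks i
      ...   | inj₁ j = in-ks j
      ...   | inj₂ j with ∈-++⁻ (map (link tensor) ts) j
      ...     | inj₁ k = in-ts k
      ...     | inj₂ k = in-ps k
      mono-C : ∀ {l p} → l ∈ ls C → p ∈ source l ⊎ p ∈ target l → colour p ≡ true
      mono-C l∈ (inj₁ p∈) = inside (source⇒target C (∈-concatMap source l∈ p∈))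
      mono-C l∈ (inj₂ p∈) = inside (∈-concatMap target l∈ p∈)
      mono-ks : ∀ {l p} → l ∈ ks → p ∈ source l ⊎ p ∈ target l → colour p ≡ false
      mono-ks l∈ (inj₁ p∈) = ks-elsewhere (closed (∈-concatMap source l∈ p∈))
      mono-ks l∈ (inj₂ p∈) = ks-elsewhere (∈-concatMap target l∈ p∈)
      tensor-mono : ∀ {p₁ p₂ p} → conn tensor p₁ p₂ p ∈ links S → colour p₁ ≡ colour p × colour p₂ ≡ colour p
      tensor-mono l∈ with place l∈
      ... | in-C i = let m = λ {p} → mono-C {p = p} i in
        ≡-trans (m (inj₁ (here refl))) (sym (m (inj₂ (here refl)))) , ≡-trans (m (inj₁ (there (here refl)))) (sym (m (inj₂ (here refl))))
      ... | in-ks i = let m = λ {p} → mono-ks {p = p} i in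
        ≡-trans (m (inj₁ (here refl))) (sym (m (inj₂ (here refl)))) , ≡-trans (m (inj₁ (there (here refl)))) (sym (m (inj₂ (here refl))))
      ... | in-ts i with ∈-map⁻ (link tensor) i
      ...   | t , t∈ , refl =
        let out = rs-elsewhere (∈-concatMap target (∈-++⁺ˡ i) (here refl)) in
        ≡-trans (premise-elsewhere (∈-++⁺ˡ i) (here refl) (proj₁ (outside t∈))) (sym out) ,
        ≡-trans (premise-elsewhere (∈-++⁺ˡ i) (there (here refl)) (proj₂ (outside t∈))) (sym out)
      tensor-mono l∈ | in-ps i with ∈-map⁻ (link par) i
      ... | _ , _ , ()
      par-mono : ∀ {p₁ p₂ p} → conn par p₁ p₂ p ∈ links S → colour p₁ ≡ colour p ⊎ colour p₂ ≡ colour p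
      par-mono l∈ with place l∈
      ... | in-C i = let m = λ {p} → mono-C {p = p} i in inj₁ (≡-trans (m (inj₁ (here refl))) (sym (m (inj₂ (here refl)))))
      ... | in-ks i = let m = λ {p} → mono-ks {p = p} i in inj₁ (≡-trans (m (inj₁ (here refl))) (sym (m (inj₂ (here refl)))))
      ... | in-ts i with ∈-map⁻ (link tensor) i
      ...   | _ , _ , ()
      par-mono l∈ | in-ps i with ∈-map⁻ (link par) i
      ... | t , t∈ , refl with outside′ t∈ | ∈-++⁺ʳ (map (link tensor) ts) i
      ...   | inj₁ p∉ | j = inj₁ (≡-trans (premise-elsewhere j (here refl) p∉) (sym (rs-elsewhere (∈-concatMap target j (here refl)))))
      ...   | inj₂ p∉ | j = inj₂ (≡-trans (premise-elsewhere j (there (here refl)) p∉) (sym (rs-elsewhere (∈-concatMap target j (here refl)))))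
      daimon-mono : ∀ {ps} → daimon ps ∈ links S → ∃[ b ] All (λ p → colour p ≡ b) ps
      daimon-mono l∈ with place l∈
      ... | in-C i = true , All.tabulate λ p∈ → mono-C i (inj₂ p∈)
      ... | in-ks i = false , All.tabulate λ p∈ → mono-ks i (inj₂ p∈)
      ... | in-ts i with () ← proj₂ (proj₂ (∈-map⁻ (link tensor) i))
      ... | in-ps i with () ← proj₂ (proj₂ (∈-map⁻ (link par) i))
      κ : Colouring S colour
      κ = record { tensorMono = tensor-mono ; parMono = par-mono ; daimonMono = daimon-mono }
      separated : Separates (links S) colour
      -- The daimon link of the other colour is found above `z`, the output of a link outside `C`.
      separated with hasDaimon C | ascend κ (τ z) refl (∈-resp-↭ (↭-sym (split target)) (∈-++⁺ʳ (targetsOf (ls C)) (∈-++⁺ʳ (targetsOf ks) z∈)))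
      ... | ps , ps∈ | qs , qs∈ , q , q∈ , eq with ∈⇒↭ (∈-resp-↭ (↭-sym σ) (∈-++⁺ˡ ps∈))
      ...   | ks′ , ρ with ∈-resp-↭ ρ qs∈
      ...     | here refl with () ← ≡-trans (sym (mono-C ps∈ (inj₂ q∈))) (≡-trans eq (rs-elsewhere z∈))
      ...     | there qs∈′ with ∈⇒↭ qs∈′ | daimon-mono qs∈
      ...       | ks″ , ρ′ | b , mono = ps , qs , ks″ , trans ρ (prep _ ρ′) , All.tabulate (λ p∈ → mono-C ps∈ (inj₂ p∈)) ,
        All.map (λ {p} eq′ → ≡-trans eq′ (≡-trans (sym (All.lookup mono q∈)) (≡-trans eq (rs-elsewhere z∈)))) mono

    Uses : Component τ → Triple → Set
    Uses C (p₁ , p₂ , p) = p₁ ∈ cs C ⊎ p₂ ∈ cs C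

    uses? : ∀ C t → Dec (Uses C t)
    uses? C (p₁ , p₂ , p) = (p₁ ∈? cs C) ⊎-dec (p₂ ∈? cs C)

    Ready : List (Component τ) → Triple → Set
    Ready Cs (p₁ , p₂ , p) = Any (λ C → p₁ ∈ cs C × p₂ ∈ cs C) Cs

    ready? : ∀ Cs t → Dec (Ready Cs t)
    ready? Cs (p₁ , p₂ , p) = any? (λ C → (p₁ ∈? cs C) ×-dec (p₂ ∈? cs C)) Cs

    components-closed : ∀ Cs {p} → p ∈ sourcesOf (concatMap ls Cs) → p ∈ targetsOf (concatMap ls Cs)
    components-closed Cs p∈ with concatMap-∈⁻ source (concatMap ls Cs) p∈
    ... | l , l∈ , p∈l with concatMap-∈⁻ ls Cs l∈
    ...   | C , C∈ , l∈C with concatMap-∈⁻ target (ls C) (source⇒target C (∈-concatMap source l∈C p∈l))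
    ...     | k , k∈ , p∈k = ∈-concatMap target (∈-concatMap ls C∈ k∈) p∈k

    remaining : List Triple → List Triple → List Link
    remaining ts ps = map (link tensor) ts ++ map (link par) ps

    target-split : ∀ ls ks → links S ↭ ls ++ ks → Unique (targetsOf ls ++ targetsOf ks)
    target-split ls ks σ = Unique-resp-↭ (trans (concatMap-↭ target σ) (↭-reflexive (concatMap-++ target ls ks))) atMostOneTarget

    source-distinct : ∀ {c p₁ p₂ p} → conn c p₁ p₂ p ∈ links S → p₁ ≢ p₂
    source-distinct l∈ with All.lookup linksWellFormed l∈
    ... | (≢ ∷ _) ∷ _ = ≢

    -- Both balances have the same targets and the same sources; cancelling the sources identifies
    -- the conclusions up to order, and `exchange` does the rest.
    complete : (C : Component τ) → links S ↭ ls C → Correct S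
    complete C σ = map τ (conclusions S) , Proves-resp-↭ (↭-sym σ) (exchange τ [] cs↭ (represented C))
      where
      cs↭ : cs C ↭ conclusions S
      cs↭ = ++-cancelˡ-↭ (sourcesOf (ls C)) (trans (↭-sym (balanced C)) (trans (↭-sym (concatMap-↭ target σ))
        (trans (IsNet⇒balanced isNet) (++⁺ʳ (conclusions S) (concatMap-↭ source σ)))))

    parStep : ∀ Cs ts ps {t} → links S ↭ concatMap ls Cs ++ remaining ts ps → t ∈ ps → Ready Cs t →
      ∃[ Cs′ ] ∃[ ps′ ] links S ↭ concatMap ls Cs′ ++ remaining ts ps′ × length Cs′ ≡ length Cs × length ps ≡ suc (length ps′)
    parStep Cs ts ps {p₁ , p₂ , p} σ t∈ ready with find ready
    ... | C , C∈ , p₁∈ , p₂∈ with ∈⇒↭ C∈ | ∈⇒↭ t∈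
    ...   | Cs₀ , ρ | ps′ , ρ′ with ∈⇒↭₂ (source-distinct par∈) p₁∈ p₂∈
      where
      par∈ : conn par p₁ p₂ p ∈ links S
      par∈ = ∈-resp-↭ (↭-sym σ) (∈-++⁺ʳ (concatMap ls Cs) (∈-++⁺ʳ (map (link tensor) ts) (∈-map⁺ (link par) t∈)))
    ...     | ds , ρ″ = D ∷ Cs₀ , ps′ , trans σ′ (arrange (conn par p₁ p₂ p ∷ []) (ls C) (concatMap ls Cs₀) (map (link tensor) ts) _) ,
              sym (↭-length ρ) , ↭-length ρ′
      where
      arrange : ∀ (a b c d e : List Link) → b ++ (c ++ (d ++ (a ++ e))) ↭ ((a ++ b) ++ c) ++ (d ++ e)
      arrange = solve↭ 5 (λ a b c d e → b ⊕ (c ⊕ (d ⊕ (a ⊕ e))) ⊜ ((a ⊕ b) ⊕ c) ⊕ (d ⊕ e)) refl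
      σ′ : links S ↭ ls C ++ (concatMap ls Cs₀ ++ (map (link tensor) ts ++ (conn par p₁ p₂ p ∷ map (link par) ps′)))
      σ′ = trans σ (trans (++⁺ (concatMap-↭ ls ρ) (++⁺ˡ (map (link tensor) ts) (map⁺ (link par) ρ′)))
        (↭-reflexive (++-assoc (ls C) (concatMap ls Cs₀) _)))
      par∈rest : conn par p₁ p₂ p ∈ concatMap ls Cs₀ ++ (map (link tensor) ts ++ (conn par p₁ p₂ p ∷ map (link par) ps′))
      par∈rest = ∈-++⁺ʳ (concatMap ls Cs₀) (∈-++⁺ʳ (map (link tensor) ts) (here refl))
      fresh : p ∉ targetsOf (ls C)
      fresh p∈ = proj₂ (proj₂ (Unique-++⁻ (targetsOf (ls C)) (target-split (ls C) _ σ′))) (p∈ , ∈-concatMap target par∈rest (here refl))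
      D : Component τ
      D = parComponent τ C ρ″ fresh (labelling (∈-resp-↭ (↭-sym σ′) (∈-++⁺ʳ (ls C) par∈rest)))

    tensorStep : ∀ Cs ts ps {C C′ Cs₀ t} → links S ↭ concatMap ls Cs ++ remaining ts ps →
      Cs ↭ C ∷ C′ ∷ Cs₀ → t ∈ ts → Uses C t → Uses C′ t →
      ∃[ Cs′ ] ∃[ ts′ ] links S ↭ concatMap ls Cs′ ++ remaining ts′ ps × length Cs ≡ suc (length Cs′) × length ts ≡ suc (length ts′)
    tensorStep Cs ts ps {C} {C′} {Cs₀} {p₁ , p₂ , p} σ ρ t∈ u u′ with ∈⇒↭ t∈
    ... | ts′ , ρ′ = step u u′
      where
      rest = concatMap ls Cs₀ ++ (conn tensor p₁ p₂ p ∷ remaining ts′ ps)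
      assoc : ∀ (a b c d : List Link) → (a ++ (b ++ c)) ++ d ↭ (a ++ b) ++ (c ++ d)
      assoc = solve↭ 4 (λ a b c d → (a ⊕ (b ⊕ c)) ⊕ d ⊜ (a ⊕ b) ⊕ (c ⊕ d)) refl
      σ′ : links S ↭ (ls C ++ ls C′) ++ rest
      σ′ = trans σ (trans (++⁺ (concatMap-↭ ls ρ) (++⁺ʳ (map (link par) ps) (map⁺ (link tensor) ρ′)))
        (assoc (ls C) (ls C′) (concatMap ls Cs₀) _))
      tensor∈rest : conn tensor p₁ p₂ p ∈ rest
      tensor∈rest = ∈-++⁺ʳ (concatMap ls Cs₀) (here refl)
      unique : Unique ((targetsOf (ls C) ++ targetsOf (ls C′)) ++ targetsOf rest)
      unique = subst (λ ps → Unique (ps ++ targetsOf rest)) (concatMap-++ target (ls C) (ls C′)) (target-split (ls C ++ ls C′) rest σ′)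
      disjoint : Disjoint (targetsOf (ls C)) (targetsOf (ls C′))
      disjoint = proj₂ (proj₂ (Unique-++⁻ (targetsOf (ls C)) (proj₁ (Unique-++⁻ (targetsOf (ls C) ++ targetsOf (ls C′)) unique))))
      fresh : p ∉ targetsOf (ls C) ++ targetsOf (ls C′)
      fresh p∈ = proj₂ (proj₂ (Unique-++⁻ (targetsOf (ls C) ++ targetsOf (ls C′)) unique)) (p∈ , ∈-concatMap target tensor∈rest (here refl))
      τp≡ = labelling (∈-resp-↭ (↭-sym σ′) (∈-++⁺ʳ (ls C ++ ls C′) tensor∈rest))
      arrange : ∀ (a b b′ c d : List Link) → (b ++ b′) ++ (c ++ (a ++ d)) ↭ ((a ++ (b ++ b′)) ++ c) ++ d
      arrange = solve↭ 5 (λ a b b′ c d → (b ⊕ b′) ⊕ (c ⊕ (a ⊕ d)) ⊜ ((a ⊕ (b ⊕ b′)) ⊕ c) ⊕ d) refl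
      Result = ∃[ Cs′ ] ∃[ ts′ ] links S ↭ concatMap ls Cs′ ++ remaining ts′ ps × length Cs ≡ suc (length Cs′) × length ts ≡ suc (length ts′)
      step : Uses C (p₁ , p₂ , p) → Uses C′ (p₁ , p₂ , p) → Result
      -- Different subnets have disjoint targets, so they cannot both hold the same premise of the
      -- link.
      step (inj₁ x) (inj₁ y) = ⊥-elim (disjoint (conclusion⇒target C x , conclusion⇒target C′ y))
      step (inj₂ x) (inj₂ y) = ⊥-elim (disjoint (conclusion⇒target C x , conclusion⇒target C′ y))
      step (inj₁ x) (inj₂ y) with ∈⇒↭ x | ∈⇒↭ y
      ... | _ , α | _ , β =
        tensorComponent τ C C′ disjoint α β (fresh ∘ ∈-++⁺ˡ) (fresh ∘ ∈-++⁺ʳ (targetsOf (ls C))) τp≡ ∷ Cs₀ , ts′ ,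
        trans σ′ (arrange (conn tensor p₁ p₂ p ∷ []) (ls C) (ls C′) (concatMap ls Cs₀) _) , ↭-length ρ , ↭-length ρ′
      step (inj₂ y) (inj₁ x) with ∈⇒↭ x | ∈⇒↭ y
      ... | _ , α | _ , β =
        tensorComponent τ C′ C (λ (v , w) → disjoint (w , v)) α β (fresh ∘ ∈-++⁺ʳ (targetsOf (ls C))) (fresh ∘ ∈-++⁺ˡ) τp≡ ∷ Cs₀ , ts′ ,
        trans σ′ (trans (arrange (conn tensor p₁ p₂ p ∷ []) (ls C) (ls C′) (concatMap ls Cs₀) _)
          (++⁺ʳ _ (++⁺ʳ (concatMap ls Cs₀) (prep (conn tensor p₁ p₂ p) (++-comm (ls C) (ls C′)))))) , ↭-length ρ , ↭-length ρ′

    -- Each step consumes one connective link, and `n` counts those that remain. A par step leaves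
    -- both sides of the length equation alone and a tensor step lowers both by one, so a single
    -- component is left at the end.
    parse : ∀ n Cs ts ps → links S ↭ concatMap ls Cs ++ remaining ts ps → length Cs ≡ suc (length ts) →
      length ts ℕ.+ length ps ≡ n → Correct S ⊎ Bad
    parse zero (C ∷ []) [] [] σ refl refl = inj₁ (complete C (trans σ (↭-reflexive (≡-trans (++-identityʳ _) (++-identityʳ (ls C))))))
    parse (suc n) Cs ts ps σ len eq with any? (ready? Cs) ps
    ... | yes some = let t , t∈ , ready = find some
                         Cs′ , ps′ , σ′ , len′ , eq′ = parStep Cs ts ps σ t∈ ready
                     in parse n Cs′ ts ps′ σ′ (≡-trans len′ len)
                          (ℕ.suc-injective (≡-trans (sym (ℕ.+-suc (length ts) (length ps′))) (≡-trans (cong (length ts ℕ.+_) (sym eq′)) eq)))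
    ... | no stuck with pigeonhole uses? Cs ts (ℕ.≤-reflexive (sym len))
    ...   | inj₂ (C , C′ , Cs₀ , t , ρ , t∈ , u , u′) =
      let Cs′ , ts′ , σ′ , len′ , eq′ = tensorStep Cs ts ps σ ρ t∈ u u′
      in parse n Cs′ ts′ ps σ′ (ℕ.suc-injective (≡-trans (sym len′) (≡-trans len (cong suc eq′))))
           (ℕ.suc-injective (≡-trans (cong (ℕ._+ length ps) (sym eq′)) eq))
    ...   | inj₁ (C , C∈ , unused) with ∈⇒↭ C∈
    ...     | Cs₀ , ρ = inj₂ (isolate C (concatMap ls Cs₀) (components-closed Cs₀) ts ps
      (trans σ (trans (++⁺ʳ _ (concatMap-↭ ls ρ)) (↭-reflexive (++-assoc (ls C) (concatMap ls Cs₀) _))))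
      (λ t∈ → (λ p₁∈ → unused t∈ (inj₁ p₁∈)) , λ p₂∈ → unused t∈ (inj₂ p₂∈)) outside (output ts ps eq))
      where
      outside : ∀ {p₁ p₂ p} → (p₁ , p₂ , p) ∈ ps → p₁ ∉ cs C ⊎ p₂ ∉ cs C
      outside {p₁} {p₂} t∈ with p₁ ∈? cs C | p₂ ∈? cs C
      ... | no p₁∉  | _       = inj₁ p₁∉
      ... | yes _   | no p₂∉  = inj₂ p₂∉
      ... | yes p₁∈ | yes p₂∈ = contradiction (lose t∈ (lose C∈ (p₁∈ , p₂∈))) stuck
      -- Since `suc n` links remain, one of them has an output; it lies outside `C` and shows that
      -- the other side is inhabited.
      someOutput : ∀ (ts ps : List Triple) → length ts ℕ.+ length ps ≡ suc n → Position
      someOutput ((_ , _ , p) ∷ ts) ps _ = p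
      someOutput [] ((_ , _ , p) ∷ ps) _ = p
      output : ∀ ts ps (eq : length ts ℕ.+ length ps ≡ suc n) → someOutput ts ps eq ∈ targetsOf (remaining ts ps)
      output (t ∷ ts) ps       _ = here refl
      output []       (t ∷ ps) _ = here refl

    sequentialise : χ (links S) ≡ 1ℤ → Correct S ⊎ Bad
    sequentialise χ≡1 with classify (links S) cutFree
    ... | pss , ts , ps , σ = let Cs , eq , len = components pss (λ ps∈ → Unique-concatMap⁻ target atMostOneTarget (∈-resp-↭ (↭-sym σ) (∈-++⁺ˡ (∈-map⁺ daimon ps∈)))) in
      parse _ Cs ts ps (subst (λ ks → links S ↭ ks ++ remaining ts ps) (sym eq) σ) (≡-trans len count) refl
      where
      components : ∀ pss → (∀ {ps} → ps ∈ pss → Unique ps) → ∃[ Cs ] concatMap ls Cs ≡ map daimon pss × length Cs ≡ length pss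
      components []         _ = [] , refl , refl
      components (ps ∷ pss) u = let Cs , eq , len = components pss (u ∘ there) in
        daimonComponent τ ps (u (here refl)) ∷ Cs , cong (daimon ps ∷_) eq , cong suc len
      χ≡ : χ (links S) ≡ ℤ.+ length pss ℤ.+ (ℤ.- (ℤ.+ length ts) ℤ.+ 0ℤ)
      χ≡ = ≡-trans (χ-↭ σ) (≡-trans (χ-++ (map daimon pss) _) (cong₂ ℤ._+_ (χ-daimons pss)
        (≡-trans (χ-++ (map (link tensor) ts) _) (cong₂ ℤ._+_ (χ-tensors ts) (χ-pars ps)))))
      rearrange : ∀ a b → a ≡ (a ℤ.+ (ℤ.- b ℤ.+ 0ℤ)) ℤ.+ b
      rearrange = solve-∀
      count : length pss ≡ suc (length ts)
      count = ℤ.+-injective (≡-trans (rearrange (ℤ.+ length pss) (ℤ.+ length ts))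
        (cong (ℤ._+ ℤ.+ length ts) (≡-trans (sym χ≡) χ≡1)))

-- Trees of connectives above a position

data Tree : Set where
  leaf : Position → Tree
  node : Connective → Position → Tree → Tree → Tree

root : Tree → Position
root (leaf p)       = p
root (node _ p _ _) = p

nodes leaves : Tree → List Position
nodes (leaf p)        = p ∷ []
nodes (node _ p l r)  = p ∷ nodes l ++ nodes r
leaves (leaf p)       = p ∷ []
leaves (node _ _ l r) = leaves l ++ leaves r

pars tensors : Tree → List Triple
pars (leaf p)              = []
pars (node tensor p l r)   = pars l ++ pars r
pars (node par p l r)      = (root l , root r , p) ∷ pars l ++ pars r
tensors (leaf p)            = []
tensors (node tensor p l r) = (root l , root r , p) ∷ tensors l ++ tensors r
tensors (node par p l r)    = tensors l ++ tensors r

output : Triple → Position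
output (_ , _ , p) = p

premises : Triple → List Position
premises (p₁ , p₂ , _) = p₁ ∷ p₂ ∷ []

targetsOf-link : ∀ c ts → targetsOf (map (link c) ts) ≡ map output ts
targetsOf-link c []       = refl
targetsOf-link c (t ∷ ts) = cong (output t ∷_) (targetsOf-link c ts)

sourcesOf-link : ∀ c ts → sourcesOf (map (link c) ts) ≡ concatMap premises ts
sourcesOf-link c []       = refl
sourcesOf-link c (t ∷ ts) = cong (premises t ++_) (sourcesOf-link c ts)

targetsOf-daimon : ∀ pss → targetsOf (map daimon pss) ≡ concat pss
targetsOf-daimon []         = refl
targetsOf-daimon (ps ∷ pss) = cong (ps ++_) (targetsOf-daimon pss)

sourcesOf-daimon : ∀ pss → sourcesOf (map daimon pss) ≡ []
sourcesOf-daimon []         = refl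
sourcesOf-daimon (ps ∷ pss) = sourcesOf-daimon pss

outputs↭nodes : ∀ t → map output (pars t) ++ map output (tensors t) ++ leaves t ↭ nodes t
outputs↭nodes (leaf p) = refl
outputs↭nodes (node tensor p l r)
  rewrite map-++ output (pars l) (pars r) | map-++ output (tensors l) (tensors r) =
  trans (solve↭ 7 (λ p a b c d e f → (a ⊕ b) ⊕ (p ⊕ (c ⊕ d)) ⊕ (e ⊕ f) ⊜ p ⊕ ((a ⊕ (c ⊕ e)) ⊕ (b ⊕ (d ⊕ f)))) refl (p ∷ [])
    (map output (pars l)) (map output (pars r)) (map output (tensors l)) (map output (tensors r)) (leaves l) (leaves r))
    (prep p (++⁺ (outputs↭nodes l) (outputs↭nodes r)))
outputs↭nodes (node par p l r)
  rewrite map-++ output (pars l) (pars r) | map-++ output (tensors l) (tensors r) =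
  trans (solve↭ 7 (λ p a b c d e f → (p ⊕ (a ⊕ b)) ⊕ (c ⊕ d) ⊕ (e ⊕ f) ⊜ p ⊕ ((a ⊕ (c ⊕ e)) ⊕ (b ⊕ (d ⊕ f)))) refl (p ∷ [])
    (map output (pars l)) (map output (pars r)) (map output (tensors l)) (map output (tensors r)) (leaves l) (leaves r))
    (prep p (++⁺ (outputs↭nodes l) (outputs↭nodes r)))

-- Together with `outputs↭nodes` this yields the balance of nets built on a tree: the root is the
-- one node that is no premise.
premises↭nodes : ∀ t → root t ∷ concatMap premises (pars t) ++ concatMap premises (tensors t) ↭ nodes t
premises↭nodes (leaf p) = refl
premises↭nodes (node tensor p l r)
  rewrite concatMap-++ premises (pars l) (pars r) | concatMap-++ premises (tensors l) (tensors r) =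
  prep p (trans (solve↭ 6 (λ x y a b c d → (a ⊕ b) ⊕ (x ⊕ (y ⊕ (c ⊕ d))) ⊜ (x ⊕ (a ⊕ c)) ⊕ (y ⊕ (b ⊕ d))) refl (root l ∷ []) (root r ∷ [])
    (concatMap premises (pars l)) (concatMap premises (pars r)) (concatMap premises (tensors l)) (concatMap premises (tensors r)))
    (++⁺ (premises↭nodes l) (premises↭nodes r)))
premises↭nodes (node par p l r)
  rewrite concatMap-++ premises (pars l) (pars r) | concatMap-++ premises (tensors l) (tensors r) =
  prep p (trans (solve↭ 6 (λ x y a b c d → (x ⊕ (y ⊕ (a ⊕ b))) ⊕ (c ⊕ d) ⊜ (x ⊕ (a ⊕ c)) ⊕ (y ⊕ (b ⊕ d))) refl (root l ∷ []) (root r ∷ [])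
    (concatMap premises (pars l)) (concatMap premises (pars r)) (concatMap premises (tensors l)) (concatMap premises (tensors r)))
    (++⁺ (premises↭nodes l) (premises↭nodes r)))

data GrownIn (S : Hypergraph) : Tree → Set where
  leaf : ∀ {p} → Initial S p → GrownIn S (leaf p)
  node : ∀ {c p l r} → conn c (root l) (root r) p ∈ links S → GrownIn S l → GrownIn S r → GrownIn S (node c p l r)

module _ {S : Hypergraph} where

  pars∈links : ∀ {t x} → GrownIn S t → x ∈ pars t → link par x ∈ links S
  pars∈links (node {tensor} {l = l} l∈ gl gr) x∈ with ∈-++⁻ (pars l) x∈
  ... | inj₁ x∈l = pars∈links gl x∈l
  ... | inj₂ x∈r = pars∈links gr x∈r
  pars∈links (node {par} l∈ gl gr) (here refl) = l∈
  pars∈links (node {par} {l = l} l∈ gl gr) (there x∈) with ∈-++⁻ (pars l) x∈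
  ... | inj₁ x∈l = pars∈links gl x∈l
  ... | inj₂ x∈r = pars∈links gr x∈r

  tensors∈links : ∀ {t x} → GrownIn S t → x ∈ tensors t → link tensor x ∈ links S
  tensors∈links (node {par} {l = l} l∈ gl gr) x∈ with ∈-++⁻ (tensors l) x∈
  ... | inj₁ x∈l = tensors∈links gl x∈l
  ... | inj₂ x∈r = tensors∈links gr x∈r
  tensors∈links (node {tensor} l∈ gl gr) (here refl) = l∈
  tensors∈links (node {tensor} {l = l} l∈ gl gr) (there x∈) with ∈-++⁻ (tensors l) x∈
  ... | inj₁ x∈l = tensors∈links gl x∈l
  ... | inj₂ x∈r = tensors∈links gr x∈r

  leaves-initial : ∀ {t p} → GrownIn S t → p ∈ leaves t → Initial S p
  leaves-initial (leaf i) (here refl) = i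
  leaves-initial (node {l = l} l∈ gl gr) p∈ with ∈-++⁻ (leaves l) p∈
  ... | inj₁ p∈l = leaves-initial gl p∈l
  ... | inj₂ p∈r = leaves-initial gr p∈r

  parent : ∀ {t p} → GrownIn S t → p ∈ nodes t →
    p ≡ root t ⊎ ∃[ c ] ∃[ p₁ ] ∃[ p₂ ] ∃[ q ] conn c p₁ p₂ q ∈ links S × p ∈ p₁ ∷ p₂ ∷ [] × q ∈ nodes t
  parent (leaf i) (here refl) = inj₁ refl
  parent (node l∈ gl gr) (here refl) = inj₁ refl
  parent (node {l = l} l∈ gl gr) (there p∈) with ∈-++⁻ (nodes l) p∈
  ... | inj₁ p∈l with parent gl p∈l
  ...   | inj₁ refl = inj₂ (_ , _ , _ , _ , l∈ , here refl , here refl)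
  ...   | inj₂ (c , p₁ , p₂ , q , l∈′ , p∈′ , q∈) = inj₂ (c , p₁ , p₂ , q , l∈′ , p∈′ , there (∈-++⁺ˡ q∈))
  parent (node {l = l} l∈ gl gr) (there p∈) | inj₂ p∈r with parent gr p∈r
  ... | inj₁ refl = inj₂ (_ , _ , _ , _ , l∈ , there (here refl) , here refl)
  ... | inj₂ (c , p₁ , p₂ , q , l∈′ , p∈′ , q∈) = inj₂ (c , p₁ , p₂ , q , l∈′ , p∈′ , there (∈-++⁺ʳ (nodes l) q∈))

conn-injective : ∀ {c c′ p₁ p₁′ p₂ p₂′ p p′} → conn c p₁ p₂ p ≡ conn c′ p₁′ p₂′ p′ → c ≡ c′ × p₁ ≡ p₁′ × p₂ ≡ p₂′ × p ≡ p′
conn-injective refl = refl , refl , refl , refl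

-- The trees inside an atomically testable net

module Growth (𝒱 : PropositionalVariables) {S : Hypergraph} {Γ : MLL✠.Sequent 𝒱} (S-testable : MLL✠.AtomicallyTestable 𝒱 S Γ) where
  open MLL✠ 𝒱
  open AtomicallyTestable S-testable
  open IsNet isNet
  open Formulas 𝒱
  open Parsing 𝒱 using (target∈targets; source∈targets)

  same-target : ∀ {l l′ p} → l ∈ links S → l′ ∈ links S → p ∈ target l → p ∈ target l′ → l ≡ l′
  same-target = Unique-concatMap⇒≡ target atMostOneTarget

  same-source : ∀ {l l′ p} → l ∈ links S → l′ ∈ links S → p ∈ source l → p ∈ source l′ → l ≡ l′
  same-source = Unique-concatMap⇒≡ source atMostOneSource

  grow : ∀ A {p} → τ p ≡ A → p ∈ targets S → ∃[ t ] GrownIn S t × root t ≡ p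
  grow A τp≡ p∈ with concatMap-∈⁻ target (links S) p∈
  ... | daimon ps , l∈ , p∈ps = leaf _ , leaf (ps , l∈ , p∈ps) , refl
  grow (var X) τp≡ p∈ | conn c p₁ p₂ p , l∈ , here refl with () ← ≡-trans (sym τp≡) (labelling l∈)
  grow (compound _ A B) τp≡ p∈ | conn c p₁ p₂ p , l∈ , here refl
    with compound-injective (≡-trans (sym (labelling l∈)) τp≡)
  ... | τp₁≡ , τp₂≡
    with grow A τp₁≡ (source∈targets S-testable l∈ (here refl)) | grow B τp₂≡ (source∈targets S-testable l∈ (there (here refl)))
  ...   | l , gl , refl | r , gr , refl = node c p l r , node l∈ gl gr , refl

  -- A position is the target of one link only, which fixes the connective and both premises, and so
  -- on upwards.
  grown-unique : ∀ {t t′} → GrownIn S t → GrownIn S t′ → root t ≡ root t′ → t ≡ t′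
  grown-unique (leaf _) (leaf _) refl = refl
  grown-unique (leaf (ps , l∈ , p∈)) (node l∈′ _ _) refl with () ← same-target l∈ l∈′ p∈ (here refl)
  grown-unique (node l∈′ _ _) (leaf (ps , l∈ , p∈)) refl with () ← same-target l∈ l∈′ p∈ (here refl)
  grown-unique (node l∈ gl gr) (node l∈′ gl′ gr′) refl with conn-injective (same-target l∈ l∈′ (here refl) (here refl))
  ... | refl , eqˡ , eqʳ , _ with grown-unique gl gl′ eqˡ | grown-unique gr gr′ eqʳ
  ...   | refl | refl = refl

  -- Made total, with a default leaf outside the targets, because labellings are functions on all
  -- positions.
  tree : Position → Tree
  tree p with p ∈? targets S
  ... | yes p∈ = proj₁ (grow (τ p) refl p∈)
  ... | no _   = leaf p

  tree-grown : ∀ {p} → p ∈ targets S → GrownIn S (tree p) × root (tree p) ≡ p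
  tree-grown {p} p∈ with p ∈? targets S
  ... | yes p∈′ = proj₂ (grow (τ p) refl p∈′)
  ... | no p∉   = contradiction p∈ p∉

  tree-leaf : ∀ {p} → Initial S p → tree p ≡ leaf p
  tree-leaf i@(ps , l∈ , p∈) = let g , eq = tree-grown (target∈targets S-testable l∈ p∈) in grown-unique g (leaf i) eq

  -- `tree` runs `grow` separately at each position, so the agreement of a tree with those of its
  -- premises rests on `grown-unique`.
  tree-node : ∀ {c p₁ p₂ p} → conn c p₁ p₂ p ∈ links S → tree p ≡ node c p (tree p₁) (tree p₂)
  tree-node l∈ with tree-grown (target∈targets S-testable l∈ (here refl))
                  | tree-grown (source∈targets S-testable l∈ (here refl))
                  | tree-grown (source∈targets S-testable l∈ (there (here refl)))
  ... | g , eq | gl , eqˡ | gr , eqʳ =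
    grown-unique g (node (subst₂ (λ q₁ q₂ → conn _ q₁ q₂ _ ∈ links S) (sym eqˡ) (sym eqʳ) l∈) gl gr) eq

  size-nodes : ∀ {t p} → GrownIn S t → p ∈ nodes t → size (τ p) ℕ.≤ size (τ (root t))
  size-nodes (leaf _) (here refl) = ℕ.≤-refl
  size-nodes (node _ _ _) (here refl) = ℕ.≤-refl
  size-nodes (node {l = l} l∈ gl gr) (there p∈) rewrite labelling l∈ with ∈-++⁻ (nodes l) p∈
  ... | inj₁ p∈l = ℕ.≤-trans (size-nodes gl p∈l) (ℕ.m≤n⇒m≤1+n (ℕ.m≤m+n _ _))
  ... | inj₂ p∈r = ℕ.≤-trans (size-nodes gr p∈r) (ℕ.m≤n⇒m≤1+n (ℕ.m≤n+m _ _))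

  size-premise : ∀ {c p₁ p₂ p q} → conn c p₁ p₂ p ∈ links S → q ∈ p₁ ∷ p₂ ∷ [] → size (τ q) < size (τ p)
  size-premise l∈ (here refl)         rewrite labelling l∈ = s≤s (ℕ.m≤m+n _ _)
  size-premise l∈ (there (here refl)) rewrite labelling l∈ = s≤s (ℕ.m≤n+m _ _)

  -- Labels strictly grow downwards, so an output never lies above its own premise.
  output-above : ∀ {c p₁ p₂ p t} → conn c p₁ p₂ p ∈ links S → GrownIn S t → root t ∈ p₁ ∷ p₂ ∷ [] → p ∉ nodes t
  output-above l∈ g t∈ p∈ = ℕ.<⇒≱ (size-premise l∈ t∈) (size-nodes g p∈)

  -- A common node would make the roots comparable: a position is in the source of at most one link, so
  -- the positions below it form a chain.
  branches-disjoint : ∀ {c p₁ p₂ p r} → conn c p₁ p₂ p ∈ links S → GrownIn S r → root r ∈ p₁ ∷ p₂ ∷ [] →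
    ∀ {s} → GrownIn S s → p ∉ nodes s → root s ∉ nodes r → Disjoint (nodes s) (nodes r)
  branches-disjoint l∈ gr r∈ (leaf _) p∉ s∉ (here refl , q∈) = s∉ q∈
  branches-disjoint l∈ gr r∈ (node _ _ _) p∉ s∉ (here refl , q∈) = s∉ q∈
  branches-disjoint {p = p} {r} l∈ gr r∈ {node c q s₁ s₂} (node l∈′ g₁ g₂) p∉ s∉ (there v∈ , v∈r) =
    [ (λ v∈₁ → branches-disjoint l∈ gr r∈ g₁ (p∉ ∘ there ∘ ∈-++⁺ˡ) (avoids (here refl)) (v∈₁ , v∈r))
    , (λ v∈₂ → branches-disjoint l∈ gr r∈ g₂ (p∉ ∘ there ∘ ∈-++⁺ʳ (nodes s₁)) (avoids (there (here refl))) (v∈₂ , v∈r))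
    ]′ (∈-++⁻ (nodes s₁) v∈)
    where
    avoids : ∀ {v} → v ∈ root s₁ ∷ root s₂ ∷ [] → v ∉ nodes r
    avoids v∈ v∈r with parent gr v∈r
    ... | inj₁ refl with conn-injective (same-source l∈ l∈′ r∈ v∈)
    ...   | _ , _ , _ , refl = p∉ (here refl)
    avoids v∈ v∈r | inj₂ (_ , _ , _ , _ , l∈″ , v∈″ , q∈) with conn-injective (same-source l∈′ l∈″ v∈ v∈″)
    ... | _ , _ , _ , refl = s∉ q∈

  nodes-unique : ∀ {t} → GrownIn S t → Unique (nodes t)
  nodes-unique (leaf _) = [] ∷ []
  nodes-unique {node c p l r} (node l∈ gl gr) =
    All.tabulate (λ {q} q∈ p≡q → below q∈ p≡q) ∷ Unique.++⁺ (nodes-unique gl) (nodes-unique gr)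
      (branches-disjoint l∈ gr (there (here refl)) gl (output-above l∈ gl (here refl)) l∉)
    where
    below : ∀ {q} → q ∈ nodes l ++ nodes r → p ≡ q → ⊥
    below q∈ refl with ∈-++⁻ (nodes l) q∈
    ... | inj₁ q∈l = output-above l∈ gl (here refl) q∈l
    ... | inj₂ q∈r = output-above l∈ gr (there (here refl)) q∈r
    l∉ : root l ∉ nodes r
    -- The premises are distinct, so `root l` inside `r` would not be its root and would have its
    -- link inside `r`. That link is the one with output `p`, which would then lie above its own
    -- premise.
    l∉ q∈ with parent gr q∈ | All.lookup linksWellFormed l∈
    ... | inj₁ eq | (l≢r ∷ _) ∷ _ = l≢r eq
    ... | inj₂ (_ , _ , _ , _ , l∈′ , l∈″ , q∈′) | _ with conn-injective (same-source l∈ l∈′ (here refl) l∈″)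
    ...   | _ , _ , _ , refl = output-above l∈ gr (there (here refl)) q∈′

-- Nets built on a single tree

module _ {S : Hypergraph} where

  balanced⇒IsNet : links S ≢ [] → All (Unique ∘ ends) (links S) → Unique (targets S) →
    targets S ↭ sources S ++ conclusions S → IsNet S
  balanced⇒IsNet nonEmpty wellFormed unique σ = record
    { nonEmpty           = nonEmpty
    ; linksWellFormed    = wellFormed
    ; atMostOneTarget    = unique
    ; atLeastOneTarget   = λ p∈ → [ (λ s → ∈-resp-↭ (↭-sym σ) (∈-++⁺ˡ s)) , id ]′ (position⇒source⊎target (links S) p∈)
    ; atMostOneSource    = proj₁ split
    ; conclusionsOrdered = proj₁ (proj₂ split)
    ; conclusionsExact   = mk⇔
        (λ c → target⇒position (links S) (∈-resp-↭ (↭-sym σ) (∈-++⁺ʳ (sources S) c)) , λ s → proj₂ (proj₂ split) (s , c))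
        (λ (p∈ , ¬s) → [ ⊥-elim ∘ ¬s , id ]′ (∈-++⁻ (sources S) (∈-resp-↭ σ
          ([ ⊥-elim ∘ ¬s , id ]′ (position⇒source⊎target (links S) p∈)))))
    }
    where
    split = Unique-++⁻ (sources S) (Unique-resp-↭ σ unique)

-- `f` is `id` for the net to be switched and `dualConnective` for the test. The par links come
-- first because `switch` consumes them from the head of the list.
treeNet : (Connective → Connective) → Tree → List (List Position) → Hypergraph
treeNet f t pss = hypergraph
  (map (link (f par)) (pars t) ++ map (link (f tensor)) (tensors t) ++ map daimon pss)
  (root t ∷ [])

data LinkOf (f : Connective → Connective) (t : Tree) (pss : List (List Position)) : Link → Set where
  par    : ∀ {x} → x ∈ pars t → LinkOf f t pss (link (f par) x)
  tensor : ∀ {x} → x ∈ tensors t → LinkOf f t pss (link (f tensor) x)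
  daimon : ∀ {ps} → ps ∈ pss → LinkOf f t pss (daimon ps)

module _ (f : Connective → Connective) where

  linkOf : ∀ t {pss l} → l ∈ links (treeNet f t pss) → LinkOf f t pss l
  linkOf t l∈ with ∈-++⁻ (map (link (f par)) (pars t)) l∈
  ... | inj₁ i with ∈-map⁻ (link (f par)) i
  ...   | _ , x∈ , refl = par x∈
  linkOf t l∈ | inj₂ i with ∈-++⁻ (map (link (f tensor)) (tensors t)) i
  ... | inj₁ j with ∈-map⁻ (link (f tensor)) j
  ...   | _ , x∈ , refl = tensor x∈
  linkOf t l∈ | inj₂ i | inj₂ j with ∈-map⁻ daimon j
  ... | _ , ps∈ , refl = daimon ps∈

  linkOf⁻ : ∀ t {pss l} → LinkOf f t pss l → l ∈ links (treeNet f t pss)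
  linkOf⁻ t (par x∈)    = ∈-++⁺ˡ (∈-map⁺ (link (f par)) x∈)
  linkOf⁻ t (tensor x∈) = ∈-++⁺ʳ (map (link (f par)) (pars t)) (∈-++⁺ˡ (∈-map⁺ (link (f tensor)) x∈))
  linkOf⁻ t (daimon x∈) = ∈-++⁺ʳ (map (link (f par)) (pars t)) (∈-++⁺ʳ (map (link (f tensor)) (tensors t)) (∈-map⁺ daimon x∈))

  daimon∈treeNet : ∀ t {pss ps} → daimon ps ∈ links (treeNet f t pss) → ps ∈ pss
  daimon∈treeNet t l∈ with linkOf t l∈
  ... | daimon ps∈ = ps∈

  targets-treeNet : ∀ t pss → concat pss ↭ leaves t → targets (treeNet f t pss) ↭ nodes t
  targets-treeNet t pss σ
    rewrite concatMap-++ target (map (link (f par)) (pars t)) (map (link (f tensor)) (tensors t) ++ map daimon pss)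
          | concatMap-++ target (map (link (f tensor)) (tensors t)) (map daimon pss)
          | targetsOf-link (f par) (pars t) | targetsOf-link (f tensor) (tensors t) | targetsOf-daimon pss =
    trans (++⁺ˡ (map output (pars t)) (++⁺ˡ (map output (tensors t)) σ)) (outputs↭nodes t)

  sources-treeNet : ∀ t pss → root t ∷ sources (treeNet f t pss) ↭ nodes t
  sources-treeNet t pss
    rewrite concatMap-++ source (map (link (f par)) (pars t)) (map (link (f tensor)) (tensors t) ++ map daimon pss)
          | concatMap-++ source (map (link (f tensor)) (tensors t)) (map daimon pss)
          | sourcesOf-link (f par) (pars t) | sourcesOf-link (f tensor) (tensors t) | sourcesOf-daimon pss
          | ++-identityʳ (concatMap premises (tensors t)) = premises↭nodes t

  balanced-treeNet : ∀ t pss → concat pss ↭ leaves t →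
    targets (treeNet f t pss) ↭ sources (treeNet f t pss) ++ conclusions (treeNet f t pss)
  balanced-treeNet t pss σ = trans (targets-treeNet t pss σ) (trans (↭-sym (sources-treeNet t pss)) (∷↭∷ʳ (root t) _))

-- The connectives c and c′ may differ, since a net and its test have dual connectives at the same addresses.
data Spans (S : Hypergraph) : Tree → Set where
  leaf : ∀ {p} → Spans S (leaf p)
  node : ∀ {c c′ p l r} → conn c (root l) (root r) p ∈ links S → Spans S l → Spans S r → Spans S (node c′ p l r)

AddressLess : Hypergraph → Position → Position → Position → Set
AddressLess S r p q = ∃[ u ] ∃[ v ] AtAddress S r u p × AtAddress S r v q × Lex-< _≡_ _<ₛ_ u v

module _ {S : Hypergraph} where

  spans : ∀ (f : Connective → Connective) t → (∀ {x} → x ∈ pars t → link (f par) x ∈ links S) →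
    (∀ {x} → x ∈ tensors t → link (f tensor) x ∈ links S) → Spans S t
  spans f (leaf p) _ _ = leaf
  spans f (node tensor p l r) ps∈ ts∈ = node (ts∈ (here refl))
    (spans f l (ps∈ ∘ ∈-++⁺ˡ) (ts∈ ∘ there ∘ ∈-++⁺ˡ))
    (spans f r (ps∈ ∘ ∈-++⁺ʳ (pars l)) (ts∈ ∘ there ∘ ∈-++⁺ʳ (tensors l)))
  spans f (node par p l r) ps∈ ts∈ = node (ps∈ (here refl))
    (spans f l (ps∈ ∘ there ∘ ∈-++⁺ˡ) (ts∈ ∘ ∈-++⁺ˡ))
    (spans f r (ps∈ ∘ there ∘ ∈-++⁺ʳ (pars l)) (ts∈ ∘ ∈-++⁺ʳ (tensors l)))

  address : ∀ {t p} → Spans S t → p ∈ leaves t → ∃[ w ] AtAddress S (root t) w p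
  address leaf (here refl) = [] , here
  address (node {l = l} l∈ sl sr) p∈ with ∈-++⁻ (leaves l) p∈
  ... | inj₁ p∈l = let w , a = address sl p∈l in left ∷ w , left l∈ a
  ... | inj₂ p∈r = let w , a = address sr p∈r in right ∷ w , right l∈ a

  -- `leaves` reads the tree from left to right: within a branch the first letters of the addresses
  -- agree, and across branches left precedes right.
  leaves-sorted : ∀ {t} → Spans S t → AllPairs (AddressLess S (root t)) (leaves t)
  leaves-sorted leaf = [] ∷ []
  leaves-sorted (node l∈ sl sr) = AllPairs.++⁺
    (AllPairs.map (λ (u , v , a , b , u<v) → left ∷ u , left ∷ v , left l∈ a , left l∈ b , next refl u<v) (leaves-sorted sl))
    (AllPairs.map (λ (u , v , a , b , u<v) → right ∷ u , right ∷ v , right l∈ a , right l∈ b , next refl u<v) (leaves-sorted sr))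
    (All.tabulate λ p∈ → All.tabulate λ q∈ →
      let u , a = address sl p∈
          v , b = address sr q∈
      in left ∷ u , right ∷ v , left l∈ a , right l∈ b , this left<right)

-- There is one conclusion, so the index is `zero` and the addresses decide. The enumeration is the
-- same for all `f` and `pss`, hence shared by a test and the net it is matched with.
treeNet-natural : ∀ f t pss → concat pss ↭ leaves t → NaturalOrder (treeNet f t pss) (leaves t)
treeNet-natural f t pss σ = record
  { initial = mk⇔
      (λ p∈ → let ps , p∈ps , ps∈ = ∈-concat⁻′ pss (∈-resp-↭ (↭-sym σ) p∈) in ps , linkOf⁻ f t (daimon ps∈) , p∈ps)
      (λ (ps , ps∈ , p∈ps) → ∈-resp-↭ σ (∈-concat⁺′ p∈ps (daimon∈treeNet f t ps∈)))
  ; sorted  = AllPairs.map (λ (u , v , a , b , u<v) → (zero , u) , (zero , v) , a , b , inj₂ (refl , u<v))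
      (leaves-sorted (spans f t (linkOf⁻ f t ∘ par) (linkOf⁻ f t ∘ tensor)))
  }

-- Switchings and tests

module Switching (colour : Position → Bool) where

  -- The left premise has priority when both have the colour of the output; in a `Colouring`, the
  -- right one has that colour whenever the left one does not.
  follows : Triple → Bool
  follows (p₁ , p₂ , p) = does (colour p₁ Bool.≟ colour p)

  kept dropped : Triple → Position
  kept    x@(p₁ , p₂ , p) = if follows x then p₁ else p₂
  dropped x@(p₁ , p₂ , p) = if follows x then p₂ else p₁

  above : Tree → List Position
  above (leaf p)            = p ∷ []
  above (node tensor p l r) = above l ++ above r
  above (node par p l r)    = if follows (root l , root r , p) then above l else above r

  -- The conclusions of the switched tree other than its root, with the leaves above them.
  cutOff : Tree → List (Position × List Position)
  cutOff (leaf p)            = []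
  cutOff (node tensor p l r) = cutOff l ++ cutOff r
  cutOff (node par p l r)    =
    (dropped x , (if follows x then above r else above l)) ∷ cutOff l ++ cutOff r
    where x = root l , root r , p

  classes : Tree → List (Position × List Position)
  classes t = (root t , above t) ∷ cutOff t

  blocks : Tree → List (List Position)
  blocks t = map proj₂ (classes t)

  cutOff-heads : ∀ t → map proj₁ (cutOff t) ≡ map dropped (pars t)
  cutOff-heads (leaf p) = refl
  cutOff-heads (node tensor p l r)
    rewrite map-++ proj₁ (cutOff l) (cutOff r) | map-++ dropped (pars l) (pars r) = cong₂ _++_ (cutOff-heads l) (cutOff-heads r)
  cutOff-heads (node par p l r)
    rewrite map-++ proj₁ (cutOff l) (cutOff r) | map-++ dropped (pars l) (pars r) = cong (dropped (root l , root r , p) ∷_) (cong₂ _++_ (cutOff-heads l) (cutOff-heads r))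

  blocks↭leaves : ∀ t → concat (blocks t) ↭ leaves t
  blocks↭leaves (leaf p) = refl
  blocks↭leaves (node tensor p l r)
    rewrite map-++ proj₂ (cutOff l) (cutOff r) | sym (concat-++ (map proj₂ (cutOff l)) (map proj₂ (cutOff r))) =
    trans (solve↭ 4 (λ a b c d → (a ⊕ b) ⊕ (c ⊕ d) ⊜ (a ⊕ c) ⊕ (b ⊕ d)) refl
      (above l) (above r) (concat (map proj₂ (cutOff l))) (concat (map proj₂ (cutOff r))))
      (++⁺ (blocks↭leaves l) (blocks↭leaves r))
  blocks↭leaves (node par p l r)
    rewrite map-++ proj₂ (cutOff l) (cutOff r) | sym (concat-++ (map proj₂ (cutOff l)) (map proj₂ (cutOff r)))
    with follows (root l , root r , p)
  ... | true =
    trans (solve↭ 4 (λ a b c d → a ⊕ (b ⊕ (c ⊕ d)) ⊜ (a ⊕ c) ⊕ (b ⊕ d)) refl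
      (above l) (above r) (concat (map proj₂ (cutOff l))) (concat (map proj₂ (cutOff r))))
      (++⁺ (blocks↭leaves l) (blocks↭leaves r))
  ... | false =
    trans (solve↭ 4 (λ a b c d → b ⊕ (a ⊕ (c ⊕ d)) ⊜ (a ⊕ c) ⊕ (b ⊕ d)) refl
      (above l) (above r) (concat (map proj₂ (cutOff l))) (concat (map proj₂ (cutOff r))))
      (++⁺ (blocks↭leaves l) (blocks↭leaves r))

  kept-dropped : ∀ ts → map kept ts ++ map dropped ts ↭ concatMap premises ts
  kept-dropped [] = refl
  kept-dropped (x@(p₁ , p₂ , p) ∷ ts) with follows x
  ... | true = prep p₁ (trans (shift p₂ (map kept ts) _) (prep p₂ (kept-dropped ts)))
  ... | false = trans (prep p₂ (trans (shift p₁ (map kept ts) _) (prep p₁ (kept-dropped ts)))) (swap p₂ p₁ refl)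

  mapTarget-∘ : ∀ (ι : Position → Position) a b l → mapTarget (id [ a ↦ b ]) (mapTarget ι l) ≡ mapTarget (ι [ a ↦ b ]) l
  mapTarget-∘ ι a b (conn c p₁ p₂ p) = refl
  mapTarget-∘ ι a b (cut p₁ p₂)      = refl
  mapTarget-∘ ι a b (daimon ps)      = cong daimon (sym (map-∘ ps))

  -- Successive replacements of targets compose into `ι`, so every state reached is the image under
  -- `mapTarget ι` of the links not yet deleted.
  switchStep : ∀ ι x ls cs → (hypergraph (mapTarget ι (link par x) ∷ map (mapTarget ι) ls) cs , ι) ⟶ₛ
    (hypergraph (map (mapTarget (ι [ kept x ↦ ι (output x) ])) ls) (cs ∷ʳ dropped x) , ι [ kept x ↦ ι (output x) ])
  switchStep ι x@(p₁ , p₂ , p) ls cs with follows x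
  ... | true  = subst (λ ks → state ⟶ₛ (hypergraph ks (cs ∷ʳ p₂) , ι [ p₁ ↦ ι p ]))
    (≡-trans (sym (map-∘ ls)) (map-cong (mapTarget-∘ ι p₁ (ι p)) ls)) (left (map (mapTarget ι) ls) refl)
    where state = hypergraph (mapTarget ι (link par x) ∷ map (mapTarget ι) ls) cs , ι
  ... | false = subst (λ ks → state ⟶ₛ (hypergraph ks (cs ∷ʳ p₁) , ι [ p₂ ↦ ι p ]))
    (≡-trans (sym (map-∘ ls)) (map-cong (mapTarget-∘ ι p₂ (ι p)) ls)) (right (map (mapTarget ι) ls) refl)
    where state = hypergraph (mapTarget ι (link par x) ∷ map (mapTarget ι) ls) cs , ι

  record Switched (ι : Position → Position) (xs : List Triple) (ls : List Link) (cs : List Position) : Set where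
    field
      ι′     : Position → Position
      steps  : Star _⟶ₛ_ (hypergraph (map (mapTarget ι) (map (link par) xs ++ ls)) cs , ι)
                         (hypergraph (map (mapTarget ι′) ls) (cs ++ map dropped xs) , ι′)
      coarser   : ∀ {p q} → ι p ≡ ι q → ι′ p ≡ ι′ q
      kept≡output : ∀ {x} → x ∈ xs → ι′ (kept x) ≡ ι′ (output x)
      fixed     : ∀ {p} → p ∉ map kept xs → ι p ≡ p → ι′ p ≡ p

  ↦-at : ∀ ι {a b} p → ι p ≡ a → (ι [ a ↦ b ]) p ≡ b
  ↦-at ι {a} p eq rewrite dec-true (ι p ℕ.≟ a) eq = refl

  ↦-away : ∀ ι {a b} p → ι p ≢ a → (ι [ a ↦ b ]) p ≡ ι p
  ↦-away ι {a} p neq rewrite dec-false (ι p ℕ.≟ a) neq = refl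

  ↦-same : ∀ ι {a} p → (ι [ a ↦ ι p ]) p ≡ ι p
  ↦-same ι {a} p with does (ι p ℕ.≟ a)
  ... | true  = refl
  ... | false = refl

  switch : ∀ ι xs ls cs → Unique (map kept xs) → (∀ {x} → x ∈ xs → ι (kept x) ≡ kept x) → Switched ι xs ls cs
  switch ι [] ls cs _ _ = record
    { ι′          = ι
    ; steps       = subst (λ ds → Star _⟶ₛ_ (hypergraph (map (mapTarget ι) ls) cs , ι) (hypergraph (map (mapTarget ι) ls) ds , ι))
                      (sym (++-identityʳ cs)) ε
    ; coarser     = id
    ; kept≡output = λ ()
    ; fixed       = λ _ eq → eq
    }
  switch ι (x ∷ xs) ls cs u ι-fixes = record
    { ι′          = ι′
    ; steps       = switchStep ι x (map (link par) xs ++ ls) cs ◅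
                      subst (λ ds → Star _⟶ₛ_ (hypergraph (map (mapTarget ι₁) (map (link par) xs ++ ls)) (cs ∷ʳ dropped x) , ι₁)
                                              (hypergraph (map (mapTarget ι′) ls) ds , ι′)) (∷ʳ-++ cs (dropped x) _) steps
    -- A replacement is a function applied after `ι`, hence preserves the equalities between values
    -- of `ι`.
    ; coarser     = coarser ∘ cong (λ p → if does (p ℕ.≟ kept x) then ι (output x) else p)
    ; kept≡output = λ where
        -- Both values become `ι (output x)`, even if that is itself the value being replaced.
        (here refl) → coarser (≡-trans (↦-at ι (kept x) (ι-fixes (here refl))) (sym (↦-same ι (output x))))
        (there y∈)  → kept≡output y∈
    ; fixed       = λ {p} p∉ eq → fixed (p∉ ∘ there)
        (≡-trans (↦-away ι p λ eq′ → p∉ (here (≡-trans (sym eq) eq′))) eq)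
    }
    where
    ι₁ = ι [ kept x ↦ ι (output x) ]
    ι-fixes′ : ∀ {y} → y ∈ xs → ι₁ (kept y) ≡ kept y
    ι-fixes′ {y} y∈ = ≡-trans (↦-away ι (kept y) λ eq → Unique-head u
      (subst (_∈ map kept xs) (≡-trans (sym (ι-fixes (there y∈))) eq) (∈-map⁺ kept y∈))) (ι-fixes (there y∈))
    rest : Switched ι₁ xs ls (cs ∷ʳ dropped x)
    rest = switch ι₁ xs ls (cs ∷ʳ dropped x) (Unique-tail u) ι-fixes′
    open Switched rest

mapTarget-id : ∀ l → mapTarget id l ≡ l
mapTarget-id (conn c p₁ p₂ p) = refl
mapTarget-id (cut p₁ p₂)      = refl
mapTarget-id (daimon ps)      = cong daimon (map-id ps)

-- Applied to the descent in a switched net: an initial position reaches one conclusion only.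
Star-deterministic : ∀ {A : Set} {R : A → A → Set} → (∀ {x y z} → R x y → R x z → y ≡ z) →
  ∀ {x y z} → Star R x y → Star R x z → (∀ {w} → ¬ R y w) → (∀ {w} → ¬ R z w) → y ≡ z
Star-deterministic det ε ε _ _ = refl
Star-deterministic det ε (r ◅ _) stuck _ = ⊥-elim (stuck r)
Star-deterministic det (r ◅ _) ε _ stuck = ⊥-elim (stuck r)
Star-deterministic det (r ◅ rs) (r′ ◅ rs′) stuck stuck′ with det r r′
... | refl = Star-deterministic det rs rs′ stuck stuck′

module Tests (𝒱 : PropositionalVariables) {S : Hypergraph} {Γ : MLL✠.Sequent 𝒱} (S-testable : MLL✠.AtomicallyTestable 𝒱 S Γ)
  (colour : Position → Bool) where
  open MLL✠ 𝒱
  open AtomicallyTestable S-testable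
  open IsNet isNet using (linksWellFormed)
  open Growth 𝒱 S-testable
  open Switching colour

  treeNet-testable : (f : Connective → Connective) (g : Formula → Formula) →
    (∀ c A B → g (compound c A B) ≡ compound (f c) (g A) (g B)) → (∀ X → ∃[ Y ] g (var X) ≡ var Y) →
    ∀ {t pss ps} → GrownIn S t → ps ∈ pss → concat pss ↭ leaves t →
    AtomicallyTestable (treeNet f t pss) (g (τ (root t)) ∷ [])
  treeNet-testable f g g-compound g-var {t} {pss} grown ps∈ σ = record
    { isNet     = balanced⇒IsNet (nonEmpty (linkOf⁻ f t (daimon ps∈))) (All.tabulate wellFormed) unique (balanced-treeNet f t pss σ)
    ; cutFree   = λ l∈ → noCut (linkOf f t l∈)
    ; τ         = g ∘ τ
    ; labelling = λ l∈ → labelling′ (linkOf f t l∈)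
    ; atomic    = λ (ps , ps∈ , p∈ps) → atomic′ (∈-resp-↭ σ (∈-concat⁺′ p∈ps (daimon∈treeNet f t ps∈)))
    ; labels    = refl
    }
    where
    nonEmpty : ∀ {l ls} → l ∈ ls → ls ≢ []
    nonEmpty () refl
    unique : Unique (targets (treeNet f t pss))
    unique = Unique-resp-↭ (↭-sym (targets-treeNet f t pss σ)) (nodes-unique grown)
    wellFormed : ∀ {l} → l ∈ links (treeNet f t pss) → Unique (ends l)
    wellFormed l∈ with linkOf f t l∈
    ... | par x∈    = All.lookup linksWellFormed (pars∈links grown x∈)
    ... | tensor x∈ = All.lookup linksWellFormed (tensors∈links grown x∈)
    ... | daimon _  = Unique-concatMap⁻ target unique l∈
    noCut : ∀ {p q} → ¬ LinkOf f t pss (cut p q)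
    noCut ()
    labelling′ : ∀ {c p₁ p₂ p} → LinkOf f t pss (conn c p₁ p₂ p) → g (τ p) ≡ compound c (g (τ p₁)) (g (τ p₂))
    labelling′ (par x∈)    = ≡-trans (cong g (labelling (pars∈links grown x∈))) (g-compound _ _ _)
    labelling′ (tensor x∈) = ≡-trans (cong g (labelling (tensors∈links grown x∈))) (g-compound _ _ _)
    atomic′ : ∀ {p} → p ∈ leaves t → ∃[ X ] g (τ p) ≡ var X
    atomic′ p∈ = let X , eq = atomic (leaves-initial grown p∈)
                     Y , eq′ = g-var X
                 in Y , ≡-trans (cong g eq) eq′

  test : Tree → Hypergraph
  test t = treeNet dualConnective t (blocks t)

  module _ {t : Tree} (grown : GrownIn S t) where

    private
      -- The net required by the definition of tests. A single daimon link on all leaves is enough,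
      -- as the classes of a switching depend only on the connectives below the leaves.
      host : Hypergraph
      host = treeNet id t (leaves t ∷ [])

      persistent : List Link
      persistent = map (link tensor) (tensors t) ++ daimon (leaves t) ∷ []

      -- From `nodes-unique`: the kept premises, the heads (the root and the dropped premises) and
      -- the premises of tensor links list every node once. It makes the descent deterministic and
      -- the heads terminal.
      split : Unique (map kept (pars t)) × Unique (map proj₁ (classes t) ++ concatMap premises (tensors t)) ×
              Disjoint (map kept (pars t)) (map proj₁ (classes t) ++ concatMap premises (tensors t))
      split = Unique-++⁻ (map kept (pars t)) (Unique-resp-↭ (↭-sym σ) (nodes-unique grown))
        where
        σ : map kept (pars t) ++ map proj₁ (classes t) ++ concatMap premises (tensors t) ↭ nodes t
        σ rewrite cutOff-heads t = trans
          (solve↭ 4 (λ x a b c → a ⊕ ((x ⊕ b) ⊕ c) ⊜ x ⊕ ((a ⊕ b) ⊕ c)) refl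
            (root t ∷ []) (map kept (pars t)) (map dropped (pars t)) (concatMap premises (tensors t)))
          (trans (prep (root t) (++⁺ʳ _ (kept-dropped (pars t)))) (premises↭nodes t))

      unkept : ∀ {p} → p ∈ map proj₁ (classes t) ++ concatMap premises (tensors t) → p ∉ map kept (pars t)
      unkept p∈ k∈ = proj₂ (proj₂ split) (k∈ , p∈)

      premise-unkept : ∀ {x p} → x ∈ tensors t → p ∈ premises x → p ∉ map kept (pars t)
      premise-unkept x∈ p∈ = unkept (∈-++⁺ʳ (map proj₁ (classes t)) (∈-concatMap premises x∈ p∈))

      process : Switched id (pars t) persistent (root t ∷ [])
      process = switch id (pars t) persistent (root t ∷ []) (proj₁ split) (λ _ → refl)

      open Switched process

      switched : SwitchState
      switched = hypergraph (map (mapTarget ι′) persistent) (root t ∷ map dropped (pars t)) , ι′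

      flow : Position → Position → Set
      flow = Below (proj₁ switched)

      heads≡ : map proj₁ (classes t) ≡ conclusions (proj₁ switched)
      heads≡ = cong (root t ∷_) (cutOff-heads t)

      persistent⁻ : ∀ {l} → l ∈ links (proj₁ switched) →
        (∃[ x ] x ∈ tensors t × l ≡ mapTarget ι′ (link tensor x)) ⊎ l ≡ daimon (map ι′ (leaves t))
      persistent⁻ l∈ with ∈-map⁻ (mapTarget ι′) l∈
      ... | k , k∈ , refl with ∈-++⁻ (map (link tensor) (tensors t)) k∈
      ...   | inj₂ (here refl) = inj₂ refl
      ...   | inj₁ k∈′ with ∈-map⁻ (link tensor) k∈′
      ...     | x , x∈ , refl = inj₁ (x , x∈ , refl)

      noPar : ∀ {p₁ p₂ p} → conn par p₁ p₂ p ∉ links (proj₁ switched)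
      noPar l∈ with persistent⁻ l∈
      ... | inj₁ (_ , _ , ())
      ... | inj₂ ()

      switching : IsSwitching host switched
      switching = subst (λ ls → Star _⟶ₛ_ (hypergraph ls (root t ∷ []) , id) switched)
                    (≡-trans (map-cong mapTarget-id (links host)) (map-id (links host))) steps
                , λ where
                    (_ , left context σ)  → noPar (∈-resp-↭ (↭-sym σ) (here refl))
                    (_ , right context σ) → noPar (∈-resp-↭ (↭-sym σ) (here refl))

      flow-step : ∀ {p p₁ p₂ q} → (p₁ , p₂ , p) ∈ tensors t → q ∈ p₁ ∷ p₂ ∷ [] → flow (ι′ q) (ι′ p)
      flow-step {p} {p₁} {p₂} x∈ q∈ =
        mapTarget ι′ (conn tensor p₁ p₂ p) , ∈-map⁺ (mapTarget ι′) (∈-++⁺ˡ (∈-map⁺ (link tensor) x∈)) ,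
        -- Premises of tensor links are never kept premises of par links, so `ι′` fixes them.
        subst (_∈ p₁ ∷ p₂ ∷ []) (sym (fixed (premise-unkept x∈ q∈) refl)) q∈ , here refl

      -- Tensor links are crossed by `flow-step`. A par link needs no step at all, since `ι′`
      -- identifies its output with the kept premise.
      above-flow : ∀ s → (∀ {x} → x ∈ pars s → x ∈ pars t) → (∀ {x} → x ∈ tensors s → x ∈ tensors t) →
        ∀ {p} → p ∈ above s → Star flow (ι′ p) (ι′ (root s))
      above-flow (leaf q) _ _ (here refl) = ε
      above-flow (node tensor q l r) ⊆ ⊆′ p∈ with ∈-++⁻ (above l) p∈
      ... | inj₁ p∈l = above-flow l (⊆ ∘ ∈-++⁺ˡ) (⊆′ ∘ there ∘ ∈-++⁺ˡ) p∈l ◅◅ flow-step (⊆′ (here refl)) (here refl) ◅ ε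
      ... | inj₂ p∈r = above-flow r (⊆ ∘ ∈-++⁺ʳ (pars l)) (⊆′ ∘ there ∘ ∈-++⁺ʳ (tensors l)) p∈r ◅◅ flow-step (⊆′ (here refl)) (there (here refl)) ◅ ε
      above-flow (node par q l r) ⊆ ⊆′ p∈ with follows (root l , root r , q) | kept≡output (⊆ (here refl))
      ... | true  | eq = subst (Star flow _) eq (above-flow l (⊆ ∘ there ∘ ∈-++⁺ˡ) (⊆′ ∘ ∈-++⁺ˡ) p∈)
      ... | false | eq = subst (Star flow _) eq (above-flow r (⊆ ∘ there ∘ ∈-++⁺ʳ (pars l)) (⊆′ ∘ ∈-++⁺ʳ (tensors l)) p∈)

      cutOff-flow : ∀ s → (∀ {x} → x ∈ pars s → x ∈ pars t) → (∀ {x} → x ∈ tensors s → x ∈ tensors t) →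
        ∀ {q ps p} → (q , ps) ∈ cutOff s → p ∈ ps → Star flow (ι′ p) (ι′ q)
      cutOff-flow (node tensor _ l r) ⊆ ⊆′ c∈ p∈ with ∈-++⁻ (cutOff l) c∈
      ... | inj₁ c∈l = cutOff-flow l (⊆ ∘ ∈-++⁺ˡ) (⊆′ ∘ there ∘ ∈-++⁺ˡ) c∈l p∈
      ... | inj₂ c∈r = cutOff-flow r (⊆ ∘ ∈-++⁺ʳ (pars l)) (⊆′ ∘ there ∘ ∈-++⁺ʳ (tensors l)) c∈r p∈
      cutOff-flow (node par q l r) ⊆ ⊆′ (here refl) p∈ with follows (root l , root r , q)
      ... | true  = above-flow r (⊆ ∘ there ∘ ∈-++⁺ʳ (pars l)) (⊆′ ∘ ∈-++⁺ʳ (tensors l)) p∈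
      ... | false = above-flow l (⊆ ∘ there ∘ ∈-++⁺ˡ) (⊆′ ∘ ∈-++⁺ˡ) p∈
      cutOff-flow (node par _ l r) ⊆ ⊆′ (there c∈) p∈ with ∈-++⁻ (cutOff l) c∈
      ... | inj₁ c∈l = cutOff-flow l (⊆ ∘ there ∘ ∈-++⁺ˡ) (⊆′ ∘ ∈-++⁺ˡ) c∈l p∈
      ... | inj₂ c∈r = cutOff-flow r (⊆ ∘ there ∘ ∈-++⁺ʳ (pars l)) (⊆′ ∘ ∈-++⁺ʳ (tensors l)) c∈r p∈

      classes-flow : ∀ {q ps p} → (q , ps) ∈ classes t → p ∈ ps → Star flow (ι′ p) q
      classes-flow c∈ p∈ = subst (Star flow _) (fixed (unkept (∈-++⁺ˡ (∈-map⁺ proj₁ c∈))) refl) (towards c∈ p∈)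
        where
        towards : ∀ {q ps p} → (q , ps) ∈ classes t → p ∈ ps → Star flow (ι′ p) (ι′ q)
        towards (here refl) = above-flow t id id
        towards (there c∈)  = cutOff-flow t id id c∈

      flow-tensor : ∀ {p q} → flow p q → ∃[ x ] x ∈ tensors t × p ∈ premises x × q ≡ ι′ (output x)
      flow-tensor (l , l∈ , p∈ , q∈) with persistent⁻ l∈
      ... | inj₁ (x , x∈ , refl) with q∈
      ...   | here refl = x , x∈ , p∈ , refl
      flow-tensor (l , l∈ , () , q∈) | inj₂ refl

      flow-deterministic : ∀ {p q q′} → flow p q → flow p q′ → q ≡ q′
      flow-deterministic f f′ with flow-tensor f | flow-tensor f′
      ... | x , x∈ , p∈ , refl | x′ , x′∈ , p∈′ , refl =
        cong (ι′ ∘ output) (Unique-concatMap⇒≡ premises (proj₁ (proj₂ (Unique-++⁻ (map proj₁ (classes t)) (proj₁ (proj₂ split))))) x∈ x′∈ p∈ p∈′)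

      head-terminal : ∀ {q p} → q ∈ map proj₁ (classes t) → ¬ flow q p
      head-terminal q∈ f with flow-tensor f
      ... | x , x∈ , p∈ , _ = proj₂ (proj₂ (Unique-++⁻ (map proj₁ (classes t)) (proj₁ (proj₂ split)))) (q∈ , ∈-concatMap premises x∈ p∈)

      heads-unique : Unique (map proj₁ (classes t))
      heads-unique = proj₁ (Unique-++⁻ (map proj₁ (classes t)) (proj₁ (proj₂ split)))

      head-injective : ∀ {xs : List (Position × List Position)} {q ps ps′} → Unique (map proj₁ xs) → (q , ps) ∈ xs → (q , ps′) ∈ xs → ps ≡ ps′
      head-injective u (here refl) (here refl) = refl
      head-injective u (here refl) (there c∈) = ⊥-elim (Unique-head u (∈-map⁺ proj₁ c∈))
      head-injective u (there c∈) (here refl) = ⊥-elim (Unique-head u (∈-map⁺ proj₁ c∈))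
      head-injective u (there c∈) (there c∈′) = head-injective (Unique-tail u) c∈ c∈′

      -- For the converse, a leaf lies in some block and descends to its head. The descent is
      -- deterministic and heads are terminal, so a leaf that also descends to `q` belongs to the
      -- block of `q`.
      class≐ : ∀ {q ps} → (q , ps) ∈ classes t → (_∈ ps) ≐ (λ p → Initial host p × Star flow (ι′ p) q)
      class≐ {q} {ps} c∈ = (λ p∈ → initial p∈ , classes-flow c∈ p∈) , λ (i , path) → converse i path
        where
        initial : ∀ {p} → p ∈ ps → Initial host p
        initial p∈ = leaves t , linkOf⁻ id t (daimon (here refl)) , ∈-resp-↭ (blocks↭leaves t) (∈-concat⁺′ p∈ (∈-map⁺ proj₂ c∈))
        converse : ∀ {p} → Initial host p → Star flow (ι′ p) q → p ∈ ps
        converse (ps′ , ps′∈ , p∈′) path with daimon∈treeNet id t ps′∈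
        ... | here refl with ∈-concat⁻′ (blocks t) (∈-resp-↭ (↭-sym (blocks↭leaves t)) p∈′)
        ...   | _ , p∈ , b∈ with ∈-map⁻ proj₂ b∈
        ...     | (q′ , _) , c∈′ , refl
          with Star-deterministic flow-deterministic path (classes-flow c∈′ p∈) (head-terminal (∈-map⁺ proj₁ c∈)) (head-terminal (∈-map⁺ proj₁ c∈′))
        ...       | refl = subst (_ ∈_) (head-injective heads-unique c∈′ c∈) p∈

      Nat-≐ : ∀ {P Q : Position → Set} → P ≐ Q →
        (λ k → ∃[ j ] suc (toℕ j) ≡ k × P (lookup (leaves t) j)) ≐ (λ k → ∃[ j ] suc (toℕ j) ≡ k × Q (lookup (leaves t) j))
      Nat-≐ (to , from) = (λ (j , eq , x) → j , eq , to x) , λ (j , eq , x) → j , eq , from x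

      matching : Nat (leaves t) (P✠ (test t)) ≋ Nat (leaves t) (↑ⁱ host switched)
      matching = forwards , backwards
        where
        forwards : ∀ i → ∃[ j ] proj₂ (Nat (leaves t) (P✠ (test t))) i ≐ proj₂ (Nat (leaves t) (↑ⁱ host switched)) j
        forwards (ps , ps∈) with ∈-map⁻ proj₂ (daimon∈treeNet dualConnective t ps∈)
        ... | (q , _) , c∈ , refl = (q , subst (q ∈_) heads≡ (∈-map⁺ proj₁ c∈)) , Nat-≐ (class≐ c∈)
        backwards : ∀ j → ∃[ i ] proj₂ (Nat (leaves t) (P✠ (test t))) i ≐ proj₂ (Nat (leaves t) (↑ⁱ host switched)) j
        backwards (q , q∈) with ∈-map⁻ proj₁ (subst (q ∈_) (sym heads≡) q∈)
        ... | (_ , ps) , c∈ , refl = (ps , linkOf⁻ dualConnective t (daimon (∈-map⁺ proj₂ c∈))) , Nat-≐ (class≐ c∈)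

    test∈tests : test t ∈tests τ (root t)
    test∈tests = record
      { testable   = treeNet-testable dualConnective dual (λ _ _ _ → refl) (λ X → _ , refl) grown (here refl) (blocks↭leaves t)
      ; S          = host
      ; S-testable = treeNet-testable id id (λ _ _ _ → refl) (λ X → _ , refl) grown (here refl) (↭-reflexive (++-identityʳ (leaves t)))
      ; σS         = switched
      ; switching  = switching
      ; T-order    = leaves t
      ; T-natural  = treeNet-natural dualConnective t (blocks t) (blocks↭leaves t)
      ; S-order    = leaves t
      ; S-natural  = treeNet-natural id t (leaves t ∷ []) (↭-reflexive (++-identityʳ (leaves t)))
      ; matches    = matching
      }

-- Reduction of painted nets

boolToℕ : Bool → ℕ
boolToℕ true  = 1
boolToℕ false = 0

boolToℕ-injective : ∀ {b b′} → boolToℕ b ≡ boolToℕ b′ → b ≡ b′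
boolToℕ-injective {true}  {true}  _ = refl
boolToℕ-injective {false} {false} _ = refl

-- Colours as propositional variables, so that colourings of the leaves are atomic labellings.
colours : PropositionalVariables
colours = record
  { Variable   = Bool
  ; _ᗮ         = id
  ; involutive = λ _ → refl
  ; countable  = mk↣ boolToℕ-injective
  }

module ℂ = MLL✠ colours
open Formulas colours

-- The colour is stored with the link because a daimon link without outputs has no labels to show
-- it.
Painted : (Position → ℂ.Formula) → Bool × Link → Set
Painted κ (b , conn c p₁ p₂ p) = κ p ≡ ℂ.compound c (κ p₁) (κ p₂)
Painted κ (b , cut p q)        = κ q ≡ ℂ.dual (κ p)
Painted κ (b , daimon ps)      = All (λ p → κ p ≡ ℂ.var b) ps

painted-cut : ∀ {κ b p q l} → CutOf p q l → Painted κ (b , l) → κ q ≡ ℂ.dual (κ p)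
painted-cut direct  eq = eq
painted-cut swapped eq = ≡-trans (sym (dual-involutive _)) (cong ℂ.dual (sym eq))

BothColours : List (Bool × Link) → Set
BothColours xs = ∀ b → ∃[ ps ] (b , daimon ps) ∈ xs

-- `closed` and `unique` express that the net has no conclusions in a form that survives a step by
-- cancelling the two positions that disappear.
record Invariant (κ : Position → ℂ.Formula) (R : Hypergraph) : Set where
  field
    paint    : List (Bool × Link)
    links↭   : map proj₂ paint ↭ links R
    painted  : All (Painted κ) paint
    closed   : sources R ↭ targets R
    unique   : Unique (targets R)
    nonEmpty : links R ≢ []
    total    : conclusions R ≡ []

  painted-link : ∀ {l} → l ∈ links R → ∃[ b ] Painted κ (b , l)
  painted-link l∈ with ∈-map⁻ proj₂ (∈-resp-↭ (↭-sym links↭) l∈)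
  ... | (b , _) , x∈ , refl = b , All.lookup painted x∈

  source∈target : ∀ {l p} → l ∈ links R → p ∈ source l → p ∈ targets R
  source∈target l∈ p∈ = ∈-resp-↭ closed (∈-concatMap source l∈ p∈)

open Invariant

-- The two reasons why reduction cannot end in a single empty daimon link.
data Obstructed {κ R} (I : Invariant κ R) : Set where
  euler  : χ (links R) ≢ 1ℤ → Obstructed I
  colour : BothColours (paint I) → Obstructed I

step-ends : ∀ {ls ks} → ls ⟿ ks → ∃[ p ] ∃[ q ]
  sourcesOf ls ↭ p ∷ q ∷ sourcesOf ks × targetsOf ls ↭ p ∷ q ∷ targetsOf ks
step-ends (multiplicative {p₁} {p₂} {p} {q₁} {q₂} {q} direct) = p , q ,
  solve↭ 6 (λ p₁ p₂ p q q₁ q₂ → p₁ ⊕ (p₂ ⊕ (p ⊕ (q ⊕ (q₁ ⊕ q₂)))) ⊜ p ⊕ (q ⊕ (p₁ ⊕ (q₁ ⊕ (p₂ ⊕ q₂))))) refl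
    (p₁ ∷ []) (p₂ ∷ []) (p ∷ []) (q ∷ []) (q₁ ∷ []) (q₂ ∷ []) , refl
step-ends (multiplicative {p₁} {p₂} {p} {q₁} {q₂} {q} swapped) = p , q ,
  solve↭ 6 (λ p₁ p₂ p q q₁ q₂ → p₁ ⊕ (p₂ ⊕ (q ⊕ (p ⊕ (q₁ ⊕ q₂)))) ⊜ p ⊕ (q ⊕ (p₁ ⊕ (q₁ ⊕ (p₂ ⊕ q₂))))) refl
    (p₁ ∷ []) (p₂ ∷ []) (p ∷ []) (q ∷ []) (q₁ ∷ []) (q₂ ∷ []) , refl
step-ends (glueing {ps} {ps′} {qs} {qs′} {p} {q} c) = p , q , cutEnds c , targets↭ c
  where
  cutEnds : ∀ {l} → CutOf p q l → sourcesOf (daimon (ps ++ p ∷ ps′) ∷ l ∷ daimon (qs ++ q ∷ qs′) ∷ []) ↭ p ∷ q ∷ []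
  cutEnds direct  = refl
  cutEnds swapped = swap q p refl
  targets↭ : ∀ {l} → CutOf p q l → targetsOf (daimon (ps ++ p ∷ ps′) ∷ l ∷ daimon (qs ++ q ∷ qs′) ∷ []) ↭ p ∷ q ∷ ((ps ++ ps′) ++ (qs ++ qs′)) ++ []
  targets↭ direct = solve↭ 6 (λ p q a b c d → (a ⊕ (p ⊕ b)) ⊕ ((c ⊕ (q ⊕ d)) ⊕ ∅) ⊜ p ⊕ (q ⊕ (((a ⊕ b) ⊕ (c ⊕ d)) ⊕ ∅))) refl
    (p ∷ []) (q ∷ []) ps ps′ qs qs′
  targets↭ swapped = targets↭ direct

step-χ : ∀ {ls ks} → ls ⟿ ks → χ ls ≡ χ ks
step-χ (multiplicative direct)  = refl
step-χ (multiplicative swapped) = refl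
step-χ (glueing direct)         = refl
step-χ (glueing swapped)        = refl

step-length : ∀ {ls ks} → ls ⟿ ks → length ks < length ls
step-length (multiplicative _) = s≤s (s≤s (s≤s z≤n))
step-length (glueing _)        = s≤s (s≤s z≤n)

-- Dual compound labels have dual components, so the new cuts again relate dual labels. Glued daimon
-- links are joined by a cut between dual variables, which are equal colours; the merged link keeps
-- this colour, so no colour dies out.
repaint : ∀ {κ ls ks} → ls ⟿ ks → ∀ xs cs → map proj₂ xs ≡ ls ++ cs → All (Painted κ) xs →
  ∃[ ys ] map proj₂ ys ≡ ks ++ cs × All (Painted κ) ys × (∀ {b ps} → (b , daimon ps) ∈ xs → ∃[ qs ] (b , daimon qs) ∈ ys)
repaint (multiplicative {p₁} {p₂} {q₁ = q₁} {q₂} direct) ((b , _) ∷ _ ∷ _ ∷ xs) _ refl (okᵖ ∷ okᶜ ∷ okᵗ ∷ oks)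
  with compound-injective (≡-trans (sym okᵗ) (≡-trans okᶜ (cong ℂ.dual okᵖ)))
... | eq₁ , eq₂ = (b , cut p₁ q₁) ∷ (b , cut p₂ q₂) ∷ xs , refl , eq₁ ∷ eq₂ ∷ oks ,
  λ where (there (there (there x∈))) → _ , there (there x∈)
repaint {κ} (multiplicative {p₁} {p₂} {q₁ = q₁} {q₂} swapped) ((b , _) ∷ _ ∷ _ ∷ xs) _ refl (okᵖ ∷ okᶜ ∷ okᵗ ∷ oks)
  with compound-injective (≡-trans (sym okᵗ) (≡-trans (painted-cut {κ} {b} swapped okᶜ) (cong ℂ.dual okᵖ)))
... | eq₁ , eq₂ = (b , cut p₁ q₁) ∷ (b , cut p₂ q₂) ∷ xs , refl , eq₁ ∷ eq₂ ∷ oks ,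
  λ where (there (there (there x∈))) → _ , there (there x∈)
repaint {κ} (glueing {ps} {ps′} {qs} {qs′} {p} {q} c) ((b , _) ∷ (b″ , l) ∷ (b′ , _) ∷ xs) _ refl (okᵖ ∷ okᶜ ∷ okᵗ ∷ oks)
  with var-injective (≡-trans (sym (All.head (All.++⁻ʳ qs okᵗ)))
         (≡-trans (painted-cut {κ} {b″} c okᶜ) (cong ℂ.dual (All.head (All.++⁻ʳ ps okᵖ)))))
... | refl = (b , daimon ((ps ++ ps′) ++ (qs ++ qs′))) ∷ xs , refl ,
  All.++⁺ (All.++⁺ (All.++⁻ˡ ps okᵖ) (All.tail (All.++⁻ʳ ps okᵖ))) (All.++⁺ (All.++⁻ˡ qs okᵗ) (All.tail (All.++⁻ʳ qs okᵗ))) ∷ oks ,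
  keep c
  where
  keep : ∀ {l b₀ rs} → CutOf p q l → (b₀ , daimon rs) ∈ (b , daimon (ps ++ p ∷ ps′)) ∷ (b″ , l) ∷ (b , daimon (qs ++ q ∷ qs′)) ∷ xs →
    ∃[ ks ] (b₀ , daimon ks) ∈ (b , daimon ((ps ++ ps′) ++ (qs ++ qs′))) ∷ xs
  keep _ (here refl)                 = _ , here refl
  keep () (there (here refl))
  keep _ (there (there (here refl))) = _ , here refl
  keep _ (there (there (there x∈)))  = _ , there x∈

step-invariant : ∀ {κ R R′} → R ⟶ R′ → (I : Invariant κ R) → Σ[ I′ ∈ Invariant κ R′ ] (Obstructed I → Obstructed I′)
step-invariant {κ} {R} (inContext {redex} {reduct} cs r σ) I with ↭-map-inv proj₂ (trans (links↭ I) σ)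
... | xs , eq , τ with repaint r xs cs (sym eq) (All-resp-↭ τ (painted I)) | step-ends r
...   | ys , eq′ , oks , keep | p , q , s↭ , t↭ = I′ , λ where
    (euler χ≢) → euler (χ≢ ∘ ≡-trans χ≡)
    (colour both) → colour λ b → keep (∈-resp-↭ τ (proj₂ (both b)))
  where
  ends↭ : ∀ (f : Link → List Position) → concatMap f redex ↭ p ∷ q ∷ concatMap f reduct →
    concatMap f (links R) ↭ p ∷ q ∷ concatMap f (reduct ++ cs)
  ends↭ f ρ = trans (concatMap-↭ f σ) (trans (↭-reflexive (concatMap-++ f redex cs))
    (trans (++⁺ʳ (concatMap f cs) ρ) (↭-reflexive (cong (λ ps → p ∷ q ∷ ps) (sym (concatMap-++ f reduct cs))))))
  reduct-nonEmpty : ∀ {ls ks} → ls ⟿ ks → ks ++ cs ≢ []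
  reduct-nonEmpty (multiplicative _) ()
  reduct-nonEmpty (glueing _) ()
  χ≡ : χ (links R) ≡ χ (reduct ++ cs)
  χ≡ = ≡-trans (χ-↭ σ) (≡-trans (χ-++ redex cs) (≡-trans (cong (λ n → n ℤ.+ χ cs) (step-χ r)) (sym (χ-++ reduct cs))))
  I′ : Invariant κ (hypergraph (reduct ++ cs) (conclusions R))
  I′ = record
    { paint    = ys
    ; links↭   = ↭-reflexive eq′
    ; painted  = oks
    ; closed   = drop-∷ (drop-∷ (trans (↭-sym (ends↭ source s↭)) (trans (closed I) (ends↭ target t↭))))
    ; unique   = Unique-tail (Unique-tail (Unique-resp-↭ (ends↭ target t↭) (unique I)))
    ; nonEmpty = reduct-nonEmpty r
    ; total    = total I
    }

steps-invariant : ∀ {κ R R′} → R ⟶* R′ → (I : Invariant κ R) → Obstructed I → Σ[ I′ ∈ Invariant κ R′ ] Obstructed I′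
steps-invariant ε        I o = I , o
steps-invariant (s ◅ ss) I o = let I′ , o′ = step-invariant s I in steps-invariant ss I′ (o′ o)

CyclicAt : Hypergraph → Position → Position → Set
CyclicAt R p q = ∃[ ps ] daimon ps ∈ links R × p ∈ ps × q ∈ ps

module _ {κ : Position → ℂ.Formula} {R : Hypergraph} (I : Invariant κ R) where

  reduce-multiplicative : ∀ {p₁ p₂ p q₁ q₂ q l} → CutOf p q l → conn par p₁ p₂ p ∈ links R → l ∈ links R →
    conn tensor q₁ q₂ q ∈ links R → ∃[ R′ ] R ⟶ R′
  reduce-multiplicative {p₁} {p₂} {p} {q₁} {q₂} {q} c p∈ l∈ q∈ with ∈⇒↭₂ (λ ()) p∈ q∈
  ... | ks , σ with ∈-resp-↭ σ l∈
  reduce-multiplicative () p∈ l∈ q∈ | ks , σ | here refl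
  reduce-multiplicative () p∈ l∈ q∈ | ks , σ | there (here refl)
  reduce-multiplicative c p∈ l∈ q∈ | ks , σ | there (there l∈ks) with ∈⇒↭ l∈ks
  ... | cs , ρ = _ , inContext cs (multiplicative c) (trans σ (prep _ (trans (prep _ ρ) (swap _ _ refl))))

  reduce-glueing : ∀ {p q ps qs} → cut p q ∈ links R → daimon ps ∈ links R → daimon qs ∈ links R → p ∈ ps → q ∈ qs →
    (∃[ R′ ] R ⟶ R′) ⊎ CyclicAt R p q
  reduce-glueing {p} {q} {ps} {qs} c∈ ps∈ qs∈ p∈ q∈ with ∈⇒↭ ps∈
  ... | ks , σ with ∈-resp-↭ σ qs∈
  ...   | here refl = inj₂ (ps , ps∈ , p∈ , q∈)
  ...   | there qs∈ks with ∈-resp-↭ σ c∈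
  ...     | there c∈ks with ∈⇒↭₂ (λ ()) c∈ks qs∈ks | ∈-∃++ p∈ | ∈-∃++ q∈
  ...       | cs , ρ | _ , _ , refl | _ , _ , refl = inj₁ (_ , inContext cs (glueing direct) (trans σ (prep _ ρ)))

  -- The labels of the two inputs are dual, which rules out a daimon link against a connective and
  -- two equal connectives. What remains is a redex, unless both inputs come from one daimon link.
  cut-reducible⊎cyclic : ∀ {p q} → cut p q ∈ links R → (∃[ R′ ] R ⟶ R′) ⊎ CyclicAt R p q
  cut-reducible⊎cyclic {p} {q} c∈
    with concatMap-∈⁻ target (links R) (source∈target I c∈ (here refl))
       | concatMap-∈⁻ target (links R) (source∈target I c∈ (there (here refl)))
       | proj₂ (painted-link I c∈)
  ... | daimon ps , l∈ , p∈ | daimon qs , k∈ , q∈ | eq = reduce-glueing c∈ l∈ k∈ p∈ q∈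
  ... | conn c p₁ p₂ p , l∈ , here refl | daimon qs , k∈ , q∈ | eq with painted-link I l∈ | painted-link I k∈
  ...   | _ , eqˡ | _ , eqᵏ with () ← ≡-trans (sym (All.lookup eqᵏ q∈)) (≡-trans eq (cong ℂ.dual eqˡ))
  cut-reducible⊎cyclic {p} {q} c∈ | daimon ps , l∈ , p∈ | conn c q₁ q₂ q , k∈ , here refl | eq with painted-link I l∈ | painted-link I k∈
  ...   | _ , eqˡ | _ , eqᵏ with () ← ≡-trans (sym eqᵏ) (≡-trans eq (cong ℂ.dual (All.lookup eqˡ p∈)))
  cut-reducible⊎cyclic {p} {q} c∈ | conn c p₁ p₂ p , l∈ , here refl | conn c′ q₁ q₂ q , k∈ , here refl | eq
    with ≡-trans (sym (proj₂ (painted-link I k∈))) (≡-trans eq (cong ℂ.dual (proj₂ (painted-link I l∈))))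
  cut-reducible⊎cyclic c∈ | conn par _ _ _ , l∈ , here refl | conn tensor _ _ _ , k∈ , here refl | _ | _ = inj₁ (reduce-multiplicative direct l∈ c∈ k∈)
  cut-reducible⊎cyclic c∈ | conn tensor _ _ _ , l∈ , here refl | conn par _ _ _ , k∈ , here refl | _ | _ = inj₁ (reduce-multiplicative swapped k∈ c∈ l∈)
  cut-reducible⊎cyclic c∈ | conn par _ _ _ , l∈ , here refl | conn par _ _ _ , k∈ , here refl | _ | ()
  cut-reducible⊎cyclic c∈ | conn tensor _ _ _ , l∈ , here refl | conn tensor _ _ _ , k∈ , here refl | _ | ()

  reducible⊎cyclic : ∀ ls → (∀ {l} → l ∈ ls → l ∈ links R) → (∃[ R′ ] R ⟶ R′) ⊎ (∀ {p q} → cut p q ∈ ls → CyclicAt R p q)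
  reducible⊎cyclic [] _ = inj₂ λ ()
  reducible⊎cyclic (l ∷ ls) ⊆ with reducible⊎cyclic ls (⊆ ∘ there)
  ... | inj₁ r = inj₁ r
  reducible⊎cyclic (cut p q ∷ ls) ⊆ | inj₂ cyclic with cut-reducible⊎cyclic (⊆ (here refl))
  ... | inj₁ r = inj₁ r
  ... | inj₂ c = inj₂ λ where
    (here refl) → c
    (there c∈)  → cyclic c∈
  reducible⊎cyclic (conn _ _ _ _ ∷ ls) ⊆ | inj₂ cyclic = inj₂ λ where (there c∈) → cyclic c∈
  reducible⊎cyclic (daimon _ ∷ ls)     ⊆ | inj₂ cyclic = inj₂ λ where (there c∈) → cyclic c∈

  -- An output of a daimon link has a variable as label, so its cut is no multiplicative redex. In a
  -- glueing redex, the second daimon link would share an output with the first one, against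
  -- `unique`.
  cyclic⇒normal : (∀ {p q} → cut p q ∈ links R → CyclicAt R p q) → IsNormalForm _⟶_ R
  cyclic⇒normal cyclic (_ , inContext cs r σ) = impossible r σ
    where
    swap-cyclic : ∀ {p q l} → CutOf p q l → l ∈ links R → CyclicAt R p q
    swap-cyclic direct  l∈ = cyclic l∈
    swap-cyclic swapped l∈ = let ps , ps∈ , q∈ , p∈ = cyclic l∈ in ps , ps∈ , p∈ , q∈
    impossible : ∀ {redex reduct} → redex ⟿ reduct → ¬ (links R ↭ redex ++ cs)
    impossible (multiplicative c) σ with swap-cyclic c (∈-resp-↭ (↭-sym σ) (there (here refl)))
    ... | ps , ps∈ , p∈ , _ with painted-link I ps∈ | painted-link I (∈-resp-↭ (↭-sym σ) (here refl))
    ...   | _ , eq | _ , eq′ with () ← ≡-trans (sym (All.lookup eq p∈)) eq′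
    impossible (glueing {ps} {ps′} {qs} {qs′} {p} {q} {l} c) σ with swap-cyclic c (∈-resp-↭ (↭-sym σ) (there (here refl)))
    ... | rs , rs∈ , p∈ , q∈ with
        Unique-concatMap⇒≡ target (unique I) rs∈ (∈-resp-↭ (↭-sym σ) (here refl)) p∈ (∈-++⁺ʳ ps (here refl))
    ...   | refl = proj₂ (proj₂ (Unique-++⁻ (ps ++ p ∷ ps′) (Unique-resp-↭ (concatMap-↭ target σ) (unique I))))
        (q∈ , ∈-concatMap target {xs = l ∷ daimon (qs ++ q ∷ qs′) ∷ cs} (there (here refl)) (∈-++⁺ʳ qs (here refl)))

normalise : ∀ {κ} n R → length (links R) ℕ.≤ n → Invariant κ R → ∃[ R₀ ] NormalFormOf R R₀
normalise zero R ≤n I with links R | nonEmpty I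
normalise zero R z≤n I | [] | ≢[] = contradiction refl ≢[]
normalise (suc n) R ≤n I with reducible⊎cyclic I (links R) id
... | inj₂ cyclic = R , ε , cyclic⇒normal I cyclic
... | inj₁ (R′ , s@(inContext {redex} {reduct} cs r σ)) =
  let R₀ , ss , nf = normalise n R′ (ℕ.≤-pred (ℕ.≤-trans shorter ≤n)) (proj₁ (step-invariant s I)) in R₀ , s ◅ ss , nf
  where
  shorter : length (reduct ++ cs) < length (links R)
  shorter rewrite ↭-length σ | length-++ redex {cs} | length-++ reduct {cs} = ℕ.+-monoˡ-< (length cs) (step-length r)

-- Normal forms of painted nets

hasCut? : ∀ ls → (∃[ p ] ∃[ q ] cut p q ∈ ls) ⊎ (∀ {p q} → cut p q ∉ ls)
hasCut? [] = inj₂ λ ()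
hasCut? (cut p q ∷ ls) = inj₁ (p , q , here refl)
hasCut? (conn _ _ _ _ ∷ ls) with hasCut? ls
... | inj₁ (p , q , c∈) = inj₁ (p , q , there c∈)
... | inj₂ none = inj₂ λ where (there c∈) → none c∈
hasCut? (daimon _ ∷ ls) with hasCut? ls
... | inj₁ (p , q , c∈) = inj₁ (p , q , there c∈)
... | inj₂ none = inj₂ λ where (there c∈) → none c∈

∈⇒≤sum : ∀ (f : Position → ℕ) {p ps} → p ∈ ps → f p ℕ.≤ sum (map f ps)
∈⇒≤sum f (here refl)          = ℕ.m≤m+n _ _
∈⇒≤sum f {ps = q ∷ _} (there p∈) = ℕ.≤-trans (∈⇒≤sum f p∈) (ℕ.m≤n+m _ (f q))

emptyDaimons : ∀ (ls : List Link) → (∀ {l} → l ∈ ls → l ≡ daimon []) → ls ≡ replicate (length ls) (daimon [])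
emptyDaimons []       _ = refl
emptyDaimons (l ∷ ls) h = cong₂ _∷_ (h (here refl)) (emptyDaimons ls (h ∘ there))

χ-emptyDaimons : ∀ k → χ (replicate k (daimon [])) ≡ ℤ.+ k
χ-emptyDaimons zero    = refl
χ-emptyDaimons (suc k) = cong (λ n → 1ℤ ℤ.+ n) (χ-emptyDaimons k)

module _ {κ : Position → ℂ.Formula} {R : Hypergraph} (I : Invariant κ R) where

  -- A closed net without cuts has no positions, as labels would grow forever along its links.
  climb : (∀ {p q} → cut p q ∉ links R) → ∀ {p} → p ∈ targets R → ∀ n → ∃[ q ] q ∈ targets R × n ℕ.≤ size (κ q)
  climb noCut p∈ zero = _ , p∈ , z≤n
  climb noCut p∈ (suc n) with climb noCut p∈ n
  ... | q , q∈ , n≤ with concatMap-∈⁻ source (links R) (∈-resp-↭ (↭-sym (closed I)) q∈)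
  ...   | cut _ _ , l∈ , _ = ⊥-elim (noCut l∈)
  ...   | conn c p₁ p₂ r , l∈ , q∈l = r , ∈-concatMap target l∈ (here refl) , ℕ.≤-trans (s≤s n≤) (larger q∈l)
    where
    larger : ∀ {q} → q ∈ p₁ ∷ p₂ ∷ [] → size (κ q) < size (κ r)
    larger (here refl)         rewrite proj₂ (painted-link I l∈) = s≤s (ℕ.m≤m+n _ _)
    larger (there (here refl)) rewrite proj₂ (painted-link I l∈) = s≤s (ℕ.m≤n+m _ _)

  cutFree⇒emptyDaimons : (∀ {p q} → cut p q ∉ links R) → ∀ {l} → l ∈ links R → l ≡ daimon []
  cutFree⇒emptyDaimons noCut {l} l∈ = onLink l l∈
    where
    noTarget : ∀ {p} → p ∉ targets R
    -- One more than the sum of the sizes of all labels, hence larger than each of them.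
    noTarget p∈ = let q , q∈ , bound = climb noCut p∈ (suc (sum (map (size ∘ κ) (targets R))))
                  in ℕ.<⇒≱ bound (∈⇒≤sum (size ∘ κ) q∈)
    onLink : ∀ l → l ∈ links R → l ≡ daimon []
    onLink (conn c p₁ p₂ p) l∈ = ⊥-elim (noTarget (∈-concatMap target l∈ (here refl)))
    onLink (cut p q)        l∈ = ⊥-elim (noCut l∈)
    onLink (daimon [])      l∈ = refl
    onLink (daimon (p ∷ _)) l∈ = ⊥-elim (noTarget (∈-concatMap target l∈ (here refl)))

  normal⇒obstructed : IsNormalForm _⟶_ R → Obstructed I →
    (∃[ k ] 2 ℕ.≤ k × R ≡ hypergraph (replicate k (daimon [])) []) ⊎ CyclicCut R
  normal⇒obstructed nf o with hasCut? (links R)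
  ... | inj₁ (p , q , c∈) with cut-reducible⊎cyclic I c∈
  ...   | inj₁ r = ⊥-elim (nf r)
  ...   | inj₂ (ps , ps∈ , p∈ , q∈) = inj₂ (p , q , ps , c∈ , ps∈ , p∈ , q∈)
  normal⇒obstructed nf o | inj₂ noCut = inj₁ (k , 2≤k , cong₂ hypergraph links≡ (total I))
    where
    k = length (links R)
    links≡ : links R ≡ replicate k (daimon [])
    links≡ = emptyDaimons (links R) (cutFree⇒emptyDaimons noCut)
    few : ∀ xs → length xs ℕ.≤ 1 → ¬ BothColours xs
    few [] _ both with () ← proj₂ (both true)
    few (x ∷ []) _ both with both true | both false
    ... | _ , here refl | _ , here ()
    few (_ ∷ _ ∷ _) (s≤s ()) _
    paint-length : length (paint I) ≡ k
    paint-length = ≡-trans (sym (length-map proj₂ (paint I))) (↭-length (links↭ I))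
    -- No links would contradict `nonEmpty`; a single one would contradict χ ≠ 1 or the presence of
    -- both colours.
    large : ∀ n → n ≡ k → Obstructed I → 2 ℕ.≤ n
    large zero eq o with links R | nonEmpty I
    large zero refl o | [] | ≢[] = contradiction refl ≢[]
    large (suc zero) eq (euler χ≢) = ⊥-elim (χ≢ (≡-trans (cong χ links≡) (≡-trans (χ-emptyDaimons k) (cong ℤ.+_ (sym eq)))))
    large (suc zero) eq (colour both) = ⊥-elim (few (paint I) (ℕ.≤-reflexive (≡-trans paint-length (sym eq))) both)
    large (suc (suc n)) _ _ = s≤s (s≤s z≤n)
    2≤k = large k refl o

-- Disjoint sums and interactions

interleave : (Position → A) → (Position → A) → Position → A
-- Even positions come from the left operand and odd ones from the right, so labellings of two nets
-- combine into one of their sum.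
interleave f g zero          = f zero
interleave f g (suc zero)    = g zero
interleave f g (suc (suc n)) = interleave (f ∘ suc) (g ∘ suc) n

interleave-inˡ : ∀ (f g : Position → A) p → interleave f g (inˡ p) ≡ f p
interleave-inˡ f g zero    = refl
interleave-inˡ f g (suc p) rewrite ℕ.+-suc p (p ℕ.+ 0) = interleave-inˡ (f ∘ suc) (g ∘ suc) p

interleave-inʳ : ∀ (f g : Position → A) p → interleave f g (inʳ p) ≡ g p
interleave-inʳ f g zero    = refl
interleave-inʳ f g (suc p) rewrite ℕ.+-suc p (p ℕ.+ 0) = interleave-inʳ (f ∘ suc) (g ∘ suc) p

inˡ-injective : ∀ {p q} → inˡ p ≡ inˡ q → p ≡ q
inˡ-injective = ℕ.*-cancelˡ-≡ _ _ 2

inʳ-injective : ∀ {p q} → inʳ p ≡ inʳ q → p ≡ q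
inʳ-injective = inˡ-injective ∘ ℕ.suc-injective

inˡ≢inʳ : ∀ p q → inˡ p ≢ inʳ q
-- Interleaving two different constants tells even positions from odd ones.
inˡ≢inʳ p q eq with () ← ≡-trans (sym (interleave-inˡ (λ _ → true) (λ _ → false) p))
  (≡-trans (cong (interleave (λ _ → true) (λ _ → false)) eq) (interleave-inʳ (λ _ → true) (λ _ → false) q))

target-rename : ∀ f l → target (renameLink f l) ≡ map f (target l)
target-rename f (conn c p₁ p₂ p) = refl
target-rename f (cut p q)        = refl
target-rename f (daimon ps)      = refl

source-rename : ∀ f l → source (renameLink f l) ≡ map f (source l)
source-rename f (conn c p₁ p₂ p) = refl
source-rename f (cut p q)        = refl
source-rename f (daimon ps)      = refl

targetsOf-rename : ∀ f ls → targetsOf (map (renameLink f) ls) ≡ map f (targetsOf ls)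
targetsOf-rename f []       = refl
targetsOf-rename f (l ∷ ls) = ≡-trans (cong₂ _++_ (target-rename f l) (targetsOf-rename f ls)) (sym (map-++ f (target l) (targetsOf ls)))

sourcesOf-rename : ∀ f ls → sourcesOf (map (renameLink f) ls) ≡ map f (sourcesOf ls)
sourcesOf-rename f []       = refl
sourcesOf-rename f (l ∷ ls) = ≡-trans (cong₂ _++_ (source-rename f l) (sourcesOf-rename f ls)) (sym (map-++ f (source l) (sourcesOf ls)))

χ-rename : ∀ f ls → χ (map (renameLink f) ls) ≡ χ ls
χ-rename f []                         = refl
χ-rename f (conn tensor p₁ p₂ p ∷ ls) = cong (λ n → -1ℤ ℤ.+ n) (χ-rename f ls)
χ-rename f (conn par p₁ p₂ p ∷ ls)    = cong (λ n → 0ℤ ℤ.+ n) (χ-rename f ls)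
χ-rename f (cut p q ∷ ls)             = cong (λ n → -1ℤ ℤ.+ n) (χ-rename f ls)
χ-rename f (daimon ps ∷ ls)           = cong (λ n → 1ℤ ℤ.+ n) (χ-rename f ls)

painted-rename : ∀ {κ κ′ : Position → ℂ.Formula} f → (∀ p → κ′ (f p) ≡ κ p) → ∀ {b} l → Painted κ (b , l) → Painted κ′ (b , renameLink f l)
painted-rename f eq (conn c p₁ p₂ p) h rewrite eq p | eq p₁ | eq p₂ = h
painted-rename f eq (cut p q)        h rewrite eq p | eq q = h
painted-rename f eq (daimon ps)      h = All.map⁺ (All.map (λ {p} → ≡-trans (eq p)) h)

Paintable : (Position → ℂ.Formula) → Link → Set
Paintable κ l = ∃[ b ] Painted κ (b , l)

paintAll : ∀ {κ ls} → All (Paintable κ) ls → ∃[ xs ] map proj₂ xs ≡ ls × All (Painted κ) xs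
paintAll []                  = [] , refl , []
paintAll ((b , h) ∷ hs)      = let xs , eq , oks = paintAll hs in (b , _) ∷ xs , cong (_ ∷_) eq , h ∷ oks

record PaintableNet (κ : Position → ℂ.Formula) (N : Hypergraph) : Set where
  field
    balanced  : targets N ↭ sources N ++ conclusions N
    unique    : Unique (targets N)
    paintable : All (Paintable κ) (links N)

open PaintableNet

module _ (N M : Hypergraph) where

  targets-∥ : targets (N ∥ M) ≡ map inˡ (targets N) ++ map inʳ (targets M)
  targets-∥ = ≡-trans (concatMap-++ target (map (renameLink inˡ) (links N)) _)
    (cong₂ _++_ (targetsOf-rename inˡ (links N)) (targetsOf-rename inʳ (links M)))

  sources-∥ : sources (N ∥ M) ≡ map inˡ (sources N) ++ map inʳ (sources M)
  sources-∥ = ≡-trans (concatMap-++ source (map (renameLink inˡ) (links N)) _)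
    (cong₂ _++_ (sourcesOf-rename inˡ (links N)) (sourcesOf-rename inʳ (links M)))

  χ-∥ : χ (links (N ∥ M)) ≡ χ (links N) ℤ.+ χ (links M)
  χ-∥ = ≡-trans (χ-++ (map (renameLink inˡ) (links N)) _) (cong₂ ℤ._+_ (χ-rename inˡ (links N)) (χ-rename inʳ (links M)))

module _ {κ μ : Position → ℂ.Formula} {N M : Hypergraph} where

  paintable-∥ : PaintableNet κ N → PaintableNet μ M → PaintableNet (interleave κ μ) (N ∥ M)
  paintable-∥ n m = record
    { balanced  = trans (↭-reflexive (targets-∥ N M)) (trans (++⁺ (map⁺ inˡ (balanced n)) (map⁺ inʳ (balanced m)))
        (trans (↭-reflexive (cong₂ _++_ (map-++ inˡ (sources N) (conclusions N)) (map-++ inʳ (sources M) (conclusions M))))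
        (trans (solve↭ 4 (λ a b c d → (a ⊕ b) ⊕ (c ⊕ d) ⊜ (a ⊕ c) ⊕ (b ⊕ d)) refl
          (map inˡ (sources N)) (map inˡ (conclusions N)) (map inʳ (sources M)) (map inʳ (conclusions M)))
        (++⁺ʳ (conclusions (N ∥ M)) (↭-reflexive (sym (sources-∥ N M)))))))
    ; unique    = subst Unique (sym (targets-∥ N M)) (Unique.++⁺ (Unique.map⁺ inˡ-injective (unique n)) (Unique.map⁺ inʳ-injective (unique m))
        λ (v∈ , v∈′) → let p , _ , eq = ∈-map⁻ inˡ v∈
                           q , _ , eq′ = ∈-map⁻ inʳ v∈′
                       in inˡ≢inʳ p q (≡-trans (sym eq) eq′))
    ; paintable = All.++⁺
        (All.map⁺ (All.map (λ {l} (b , h) → b , painted-rename inˡ (interleave-inˡ κ μ) l h) (paintable n)))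
        (All.map⁺ (All.map (λ {l} (b , h) → b , painted-rename inʳ (interleave-inʳ κ μ) l h) (paintable m)))
    }

paintable-empty : ∀ {κ} → PaintableNet κ (hypergraph [] [])
paintable-empty = record { balanced = refl ; unique = [] ; paintable = [] }

cuts-painted : ∀ {κ : Position → ℂ.Formula} ps qs → map κ qs ≡ map (ℂ.dual ∘ κ) ps → All (Paintable κ) (zipWith cut ps qs)
cuts-painted []       []       _  = []
cuts-painted (p ∷ ps) (q ∷ qs) eq = let e , es = ∷-injective eq in (true , e) ∷ cuts-painted ps qs es

sources-cuts : ∀ ps qs → length ps ≡ length qs → sourcesOf (zipWith cut ps qs) ↭ ps ++ qs
sources-cuts []       []       _  = refl
sources-cuts (p ∷ ps) (q ∷ qs) eq = prep p (trans (prep q (sources-cuts ps qs (ℕ.suc-injective eq))) (↭-sym (shift q ps qs)))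

targets-cuts : ∀ ps qs → targetsOf (zipWith cut ps qs) ≡ []
targets-cuts (p ∷ ps) (q ∷ qs) = targets-cuts ps qs
targets-cuts []       _        = refl
targets-cuts (p ∷ ps) []       = refl

χ-cuts : ∀ ps qs → length ps ≡ length qs → χ (zipWith cut ps qs) ≡ ℤ.- (ℤ.+ length ps)
χ-cuts []       []       _  = refl
χ-cuts (p ∷ ps) (q ∷ qs) eq = ≡-trans (cong (λ n → -1ℤ ℤ.+ n) (χ-cuts ps qs (ℕ.suc-injective eq))) (sym (ℤ.neg-distrib-+ 1ℤ (ℤ.+ length ps)))

module _ {κ μ : Position → ℂ.Formula} {N M : Hypergraph} (n : PaintableNet κ N) (m : PaintableNet μ M)
  (N-nonEmpty : links N ≢ []) (dualConclusions : map μ (conclusions M) ≡ map (ℂ.dual ∘ κ) (conclusions N)) where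

  private
    ps qs : List Position
    ps = map inˡ (conclusions N)
    qs = map inʳ (conclusions M)

    n∥m : PaintableNet (interleave κ μ) (N ∥ M)
    n∥m = paintable-∥ n m

    length≡ : length (conclusions N) ≡ length (conclusions M)
    length≡ = ≡-trans (sym (length-map (ℂ.dual ∘ κ) (conclusions N))) (≡-trans (cong length (sym dualConclusions)) (length-map μ (conclusions M)))

    length≡′ : length ps ≡ length qs
    length≡′ = ≡-trans (length-map inˡ (conclusions N)) (≡-trans length≡ (sym (length-map inʳ (conclusions M))))

    dual≡ : map (interleave κ μ) qs ≡ map (ℂ.dual ∘ interleave κ μ) ps
    dual≡ = ≡-trans (sym (map-∘ (conclusions M))) (≡-trans (map-cong (interleave-inʳ κ μ) (conclusions M)) (≡-trans dualConclusions
      (≡-trans (sym (map-cong (λ p → cong ℂ.dual (interleave-inˡ κ μ p)) (conclusions N))) (map-∘ (conclusions N)))))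

    cutsPaintable : All (Paintable (interleave κ μ)) (links (N :: M))
    cutsPaintable = All.++⁺ (cuts-painted ps qs dual≡) (paintable n∥m)

    targets≡ : targets (N :: M) ≡ targets (N ∥ M)
    targets≡ = ≡-trans (concatMap-++ target (zipWith cut ps qs) _) (cong (_++ targets (N ∥ M)) (targets-cuts ps qs))

    some : ∀ {ls : List Link} → ls ≢ [] → ∃[ l ] l ∈ ls
    some {[]}    ≢[] = contradiction refl ≢[]
    some {l ∷ _} _   = l , here refl

    interaction-nonEmpty : links (N :: M) ≢ []
    interaction-nonEmpty eq with some N-nonEmpty
    ... | l , l∈ with () ← subst (renameLink inˡ l ∈_) eq (∈-++⁺ʳ (zipWith cut ps qs) (∈-++⁺ˡ (∈-map⁺ (renameLink inˡ) l∈)))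

    drop≡ : ∀ (rs : List Position) k → length rs ≡ k → drop k rs ≡ []
    drop≡ rs k eq = drop-all k rs (ℕ.≤-reflexive eq)

  χ-interaction : χ (links (N :: M)) ≡ χ (links N) ℤ.+ (χ (links M) ℤ.- ℤ.+ length (conclusions N))
  χ-interaction = ≡-trans (χ-++ (zipWith cut ps qs) _) (≡-trans (cong₂ ℤ._+_ (≡-trans (χ-cuts ps qs length≡′)
      (cong (λ k → ℤ.- (ℤ.+ k)) (length-map inˡ (conclusions N)))) (χ-∥ N M)) (rearrange (ℤ.+ length (conclusions N)) (χ (links N)) (χ (links M))))
    where
    rearrange : ∀ a b c → ℤ.- a ℤ.+ (b ℤ.+ c) ≡ b ℤ.+ (c ℤ.- a)
    rearrange = solve-∀

  -- The painting is chosen by the caller and returned with an equation, because `BothColours`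
  -- speaks about the painting and an empty daimon link could be painted either way.
  interaction-invariant : ∀ xs → map proj₂ xs ↭ links (N :: M) → All (Painted (interleave κ μ)) xs →
    Σ[ I ∈ Invariant (interleave κ μ) (N :: M) ] Invariant.paint I ≡ xs
  interaction-invariant xs σ oks = record
    { paint    = xs
    ; links↭   = σ
    ; painted  = oks
    ; closed   = trans (↭-reflexive (concatMap-++ source (zipWith cut ps qs) _)) (trans (++⁺ʳ _ (sources-cuts ps qs length≡′))
        (trans (++-comm (ps ++ qs) (sources (N ∥ M))) (trans (↭-sym (balanced n∥m)) (↭-reflexive (sym targets≡)))))
    ; unique   = subst Unique (sym targets≡) (unique n∥m)
    ; nonEmpty = interaction-nonEmpty
    ; total    = cong₂ _++_ (drop≡ ps _ (≡-trans (length-map inˡ (conclusions N)) length≡)) (drop≡ qs _ (≡-trans (length-map inʳ (conclusions M)) (sym length≡)))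
    } , refl

  interaction-euler : χ (links (N :: M)) ≢ 1ℤ → Σ[ I ∈ Invariant (interleave κ μ) (N :: M) ] Obstructed I
  interaction-euler χ≢ = let xs , eq , oks = paintAll cutsPaintable
                             I , _ = interaction-invariant xs (↭-reflexive eq) oks
                         in I , euler χ≢

  interaction-separated : ∀ {ps₁ ps₂ ks} → links N ↭ daimon ps₁ ∷ daimon ps₂ ∷ ks →
    All (λ p → κ p ≡ ℂ.var true) ps₁ → All (λ p → κ p ≡ ℂ.var false) ps₂ →
    Σ[ I ∈ Invariant (interleave κ μ) (N :: M) ] Obstructed I
  interaction-separated {ps₁} {ps₂} {ks} σ h₁ h₂ =
    let xs , eq , oks = paintAll (All.tail (All.tail (All-resp-↭ τ cutsPaintable)))
        I , eq′       = interaction-invariant ((true , d₁) ∷ (false , d₂) ∷ xs)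
          (trans (↭-reflexive (cong (λ ls → d₁ ∷ d₂ ∷ ls) eq)) (↭-sym τ))
          (painted-rename inˡ (interleave-inˡ κ μ) (daimon ps₁) h₁ ∷
           painted-rename inˡ (interleave-inˡ κ μ) (daimon ps₂) h₂ ∷ oks)
    in I , colour (subst BothColours (sym eq′) λ where
         true  → _ , here refl
         false → _ , there (here refl))
    where
    d₁ = daimon (map inˡ ps₁)
    d₂ = daimon (map inˡ ps₂)
    τ : links (N :: M) ↭ d₁ ∷ d₂ ∷ (zipWith cut ps qs ++ (map (renameLink inˡ) ks ++ map (renameLink inʳ) (links M)))
    τ = trans (++⁺ˡ (zipWith cut ps qs) (++⁺ʳ _ (map⁺ (renameLink inˡ) σ)))
      (solve↭ 5 (λ d₁ d₂ a b c → a ⊕ ((d₁ ⊕ (d₂ ⊕ b)) ⊕ c) ⊜ d₁ ⊕ (d₂ ⊕ (a ⊕ (b ⊕ c)))) refl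
        (d₁ ∷ []) (d₂ ∷ []) (zipWith cut ps qs) (map (renameLink inˡ) ks) (map (renameLink inʳ) (links M)))

-- Obstructions to correctness

module Incorrectness (𝒱 : PropositionalVariables) where
  open MLL✠ 𝒱

  rename-∈ : ∀ {S T} (f : Position → Position) → map (renameLink f) (links S) ↭ links T → ∀ {p} → p ∈ positions S → f p ∈ positions T
  rename-∈ {S} {T} f σ p∈ with concatMap-∈⁻ ends (links S) p∈
  ... | l , l∈ , p∈l = ∈-concatMap ends {xs = links T} (∈-resp-↭ σ (∈-map⁺ (renameLink f) l∈)) (ends-rename l p∈l)
    where
    ends-rename : ∀ l {p} → p ∈ ends l → f p ∈ ends (renameLink f l)
    ends-rename l p∈ rewrite source-rename f l | target-rename f l | sym (map-++ f (source l) (target l)) = ∈-map⁺ f p∈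

  ++-⊆ : ∀ ls {ks p} → p ∈ concatMap ends ls ⊎ p ∈ concatMap ends ks → p ∈ concatMap ends (ls ++ ks)
  ++-⊆ ls {ks} p∈ rewrite concatMap-++ ends ls ks = [ ∈-++⁺ˡ , ∈-++⁺ʳ (concatMap ends ls) ]′ p∈

  -- Needed for the inputs of a cut: disjointness of two nets applies to them only as positions of
  -- these nets.
  represents-conclusions : ∀ {Γ S} {π : ⊢ Γ} → Represents S π → ∀ {p} → p ∈ conclusions S → p ∈ positions S
  represents-conclusions (✠ {ps = ps} _ _) p∈ rewrite ++-identityʳ ps = p∈
  represents-conclusions (⅋ {cs = cs} {p₁} {p₂} {p} r _) q∈ with ∈-++⁻ cs q∈
  ... | inj₁ q∈cs = there (there (there (represents-conclusions r (∈-++⁺ˡ q∈cs))))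
  ... | inj₂ (here refl) = there (there (here refl))
  represents-conclusions (⊗ {ls = ls} {cs = cs} {ds} r s _ _ _) q∈ with ∈-++⁻ cs q∈
  ... | inj₁ q∈cs = there (there (there (++-⊆ ls (inj₁ (represents-conclusions r (∈-++⁺ˡ q∈cs))))))
  ... | inj₂ q∈′ with ∈-++⁻ ds q∈′
  ...   | inj₁ q∈ds = there (there (there (++-⊆ ls (inj₂ (represents-conclusions s (∈-++⁺ˡ q∈ds))))))
  ...   | inj₂ (here refl) = there (there (here refl))
  represents-conclusions (cut {ls = ls} {cs = cs} r s _) q∈ with ∈-++⁻ cs q∈
  ... | inj₁ q∈cs = there (there (++-⊆ ls (inj₁ (represents-conclusions r (∈-++⁺ˡ q∈cs)))))
  ... | inj₂ q∈ds = there (there (++-⊆ ls (inj₂ (represents-conclusions s (∈-++⁺ˡ q∈ds)))))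
  represents-conclusions (ex {cs = cs} {ds} {p} {q} _ r) q∈ =
    represents-conclusions r (∈-resp-↭ (++⁺ˡ cs (swap q p refl)) q∈)
  represents-conclusions (iso {S = S} {T} i r) {q} q∈ with ∈-map⁻ (_≅_.rename i) (subst (q ∈_) (sym (_≅_.conclusions≡ i)) q∈)
  ... | p , p∈ , refl = rename-∈ {S} {T} (_≅_.rename i) (_≅_.links↭ i) (represents-conclusions r p∈)

  private
    end∈ : ∀ {ls l p} → l ∈ ls → p ∈ ends l → p ∈ concatMap ends ls
    end∈ = ∈-concatMap ends

  cyclic-++ : ∀ {ls ks cs} → Disjoint (concatMap ends ls) (concatMap ends ks) → ¬ CyclicCut (hypergraph ls cs) → ¬ CyclicCut (hypergraph ks cs) →
    ∀ {p q ps} → cut p q ∈ ls ++ ks → daimon ps ∈ ls ++ ks → p ∈ ps → q ∈ ps → ⊥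
  cyclic-++ {ls} {ks} disjoint ¬l ¬k c∈ d∈ p∈ q∈ with ∈-++⁻ ls c∈ | ∈-++⁻ ls d∈
  ... | inj₁ c | inj₁ d = ¬l (_ , _ , _ , c , d , p∈ , q∈)
  ... | inj₂ c | inj₂ d = ¬k (_ , _ , _ , c , d , p∈ , q∈)
  ... | inj₁ c | inj₂ d = disjoint (end∈ {ls} c (here refl) , end∈ {ks} d p∈)
  ... | inj₂ c | inj₁ d = disjoint (end∈ {ls} d p∈ , end∈ {ks} c (here refl))

  -- A cut rule takes its two inputs from nets with disjoint positions, and no rule merges or
  -- enlarges daimon links.
  represents⇒¬cyclic : ∀ {Γ S} {π : ⊢ Γ} → Represents S π → ¬ CyclicCut S
  represents⇒¬cyclic (✠ _ _) (_ , _ , _ , here () , _)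
  represents⇒¬cyclic (⅋ r _) (p , q , ps , there c , there d , p∈ , q∈) = represents⇒¬cyclic r (p , q , ps , c , d , p∈ , q∈)
  represents⇒¬cyclic (⊗ {ls = ls} {ks} r s disjoint _ _) (p , q , ps , there c , there d , p∈ , q∈) =
    cyclic-++ {ls} {ks} {[]} disjoint (represents⇒¬cyclic r) (represents⇒¬cyclic s) c d p∈ q∈
  represents⇒¬cyclic (cut {ls = ls} {ks} r s disjoint) (p , q , ps , there c , there d , p∈ , q∈) =
    cyclic-++ {ls} {ks} {[]} disjoint (represents⇒¬cyclic r) (represents⇒¬cyclic s) c d p∈ q∈
  represents⇒¬cyclic (cut {ls = ls} {ks} {cs} {ds} r s disjoint) (p , q , ps , here refl , there d , p∈ , q∈) with ∈-++⁻ ls d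
  ... | inj₁ d∈ = disjoint (end∈ {ls} d∈ q∈ , represents-conclusions s (∈-++⁺ʳ ds (here refl)))
  ... | inj₂ d∈ = disjoint (represents-conclusions r (∈-++⁺ʳ cs (here refl)) , end∈ {ks} d∈ p∈)
  represents⇒¬cyclic (ex _ r) cyclic = represents⇒¬cyclic r cyclic
  represents⇒¬cyclic (iso {S = S} i r) (p , q , ps , c , d , p∈ , q∈)
    with ∈-map⁻ (renameLink f) (∈-resp-↭ (↭-sym (_≅_.links↭ i)) c) | ∈-map⁻ (renameLink f) (∈-resp-↭ (↭-sym (_≅_.links↭ i)) d)
    where f = _≅_.rename i
  ... | cut p′ q′ , c′ , refl | daimon ps′ , d′ , refl = represents⇒¬cyclic r (p′ , q′ , ps′ , c′ , d′ , back (here refl) p∈ , back (there (here refl)) q∈)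
    where
    f = _≅_.rename i
    back : ∀ {v} → v ∈ p′ ∷ q′ ∷ [] → f v ∈ map f ps′ → v ∈ ps′
    back v∈ fv∈ with ∈-map⁻ f fv∈
    ... | w , w∈ , eq = subst (_∈ ps′) (sym (_≅_.injective i (end∈ {links S} c′ (∈-++⁺ˡ v∈)) (end∈ {links S} d′ w∈) eq)) w∈

  -- Every logical rule adds a connective or a cut link, which leaves the daimon rule, up to
  -- exchange and isomorphism.
  represents⇒single : ∀ {Γ S} {π : ⊢ Γ} → Represents S π → All (_≡ daimon []) (links S) → length (links S) ≡ 1
  represents⇒single (✠ _ _) _ = refl
  represents⇒single (⅋ _ _) (() ∷ _)
  represents⇒single (⊗ _ _ _ _ _) (() ∷ _)
  represents⇒single (cut _ _ _) (() ∷ _)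
  represents⇒single (ex _ r) h = represents⇒single r h
  represents⇒single (iso {S = S} i r) h = ≡-trans (sym (≡-trans (sym (length-map (renameLink f) (links S))) (↭-length (_≅_.links↭ i))))
    (represents⇒single r (All.map (unrename _) (All.map⁻ (All-resp-↭ (↭-sym (_≅_.links↭ i)) h))))
    where
    f = _≅_.rename i
    unrename : ∀ l → renameLink f l ≡ daimon [] → l ≡ daimon []
    unrename (daimon []) refl = refl

-- Interaction with the tests

module Testing (𝒱 : PropositionalVariables) {S : Hypergraph} {Γ : MLL✠.Sequent 𝒱} (S-testable : MLL✠.AtomicallyTestable 𝒱 S Γ)
  {hue : Position → Bool} (mono : Colouring S hue) where
  open MLL✠ 𝒱
  open AtomicallyTestable S-testable
  open IsNet isNet using (atMostOneTarget)
  open Parsing 𝒱 using (target∈targets)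
  open Growth 𝒱 S-testable
  open Switching hue
  open Tests 𝒱 S-testable hue
  open Colouring mono
  open PaintableNet

  -- Defined on trees, since a formula does not record which initial position each of its variables
  -- stands for.
  paintTree : Tree → ℂ.Formula
  paintTree (leaf p)       = ℂ.var (hue p)
  paintTree (node c _ l r) = ℂ.compound c (paintTree l) (paintTree r)

  κ : Position → ℂ.Formula
  κ = paintTree ∘ tree

  κ-conn : ∀ {c p₁ p₂ p} → conn c p₁ p₂ p ∈ links S → κ p ≡ ℂ.compound c (κ p₁) (κ p₂)
  κ-conn l∈ = cong paintTree (tree-node l∈)

  κ-initial : ∀ {p} → Initial S p → κ p ≡ ℂ.var (hue p)
  κ-initial i = cong paintTree (tree-leaf i)

  S-paintable : PaintableNet κ S
  S-paintable = record { balanced = IsNet⇒balanced isNet ; unique = atMostOneTarget ; paintable = All.tabulate (λ {l} → paintable′ l) }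
    where
    paintable′ : ∀ l → l ∈ links S → Paintable κ l
    paintable′ (conn c p₁ p₂ p) l∈ = true , κ-conn l∈
    paintable′ (cut p q)        l∈ = ⊥-elim (cutFree l∈)
    paintable′ (daimon ps)      l∈ = let b , same = daimonMono l∈ in
      b , All.tabulate λ p∈ → ≡-trans (κ-initial (ps , l∈ , p∈)) (cong ℂ.var (All.lookup same p∈))

  -- Tensor links preserve the colour, and by `parMono` the premise selected at a par link has the
  -- colour of the output.
  above-mono : ∀ {t p} → GrownIn S t → p ∈ above t → hue p ≡ hue (root t)
  above-mono (leaf _) (here refl) = refl
  above-mono (node {tensor} {l = l} l∈ gl gr) p∈ with ∈-++⁻ (above l) p∈
  ... | inj₁ p∈l = ≡-trans (above-mono gl p∈l) (proj₁ (tensorMono l∈))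
  ... | inj₂ p∈r = ≡-trans (above-mono gr p∈r) (proj₂ (tensorMono l∈))
  above-mono (node {par} {p} {l} {r} l∈ gl gr) p∈ with hue (root l) Bool.≟ hue p | parMono l∈
  ... | yes eq | _       = ≡-trans (above-mono gl p∈) eq
  ... | no neq | inj₁ eq = contradiction eq neq
  ... | no neq | inj₂ eq = ≡-trans (above-mono gr p∈) eq

  cutOff-mono : ∀ {t q ps p} → GrownIn S t → (q , ps) ∈ cutOff t → p ∈ ps → hue p ≡ hue q
  cutOff-mono (node {tensor} {l = l} _ gl gr) c∈ p∈ with ∈-++⁻ (cutOff l) c∈
  ... | inj₁ c∈l = cutOff-mono gl c∈l p∈
  ... | inj₂ c∈r = cutOff-mono gr c∈r p∈
  cutOff-mono (node {par} {p} {l} {r} _ gl gr) (here refl) p∈ with hue (root l) Bool.≟ hue p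
  ... | yes _ = above-mono gr p∈
  ... | no _  = above-mono gl p∈
  cutOff-mono (node {par} {l = l} _ gl gr) (there c∈) p∈ with ∈-++⁻ (cutOff l) c∈
  ... | inj₁ c∈l = cutOff-mono gl c∈l p∈
  ... | inj₂ c∈r = cutOff-mono gr c∈r p∈

  classes-mono : ∀ {t q ps p} → GrownIn S t → (q , ps) ∈ classes t → p ∈ ps → hue p ≡ hue q
  classes-mono g (here refl) = above-mono g
  classes-mono g (there c∈)  = cutOff-mono g c∈

  -- The daimon links of the test are the classes of the switching, each within one colour by
  -- `classes-mono`; its connectives are labelled by duality.
  test-paintable : ∀ {t} → GrownIn S t → PaintableNet (ℂ.dual ∘ κ) (test t)
  test-paintable {t} g = record
    { balanced  = balanced-treeNet dualConnective t (blocks t) (blocks↭leaves t)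
    ; unique    = Unique-resp-↭ (↭-sym (targets-treeNet dualConnective t (blocks t) (blocks↭leaves t))) (nodes-unique g)
    ; paintable = All.tabulate (λ l∈ → paintable′ (linkOf dualConnective t l∈))
    }
    where
    paintable′ : ∀ {l} → LinkOf dualConnective t (blocks t) l → Paintable (ℂ.dual ∘ κ) l
    paintable′ (par x∈)     = true , cong ℂ.dual (κ-conn (pars∈links g x∈))
    paintable′ (tensor x∈)  = true , cong ℂ.dual (κ-conn (tensors∈links g x∈))
    paintable′ (daimon ps∈) with ∈-map⁻ proj₂ ps∈
    ... | (q , ps) , c∈ , refl = hue q , All.tabulate λ p∈ →
      cong ℂ.dual (≡-trans (κ-initial (leaves-initial g (∈-resp-↭ (blocks↭leaves t) (∈-concat⁺′ p∈ ps∈)))) (cong ℂ.var (classes-mono g c∈ p∈)))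

  length-cutOff : ∀ t → length (cutOff t) ≡ length (pars t)
  length-cutOff t = ≡-trans (sym (length-map proj₁ (cutOff t))) (≡-trans (cong length (cutOff-heads t)) (length-map dropped (pars t)))

  χ-test : ∀ t → χ (links (test t)) ≡ 1ℤ
  χ-test t = ≡-trans (χ-++ (map (link tensor) (pars t)) _) (≡-trans (cong₂ ℤ._+_ (χ-tensors (pars t))
    (≡-trans (χ-++ (map (link par) (tensors t)) _) (cong₂ ℤ._+_ (χ-pars (tensors t)) (χ-daimons (blocks t)))))
    (≡-trans (cong (λ n → ℤ.- (ℤ.+ length (pars t)) ℤ.+ (0ℤ ℤ.+ (1ℤ ℤ.+ ℤ.+ n))) (≡-trans (length-map proj₂ (cutOff t)) (length-cutOff t)))
      (cancel (ℤ.+ length (pars t)))))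
    where
    cancel : ∀ a → ℤ.- a ℤ.+ (0ℤ ℤ.+ (1ℤ ℤ.+ a)) ≡ 1ℤ
    cancel = solve-∀

  testAt : Position → Hypergraph
  testAt = test ∘ tree

  tests-∈ : ∀ {ps} → (∀ {p} → p ∈ ps → p ∈ targets S) → Pointwise _∈tests_ (map testAt ps) (map τ ps)
  tests-∈ {[]}     _ = []
  tests-∈ {p ∷ ps} ⊆ = let g , eq = tree-grown (⊆ (here refl)) in
    subst (λ q → testAt p ∈tests τ q) eq (test∈tests g) ∷ tests-∈ (⊆ ∘ there)

  tests-paintable : ∀ ps → (∀ {p} → p ∈ ps → p ∈ targets S) → ∃[ μ ] PaintableNet μ (∥⋯∥ (map testAt ps)) ×
    map μ (conclusions (∥⋯∥ (map testAt ps))) ≡ map (ℂ.dual ∘ κ) ps × χ (links (∥⋯∥ (map testAt ps))) ≡ ℤ.+ length ps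
  tests-paintable []       _ = (λ _ → ℂ.var true) , paintable-empty , refl , refl
  tests-paintable (p ∷ ps) ⊆ with tests-paintable ps (⊆ ∘ there) | tree-grown (⊆ (here refl))
  ... | μ , m , eq , χ≡ | g , root≡ = interleave (ℂ.dual ∘ κ) μ , paintable-∥ (test-paintable g) m ,
    cong₂ _∷_ (≡-trans (interleave-inˡ (ℂ.dual ∘ κ) μ (root (tree p))) (cong (ℂ.dual ∘ κ) root≡))
      (≡-trans (sym (map-∘ cs)) (≡-trans (map-cong (interleave-inʳ (ℂ.dual ∘ κ) μ) cs) eq)) ,
    ≡-trans (χ-∥ (testAt p) (∥⋯∥ (map testAt ps))) (cong₂ ℤ._+_ (χ-test (tree p)) χ≡)
    where cs = conclusions (∥⋯∥ (map testAt ps))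

  Conclusion : Set
  Conclusion = ∃[ Ts ] Pointwise _∈tests_ Ts Γ ×
      (∃[ S₀ ] NormalFormOf (S :: ∥⋯∥ Ts) S₀) ×
      (∀ S₀ → NormalFormOf (S :: ∥⋯∥ Ts) S₀ →
        ¬ Correct S₀ ×
        ((∃[ k ] 2 ℕ.≤ k × S₀ ≡ hypergraph (replicate k (daimon [])) []) ⊎ CyclicCut S₀))

  conclusion∈targets : ∀ {p} → p ∈ conclusions S → p ∈ targets S
  conclusion∈targets p∈ = ∈-resp-↭ (↭-sym (IsNet⇒balanced isNet)) (∈-++⁺ʳ (sources S) p∈)

  obstructed⇒incorrect : ∀ S₀ → (∃[ k ] 2 ℕ.≤ k × S₀ ≡ hypergraph (replicate k (daimon [])) []) ⊎ CyclicCut S₀ → ¬ Correct S₀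
  obstructed⇒incorrect S₀ (inj₂ cyclic) (_ , π , r) = Incorrectness.represents⇒¬cyclic 𝒱 r cyclic
  obstructed⇒incorrect S₀ (inj₁ (k , 2≤k , refl)) (_ , π , r) = ℕ.<⇒≢ 2≤k
    (sym (≡-trans (sym (length-replicate k)) (Incorrectness.represents⇒single 𝒱 r (All.replicate⁺ k refl))))

  conclude : χ (links S) ≢ 1ℤ ⊎ Separates (links S) hue → Conclusion
  conclude bad = Ts , subst (Pointwise _∈tests_ Ts) labels (tests-∈ conclusion∈targets) ,
    normalise _ (S :: ∥⋯∥ Ts) ℕ.≤-refl (proj₁ invariant) ,
    λ S₀ (steps , nf) →
      let I , o  = steps-invariant steps (proj₁ invariant) (proj₂ invariant)
          result = normal⇒obstructed I nf o
      in obstructed⇒incorrect S₀ result , result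
    where
    Ts = map testAt (conclusions S)
    μ = proj₁ (tests-paintable (conclusions S) conclusion∈targets)
    m = proj₁ (proj₂ (tests-paintable (conclusions S) conclusion∈targets))
    dual≡ = proj₁ (proj₂ (proj₂ (tests-paintable (conclusions S) conclusion∈targets)))
    χ≡ = proj₂ (proj₂ (proj₂ (tests-paintable (conclusions S) conclusion∈targets)))
    cancel : ∀ a b → a ℤ.+ (b ℤ.- b) ≡ a
    cancel = solve-∀
    χ-S : χ (links (S :: ∥⋯∥ Ts)) ≡ χ (links S)
    χ-S = ≡-trans (χ-interaction S-paintable m (IsNet.nonEmpty isNet) dual≡)
      (≡-trans (cong (λ n → χ (links S) ℤ.+ (n ℤ.- ℤ.+ length (conclusions S))) χ≡) (cancel (χ (links S)) (ℤ.+ length (conclusions S))))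
    daimon-hue : ∀ {ps b} → daimon ps ∈ links S → All (λ p → hue p ≡ b) ps → All (λ p → κ p ≡ ℂ.var b) ps
    daimon-hue d∈ same = All.tabulate λ p∈ → ≡-trans (κ-initial (_ , d∈ , p∈)) (cong ℂ.var (All.lookup same p∈))
    obstruction : χ (links S) ≢ 1ℤ ⊎ Separates (links S) hue → Σ[ I ∈ Invariant (interleave κ μ) (S :: ∥⋯∥ Ts) ] Obstructed I
    obstruction (inj₁ χ≢) = interaction-euler S-paintable m (IsNet.nonEmpty isNet) dual≡ (χ≢ ∘ ≡-trans (sym χ-S))
    obstruction (inj₂ (ps , qs , ks , σ , h₁ , h₂)) = interaction-separated S-paintable m (IsNet.nonEmpty isNet) dual≡ σ
      (daimon-hue (∈-resp-↭ (↭-sym σ) (here refl)) h₁) (daimon-hue (∈-resp-↭ (↭-sym σ) (there (here refl))) h₂)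
    invariant = obstruction bad

-- Selects the left premise of every par link, a default choice of tests for the case χ ≠ 1.
constant-colouring : ∀ S → Colouring S (λ _ → true)
constant-colouring S = record
  { tensorMono = λ _ → refl , refl
  ; parMono    = λ _ → inj₁ refl
  ; daimonMono = λ _ → true , All.tabulate (λ _ → refl)
  }

corollary79 : (𝒱 : PropositionalVariables) →
    let open MLL✠ 𝒱 in
    (S : Hypergraph) (Γ : Sequent) →
    AtomicallyTestable S Γ →
    ¬ Correct S →
    ∃[ Ts ] Pointwise _∈tests_ Ts Γ ×
      (∃[ S₀ ] NormalFormOf (S :: ∥⋯∥ Ts) S₀) ×
      (∀ S₀ → NormalFormOf (S :: ∥⋯∥ Ts) S₀ →
        ¬ Correct S₀ ×
        ((∃[ k ] 2 ≤ k × S₀ ≡ hypergraph (replicate k (daimon [])) []) ⊎ CyclicCut S₀))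
corollary79 𝒱 S Γ S-testable incorrect with χ (links S) ℤ.≟ 1ℤ
... | no χ≢1 = Testing.conclude 𝒱 S-testable (constant-colouring S) (inj₁ χ≢1)
... | yes χ≡1 with Parsing.sequentialise 𝒱 S-testable χ≡1
...   | inj₁ correct = contradiction correct incorrect
...   | inj₂ (hue , colouring , separated) = Testing.conclude 𝒱 S-testable colouring (inj₂ separated)
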